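{- Let $G$ be a cyclically $4$-edge-connected cubic graph with a $2$-factor $C$ containing exactly two odd circuits $N_1,N_2$ and at least one even circuit $W$. Let $x_1y_1$, $y_1y_2$, $y_2x_2$ be edges of $G$ with $x_1\in V(N_1)$, $x_2\in V(N_2)$ and $y_1,y_2\in V(W)$. For $i\in\{1,2\}$ let $u_i,v_i$ be the two neighbours of $x_i$ on $N_i$, and let $w_i$ be the neighbour of $y_i$ on $W$ different from $y_{3-i}$. Let $F=G-E(C)$ and let $M$ be a maximum matching in $C-\{x_1,y_1,y_2,x_2\}$. Let $Z$ be the set consisting of, for $i\in\{1,2\}$, the edges of $N_i$ not incident with $x_i$ but incident with $u_i$ or $v_i$, and the edges of $W$ incident with $w_i$ but not incident with $y_i$ (i.e. not incident with $y_1$ or $y_2$). Suppose that: (i) there exist a smooth orientation of the circuits of the subgraph with edge set $(E(F)\setminus\{x_1y_1,x_2y_2\})\cup M$ and a smooth orientation of $C$ which agree on all edges of $Z$; (ii) the graph $G\sim x_1y_1\sim x_2y_2$ is cyclically $3$-edge-connected; and (iii) $G\sim x_1y_1\sim x_2y_2$ has no cycle-separating $3$-edge-cut $\{e_1,e_2,e_3\}$ with $e_1\in\{u_1v_1,u_2v_2,w_1w_2\}$ and $e_2,e_3\in (E(F)\setminus\{x_1y_1,x_2y_2\})\cup M$. Then $fn(G)=2$.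
   Context: A circuit is a connected $2$-regular graph; a cycle is a graph in which every vertex has even degree. A graph is cyclically $k$-edge-connected if the removal of fewer than $k$ edges cannot separate it into two components that both contain a cycle; an edge-cut is cycle-separating if both sides contain a cycle. A smooth orientation of a set of edge-disjoint circuits is an orientation in which, for every circuit of the set, each vertex of that circuit has exactly one incoming and one outgoing edge of that circuit. For an edge $e$ of a cubic graph $G$, $G\sim e$ denotes the cubic graph obtained from $G-e$ by smoothing the two resulting vertices of degree $2$ (each is removed and its two neighbours are joined by a new edge); thus in $G\sim x_1y_1\sim x_2y_2$ the edges $u_1v_1$, $u_2v_2$, $w_1w_2$ are the new edges arising from smoothing, and the other edges are identified with edges of $G$. An orientation is strong if for every ordered pair of distinct vertices $u,v$ there is a directed $uv$-path. An edge is deletable in an orientation $(G,o)$ if the restriction of $o$ to the remaining edges is a strong orientation of the graph with that edge removed. For a $3$-edge-connected graph $G$, $fn(G)$ is the minimum number $k$ such that $G$ admits $k$ orientations with every edge deletable in at least one of them. -}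

module Defs where

open import Data.Bool using (Bool; true; false; not; _∧_)
open import Data.Fin using (Fin; zero; suc; _≟_)
open import Data.Fin.Subset
  using (Subset; inside; _∈_; _⊆_; _∩_; _∪_; _─_; _-_; ∁; ⁅_⁆; ∣_∣; Nonempty)
open import Data.Fin.Subset.Properties using (_∈?_; ⊆-trans; p∩q⊆q; p─q⊆p)
open import Data.List using (List; []; _∷_; length; map; filter; allFin; cartesianProduct)
open import Data.Nat using (ℕ; zero; suc; _≤_; _<_; _%_)
open import Data.Product using (Σ; ∃; ∃-syntax; ∃₂; _×_; _,_; proj₁; proj₂)
import Data.Vec as Vec
open import Relation.Binary.Construct.Closure.ReflexiveTransitive using (Star)
open import Relation.Binary.PropositionalEquality using (_≡_; _≢_)
open import Relation.Nullary using (¬_)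
open import Relation.Nullary.Decidable using (_×-dec_)

private
  variable
    n m : ℕ

-- The edges (under an arbitrary assignment of ends) with both ends in S.
inducedBy : (Fin m → Fin n × Fin n) → Subset n → Subset m
inducedBy ends S =
  Vec.tabulate λ e → Vec.lookup S (proj₁ (ends e)) ∧ Vec.lookup S (proj₂ (ends e))

-- A finite graph, parallel edges and loops allowed, whose vertices and edges
-- are subsets of the label sets Fin n and Fin m: labels survive the deletion
-- of vertices and edges, so edges of a smaller graph can be identified with
-- edges of the original one.  The order of the two ends of an edge carries no
-- graph-theoretic meaning; it only serves as a reference for orientations.
record Graph (n m : ℕ) : Set where
  field
    V    : Subset n
    E    : Subset m
    ends : Fin m → Fin n × Fin n
    wf   : E ⊆ inducedBy ends V

open Graph public

-- Half-edges: an edge together with a direction of traversal.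
Dart : ℕ → Set
Dart m = Fin m × Bool

tail head : Graph n m → Dart m → Fin n
tail G (e , false) = proj₁ (ends G e)
tail G (e , true)  = proj₂ (ends G e)
head G (e , b)     = tail G (e , not b)

Incident : Graph n m → Fin m → Fin n → Set
Incident G e v = ∃[ b ] tail G (e , b) ≡ v

Joins : Graph n m → Fin m → Fin n → Fin n → Set
Joins G e u v = ∃[ b ] tail G (e , b) ≡ u × head G (e , b) ≡ v

-- Below, a set D of edges stands for the subgraph formed by D and its ends.

VertexOf : Graph n m → Subset m → Fin n → Set
VertexOf G D v = ∃[ e ] e ∈ D × Incident G e v

Adjacent : Graph n m → Subset m → Fin n → Fin n → Set
Adjacent G D u v = ∃[ e ] e ∈ D × Joins G e u v

Connected : Graph n m → Subset m → Fin n → Fin n → Set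
Connected G D = Star (Adjacent G D)

dartsAt : Graph n m → Subset m → Fin n → List (Dart m)
dartsAt {m = m} G D v =
  filter (λ d → (proj₁ d ∈? D) ×-dec (tail G d ≟ v))
         (cartesianProduct (allFin m) (false ∷ true ∷ []))

-- A loop contributes 2.
degree : Graph n m → Subset m → Fin n → ℕ
degree G D v = length (dartsAt G D v)

Cubic : Graph n m → Set
Cubic G = ∀ v → v ∈ V G → degree G (E G) v ≡ 3

Circuit : Graph n m → Subset m → Set
Circuit G D =
    D ⊆ E G
  × Nonempty D
  × (∀ v → VertexOf G D v → degree G D v ≡ 2)
  × (∀ u v → VertexOf G D u → VertexOf G D v → Connected G D u v)

OddSize EvenSize : Subset m → Set
OddSize  D = ∣ D ∣ % 2 ≡ 1
EvenSize D = ∣ D ∣ % 2 ≡ 0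

TwoFactor : Graph n m → Subset m → Set
TwoFactor G C = C ⊆ E G × (∀ v → v ∈ V G → degree G C v ≡ 2)

-- The edges of the subgraph D that remain after deleting the vertices in X.
deleteVertices : Graph n m → Subset m → Subset n → Subset m
deleteVertices G D X = D ∩ inducedBy (ends G) (∁ X)

Matching : Graph n m → Subset m → Subset m → Set
Matching G D M = M ⊆ D × (∀ v → degree G M v ≤ 1)

MaximumMatching : Graph n m → Subset m → Subset m → Set
MaximumMatching G D M = Matching G D M × (∀ M′ → Matching G D M′ → ∣ M′ ∣ ≤ ∣ M ∣)

infixl 5 _∖_

_∖_ : Graph n m → Subset m → Graph n m
G ∖ X = record
  { V    = V G
  ; E    = E G ─ X
  ; ends = ends G
  ; wf   = ⊆-trans (p─q⊆p (E G) X) (wf G)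
  }

-- Removing fewer than k edges never leaves two different components each of
-- which contains a circuit.
CyclicallyEdgeConnected : ℕ → Graph n m → Set
CyclicallyEdgeConnected k G =
  ∀ X → X ⊆ E G → ∣ X ∣ < k →
  ¬ (∃₂ λ D₁ D₂ → Circuit (G ∖ X) D₁ × Circuit (G ∖ X) D₂ ×
     ∃₂ λ u v → VertexOf G D₁ u × VertexOf G D₂ v × ¬ Connected G (E G ─ X) u v)

-- The edges with exactly one end in S.
boundary : Graph n m → Subset n → Subset m
boundary G S = E G ─ (inducedBy (ends G) S ∪ inducedBy (ends G) (∁ S))

CycleSeparatingCut : Graph n m → Subset m → Set
CycleSeparatingCut G K =
  ∃[ S ] K ≡ boundary G S
       × (∃[ D ] Circuit G D × D ⊆ inducedBy (ends G) S)
       × (∃[ D ] Circuit G D × D ⊆ inducedBy (ends G) (∁ S))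

-- The two ends of the new edge when a vertex v is smoothed, given the list of
-- its neighbours.  If v does not have degree 2, the value (v , v) makes the
-- new edge disappear together with v.
newEnds : Fin n → List (Fin n) → Fin n × Fin n
newEnds v (a ∷ b ∷ []) = a , b
newEnds v _            = v , v

-- Smoothing a vertex of degree 2: the new edge gets the label zero, and an
-- old edge e gets the label suc e.
smooth : Graph n m → Fin n → Graph n (suc m)
smooth {n} {m} G v = record
  { V    = V G - v
  ; E    = (inside Vec.∷ E G) ∩ inducedBy ends′ (V G - v)
  ; ends = ends′
  ; wf   = p∩q⊆q (inside Vec.∷ E G) (inducedBy ends′ (V G - v))
  }
  where
  ends′ : Fin (suc m) → Fin n × Fin n
  ends′ zero    = newEnds v (map (head G) (dartsAt G (E G) v))
  ends′ (suc e) = ends G e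

infixl 5 _∼_

-- The labels 0 and 1 are those of the two new edges, and an old edge e gets
-- the label 2 ↑ʳ e.
_∼_ : Graph n m → Fin m → Graph n (suc (suc m))
G ∼ e = smooth (smooth (G ∖ ⁅ e ⁆) (proj₁ (ends G e))) (proj₂ (ends G e))

-- The edge e is directed from tail (e , o e) to head (e , o e).
Orientation : ℕ → Set
Orientation m = Fin m → Bool

outDegree inDegree : Graph n m → Orientation m → Subset m → Fin n → ℕ
outDegree {m = m} G o D v =
  length (filter (λ e → (e ∈? D) ×-dec (tail G (e , o e) ≟ v)) (allFin m))
inDegree {m = m} G o D v =
  length (filter (λ e → (e ∈? D) ×-dec (head G (e , o e) ≟ v)) (allFin m))

-- o restricts to a smooth orientation of the circuits of the subgraph A.
SmoothOn : Graph n m → Subset m → Orientation m → Set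
SmoothOn G A o =
  ∀ D → Circuit G D → D ⊆ A → ∀ v → VertexOf G D v →
  inDegree G o D v ≡ 1 × outDegree G o D v ≡ 1

Arc : Graph n m → Orientation m → Fin n → Fin n → Set
Arc G o u v = ∃[ e ] e ∈ E G × tail G (e , o e) ≡ u × head G (e , o e) ≡ v

Strong : Graph n m → Orientation m → Set
Strong G o = ∀ u v → u ∈ V G → v ∈ V G → u ≢ v → Star (Arc G o) u v

Deletable : Graph n m → Orientation m → Fin m → Set
Deletable G o e = Strong (G ∖ ⁅ e ⁆) o

CoveredByOrientations : Graph n m → ℕ → Set
CoveredByOrientations {m = m} G k =
  Σ (Fin k → Orientation m) λ os → ∀ e → e ∈ E G → ∃[ i ] Deletable G (os i) e

-- fn(G) = k, as a relation because a minimum need not exist for every graph.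
FrankNumber : Graph n m → ℕ → Set
FrankNumber G k =
  CoveredByOrientations G k × (∀ j → CoveredByOrientations G j → k ≤ j)

{-# OPTIONS --safe #-}
-- Let f be the ±1-flow on C given by the smooth orientation of C, and g the ±1-flow
-- on (F ─ {x₁y₁, x₂y₂}) ∪ M given by the other smooth orientation (M is perfect off
-- the path x₁y₁y₂x₂, so that set is 2-regular there).  Both are flows on the cubic
-- graph H obtained by the two smoothings, and φ₁ = f − 2g, φ₂ = 2f + g vanish nowhere
-- on H.  In a graph without edge cuts of size less than 3, orienting the edges by the
-- sign of a nowhere-zero flow makes every edge of value ±1 deletable: an edge cut in
-- which it is the only edge of its direction would have at most two edges.  Every edge
-- of H has value ±1 in φ₁ or φ₂.  The three new edges have value ±1 in φ₁ and ±2 in φ₂;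
-- they are deletable in φ₂ too, because a cut obstructing this would be a 3-cut whose
-- other two edges have value ±1, hence lie in the support of g.  By (iii) it would cut
-- off a single vertex, an end of the new edge, where by (i) the matching edge has
-- value ±3.
--
-- In G orient x₁y₁ and x₂y₂ as x₁ → y₁, y₂ → x₂ for φ₁ and as y₁ → x₁, x₂ → y₂ for φ₂.
-- When one edge of the path replaced by a new edge of H is deleted, the rest of that
-- path together with x₁y₁ or x₂y₂ still consists of directed ears attached to H minus
-- the new edge, provided the orientation is the right one of the two.
--
-- One orientation never suffices, as each vertex would need out- and indegree 2.
module Submission where

open import Defs
open import Algebra.Core using (Op₂)
open import Algebra.Structures using (IsCommutativeMonoid)
open import Algebra.Bundles using (CommutativeRing)
open import Data.Bool as Bool using (Bool; true; false; not; _∧_; _xor_; if_then_else_)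
import Data.Bool.Properties as Bool
open import Data.Empty using (⊥; ⊥-elim)
open import Data.Fin using (Fin; zero; suc; _≟_; _↑ˡ_; _↑ʳ_)
import Data.Fin as Fin
import Data.Fin.Properties as Fin
open import Data.Fin.Subset using (Subset; inside; _∈_; _∉_; _⊆_; _∪_; _∩_; _─_; _-_; ∁; ⁅_⁆; ∣_∣; Nonempty)
open import Data.Fin.Subset using () renaming (⊥ to ∅)
open import Data.Fin.Subset.Properties
open import Data.Integer as ℤ using (ℤ; 0ℤ; 1ℤ; -1ℤ)
import Data.Integer.Properties as ℤ
import Data.Integer.Tactic.RingSolver as ℤ-Solver
open import Data.List using (List; []; _∷_; length; map; filter; allFin; cartesianProduct)
import Data.List as List
import Data.List.Properties as List
import Data.List.Membership.Propositional as List
import Data.List.Membership.Propositional.Properties as List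
open import Data.List.Relation.Unary.Any using (here; there)
open import Data.List.Relation.Unary.All using ([]; _∷_)
import Data.List.Relation.Unary.All as All
open import Data.List.Relation.Unary.AllPairs using ([]; _∷_)
open import Data.List.Relation.Unary.Unique.Propositional using (Unique)
import Data.List.Relation.Unary.Unique.Propositional.Properties as Unique
open import Data.Nat as ℕ using (ℕ; zero; suc; _+_; _*_; _≤_; _<_; _%_; z≤n; s≤s; _^_)
import Data.Nat.Properties as ℕ
import Data.Nat.Induction as ℕ
open import Data.Product using (∃; ∃-syntax; ∃₂; _×_; _,_; proj₁; proj₂)
import Data.Product.Properties as Product
open import Data.Sum using (_⊎_; inj₁; inj₂; [_,_]′)
import Data.Sum as Sum
import Data.Vec as Vec
import Data.Vec.Properties as Vec
open import Function using (_∘_; id; flip; case_of_)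
open import Induction.WellFounded using (Acc; acc)
open import Relation.Binary.Construct.Closure.ReflexiveTransitive using (Star; ε; _◅_; _◅◅_; kleisliStar)
import Relation.Binary.Construct.Closure.ReflexiveTransitive as Star
open import Relation.Binary.PropositionalEquality using (_≡_; _≢_; refl; sym; trans; cong; cong₂; subst; subst₂; module ≡-Reasoning)
open import Relation.Nullary using (¬_; Dec; yes; no; does; contradiction)
open import Relation.Nullary.Decidable using (_×-dec_; _⊎-dec_; ¬?; decidable-stable; map′; dec-true; dec-false; toSum)

-- The coefficients of `φ₁` and `φ₂` are chosen so that an edge carrying only `f` is a unit in `φ₁`,
-- one carrying only `g` is a unit in `φ₂`, and one carrying both has absolute values 1 and 3, or 3
-- and 1, according as `f` and `g` agree or differ there. At the path vertices `g` vanishes, so `φ₁`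
-- and `φ₂` equal `f` and `2f`: the remaining edges there are directed alike in both orientations
-- and only x₁y₁, x₂y₂ turn round. A given edge needs one particular direction of these two, decided
-- by the sign of `f`. Hence the right orientation may be either one, and the new edges have to be
-- deletable for both flows. Cyclic edge-connectivity speaks of circuits, the flow argument of
-- arbitrary cuts. In a cubic graph a dart count bridges the gap: a shore with at most three leaving
-- edges is a single vertex or contains a circuit. That M is perfect is a matter of parity: off the
-- path each circuit of C keeps an even number of vertices. A subgraph of C with odd degree exactly
-- at these vertices becomes, after adding N₁, N₂ or W modulo 2 where necessary, a perfect matching
-- there, and M is at least as large.

private
  variable
    n m k : ℕ

-- Finite sums

record Enumeration (I : Set) : Set where
  field
    elements : List I
    complete : ∀ i → i List.∈ elements
    unique   : Unique elements

open Enumeration {{...}}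

elementsOf : (I : Set) {{_ : Enumeration I}} → List I
elementsOf I = elements

instance
  Fin-enumeration : Enumeration (Fin n)
  Fin-enumeration = record
    { elements = allFin _
    ; complete = List.∈-allFin
    ; unique   = Unique.allFin⁺ _
    }

bools : List Bool
bools = false ∷ true ∷ []

instance
  Dart-enumeration : Enumeration (Fin m × Bool)
  Dart-enumeration = record
    { elements = cartesianProduct (allFin _) bools
    ; complete = λ (e , b) → List.∈-cartesianProduct⁺ (List.∈-allFin e) (bool b)
    ; unique   = Unique.cartesianProduct⁺ (Unique.allFin⁺ _)
                   (((λ ()) ∷ []) ∷ [] ∷ [])
    }
    where
    bool : ∀ b → b List.∈ bools
    bool false = here refl
    bool true  = there (here refl)

-- Used for three monoids: counts in `ℕ`, flow values in `ℤ`, and parities in `Bool` under `xor`.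
module Summation {A : Set} {_∙_ : Op₂ A} {𝟘 : A} (isCM : IsCommutativeMonoid _≡_ _∙_ 𝟘) where
  open IsCommutativeMonoid isCM
    using (assoc; comm; identityˡ; identityʳ)
  open ≡-Reasoning

  when : {P : Set} → Dec P → A → A
  when P? x = if does P? then x else 𝟘

  when-yes : {P : Set} (P? : Dec P) {x : A} → P → when P? x ≡ x
  when-yes P? {x} p = cong (if_then x else 𝟘) (dec-true P? p)

  when-no : {P : Set} (P? : Dec P) {x : A} → ¬ P → when P? x ≡ 𝟘
  when-no P? {x} ¬p = cong (if_then x else 𝟘) (dec-false P? ¬p)

  when-cong : {P Q : Set} (P? : Dec P) (Q? : Dec Q) {x y : A} →
              (P → Q) → (Q → P) → (P → x ≡ y) → when P? x ≡ when Q? y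
  when-cong (yes p) Q? f g h = trans (h p) (sym (when-yes Q? (f p)))
  when-cong (no ¬p) Q? f g h = sym (when-no Q? (¬p ∘ g))

  sum : {I : Set} → (I → A) → List I → A
  sum f = List.foldr (λ i s → f i ∙ s) 𝟘

  interchange : ∀ a b c d → (a ∙ b) ∙ (c ∙ d) ≡ (a ∙ c) ∙ (b ∙ d)
  interchange a b c d = begin
    (a ∙ b) ∙ (c ∙ d) ≡⟨ assoc a b (c ∙ d) ⟩
    a ∙ (b ∙ (c ∙ d)) ≡⟨ cong (a ∙_) (sym (assoc b c d)) ⟩
    a ∙ ((b ∙ c) ∙ d) ≡⟨ cong (λ z → a ∙ (z ∙ d)) (comm b c) ⟩
    a ∙ ((c ∙ b) ∙ d) ≡⟨ cong (a ∙_) (assoc c b d) ⟩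
    a ∙ (c ∙ (b ∙ d)) ≡⟨ sym (assoc a c (b ∙ d)) ⟩
    (a ∙ c) ∙ (b ∙ d) ∎

  sum-cong : {I : Set} {f g : I → A} → (∀ i → f i ≡ g i) → ∀ xs → sum f xs ≡ sum g xs
  sum-cong h []       = refl
  sum-cong h (x ∷ xs) = cong₂ _∙_ (h x) (sum-cong h xs)

  sum-𝟘 : {I : Set} (xs : List I) → sum (λ _ → 𝟘) xs ≡ 𝟘
  sum-𝟘 []       = refl
  sum-𝟘 (x ∷ xs) = trans (identityˡ _) (sum-𝟘 xs)

  sum-∙ : {I : Set} (f g : I → A) → ∀ xs → sum (λ i → f i ∙ g i) xs ≡ sum f xs ∙ sum g xs
  sum-∙ f g []       = sym (identityˡ 𝟘)
  sum-∙ f g (x ∷ xs) = trans (cong ((f x ∙ g x) ∙_) (sum-∙ f g xs)) (interchange _ _ _ _)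

  sum-swap : {I J : Set} (f : I → J → A) (xs : List I) (ys : List J) →
             sum (λ i → sum (f i) ys) xs ≡ sum (λ j → sum (λ i → f i j) xs) ys
  sum-swap f []       ys = sym (sum-𝟘 ys)
  sum-swap f (x ∷ xs) ys =
    trans (cong (sum (f x) ys ∙_) (sum-swap f xs ys)) (sym (sum-∙ (f x) _ ys))

  sum-++ : {I : Set} (f : I → A) (xs ys : List I) → sum f (xs List.++ ys) ≡ sum f xs ∙ sum f ys
  sum-++ f []       ys = sym (identityˡ _)
  sum-++ f (x ∷ xs) ys = trans (cong (f x ∙_) (sum-++ f xs ys)) (sym (assoc _ _ _))

  sum-single : {I : Set} (f : I → A) {xs : List I} {x : I} → Unique xs → x List.∈ xs →
               (∀ i → i ≢ x → f i ≡ 𝟘) → sum f xs ≡ f x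
  sum-single f {_ ∷ xs} (x∉ ∷ u) (here refl) h =
    trans (cong (f _ ∙_) (sum-all-𝟘 xs x∉)) (identityʳ _)
    where
    sum-all-𝟘 : ∀ ys → All.All (_ ≢_) ys → sum f ys ≡ 𝟘
    sum-all-𝟘 []       []       = refl
    sum-all-𝟘 (y ∷ ys) (p ∷ ps) =
      trans (cong₂ _∙_ (h y (p ∘ sym)) (sum-all-𝟘 ys ps)) (identityˡ _)
  sum-single f (y∉ ∷ u) (there x∈) h =
    trans (cong₂ _∙_ (h _ (All.lookup y∉ x∈)) (sum-single f u x∈ h)) (identityˡ _)

  -- The sum always runs over the whole enumeration, with `𝟘` off `P`; changing the range then only
  -- means changing the predicate.
  ∑ : {I : Set} {{_ : Enumeration I}} {P : I → Set} → (∀ i → Dec (P i)) → (I → A) → A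
  ∑ P? f = sum (λ i → when (P? i) (f i)) elements

  module _ {I : Set} {{_ : Enumeration I}} where

    ∑-cong : {P Q : I → Set} (P? : ∀ i → Dec (P i)) (Q? : ∀ i → Dec (Q i)) {f g : I → A} →
             (∀ i → P i → Q i) → (∀ i → Q i → P i) → (∀ i → P i → f i ≡ g i) →
             ∑ P? f ≡ ∑ Q? g
    ∑-cong P? Q? pq qp h =
      sum-cong (λ i → when-cong (P? i) (Q? i) (pq i) (qp i) (h i)) elements

    ∑-cong′ : {P : I → Set} (P? : ∀ i → Dec (P i)) {f g : I → A} →
              (∀ i → P i → f i ≡ g i) → ∑ P? f ≡ ∑ P? g
    ∑-cong′ P? = ∑-cong P? P? (λ _ p → p) (λ _ p → p)

    ∑-∙ : {P : I → Set} (P? : ∀ i → Dec (P i)) (f g : I → A) →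
          ∑ P? (λ i → f i ∙ g i) ≡ ∑ P? f ∙ ∑ P? g
    ∑-∙ P? f g = trans (sum-cong (λ i → lemma (does (P? i)) (f i) (g i)) (elementsOf I))
                       (sum-∙ _ _ (elementsOf I))
      where
      lemma : ∀ b x y → (if b then x ∙ y else 𝟘) ≡ (if b then x else 𝟘) ∙ (if b then y else 𝟘)
      lemma true  x y = refl
      lemma false x y = sym (identityˡ 𝟘)

    ∑-𝟘 : {P : I → Set} (P? : ∀ i → Dec (P i)) (f : I → A) →
          (∀ i → P i → f i ≡ 𝟘) → ∑ P? f ≡ 𝟘
    ∑-𝟘 P? f h = trans (sum-cong (λ i → lemma i) (elementsOf I)) (sum-𝟘 (elementsOf I))
      where
      lemma : ∀ i → when (P? i) (f i) ≡ 𝟘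
      lemma i with P? i
      ... | yes p = h i p
      ... | no ¬p = refl

    ∑-single : {P : I → Set} (P? : ∀ i → Dec (P i)) (f : I → A) {x : I} →
               P x → (∀ i → P i → i ≡ x) → ∑ P? f ≡ f x
    ∑-single P? f {x} px h =
      trans (sum-single _ unique (complete x) (λ i i≢x → when-no (P? i) (λ p → i≢x (h i p))))
            (when-yes (P? x) px)

    ∑-split : {P Q : I → Set} (P? : ∀ i → Dec (P i)) (Q? : ∀ i → Dec (Q i)) (f : I → A) →
              ∑ P? f ≡ ∑ (λ i → P? i ×-dec Q? i) f ∙ ∑ (λ i → P? i ×-dec ¬? (Q? i)) f
    ∑-split P? Q? f = trans (sum-cong (λ i → lemma i) (elementsOf I)) (sum-∙ _ _ (elementsOf I))
      where
      lemma : ∀ i → when (P? i) (f i) ≡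
              when (P? i ×-dec Q? i) (f i) ∙ when (P? i ×-dec ¬? (Q? i)) (f i)
      lemma i with does (P? i) | does (Q? i)
      ... | false | _     = sym (identityˡ _)
      ... | true  | true  = sym (identityʳ _)
      ... | true  | false = sym (identityˡ _)

  -- The same set of pairs may be described differently on the two sides; the last two arguments
  -- match the descriptions.
  ∑-swap : {I J : Set} {{_ : Enumeration I}} {{_ : Enumeration J}}
           {P : I → Set} {Q : I → J → Set} {P′ : J → Set} {Q′ : J → I → Set}
           (P? : ∀ i → Dec (P i)) (Q? : ∀ i j → Dec (Q i j))
           (P′? : ∀ j → Dec (P′ j)) (Q′? : ∀ j i → Dec (Q′ j i)) (f : I → J → A) →
           (∀ i j → P i → Q i j → P′ j × Q′ j i) → (∀ i j → P′ j → Q′ j i → P i × Q i j) →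
           ∑ P? (λ i → ∑ (Q? i) (f i)) ≡ ∑ P′? (λ j → ∑ (Q′? j) (λ i → f i j))
  ∑-swap {I} {J} P? Q? P′? Q′? f to from = begin
    ∑ P? (λ i → ∑ (Q? i) (f i))
      ≡⟨ sum-cong (λ i → push (P? i) (Q? i) (f i)) (elementsOf I) ⟩
    sum (λ i → sum (λ j → when (P? i ×-dec Q? i j) (f i j)) (elementsOf J)) (elementsOf I)
      ≡⟨ sum-swap _ (elementsOf I) (elementsOf J) ⟩
    sum (λ j → sum (λ i → when (P? i ×-dec Q? i j) (f i j)) (elementsOf I)) (elementsOf J)
      ≡⟨ sum-cong (λ j → sum-cong (λ i → when-cong (P? i ×-dec Q? i j) (P′? j ×-dec Q′? j i)
           (λ (p , q) → to i j p q) (λ (p , q) → from i j p q) (λ _ → refl)) (elementsOf I)) (elementsOf J) ⟩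
    sum (λ j → sum (λ i → when (P′? j ×-dec Q′? j i) (f i j)) (elementsOf I)) (elementsOf J)
      ≡⟨ sym (sum-cong (λ j → push (P′? j) (Q′? j) (λ i → f i j)) (elementsOf J)) ⟩
    ∑ P′? (λ j → ∑ (Q′? j) (λ i → f i j)) ∎
    where
    push : {K : Set} {{_ : Enumeration K}} {S : Set} {T : K → Set} (S? : Dec S)
           (T? : ∀ j → Dec (T j)) (g : K → A) →
           when S? (∑ T? g) ≡ sum (λ j → when (S? ×-dec T? j) (g j)) elements
    push {K} S? T? g with does S?
    ... | true  = refl
    ... | false = sym (sum-𝟘 (elementsOf K))

  -- Both sides equal the double sum over the pairs (i , j) with R j ≡ i.
  ∑-reindex : {I J : Set} {{_ : Enumeration I}} {{_ : Enumeration J}}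
              {P : I → Set} {P′ : J → Set} (P? : ∀ i → Dec (P i)) (P′? : ∀ j → Dec (P′ j))
              (_≟′_ : (i i′ : I) → Dec (i ≡ i′)) (R : J → I) (f : I → A) →
              (∀ j → P′ j → P (R j)) →
              (∀ j j′ → P′ j → P′ j′ → R j ≡ R j′ → j ≡ j′) →
              (∀ i → P i → ∃[ j ] P′ j × R j ≡ i) →
              ∑ P′? (f ∘ R) ≡ ∑ P? f
  ∑-reindex {P = P} {P′} P? P′? _≟′_ R f into inj onto = begin
    ∑ P′? (f ∘ R)
      ≡⟨ ∑-cong′ P′? (λ j _ → sym (∑-single (λ i → R j ≟′ i) f refl (λ i → sym))) ⟩
    ∑ P′? (λ j → ∑ (λ i → R j ≟′ i) f)
      ≡⟨ ∑-swap P′? (λ j i → R j ≟′ i) P? (λ i j → P′? j ×-dec (R j ≟′ i)) (λ _ i → f i)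
           (λ { j i p refl → into j p , p , refl }) (λ { j i p (p′ , q) → p′ , q }) ⟩
    ∑ P? (λ i → ∑ (λ j → P′? j ×-dec (R j ≟′ i)) (λ _ → f i))
      ≡⟨ ∑-cong′ P? (λ i p → let (j , p′ , q) = onto i p in
           ∑-single (λ j → P′? j ×-dec (R j ≟′ i)) (λ _ → f i) (p′ , q)
             (λ { j′ (p″ , q′) → inj j′ j p″ p′ (trans q′ (sym q)) })) ⟩
    ∑ P? f ∎

  ∑-darts : {P : Fin m × Bool → Set} (P? : ∀ d → Dec (P d)) (f : Fin m × Bool → A) →
            ∑ P? f ≡ sum (λ e → when (P? (e , false)) (f (e , false)) ∙
                                when (P? (e , true)) (f (e , true))) (allFin m)
  ∑-darts {m = m} P? f = go (allFin m)
    where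
    g = λ d → when (P? d) (f d)
    go : ∀ es → sum g (cartesianProduct es bools) ≡ sum (λ e → g (e , false) ∙ g (e , true)) es
    go []       = refl
    go (e ∷ es) = trans (sym (assoc _ _ _)) (cong (_ ∙_) (go es))

module ℕ∑ = Summation ℕ.+-0-isCommutativeMonoid
module ℤ∑ = Summation ℤ.+-0-isCommutativeMonoid
xor-isCommutativeMonoid : IsCommutativeMonoid _≡_ _xor_ false
xor-isCommutativeMonoid = CommutativeRing.+-isCommutativeMonoid Bool.xor-∧-commutativeRing

module X∑ = Summation xor-isCommutativeMonoid

∑-homo : {A B : Set} {_∙_ : Op₂ A} {_∘′_ : Op₂ B} {a : A} {b : B}
         (M : IsCommutativeMonoid _≡_ _∙_ a) (N : IsCommutativeMonoid _≡_ _∘′_ b)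
         (h : A → B) → h a ≡ b → (∀ x y → h (x ∙ y) ≡ (h x ∘′ h y)) →
         {I : Set} {{_ : Enumeration I}} {P : I → Set} (P? : ∀ i → Dec (P i)) (f : I → A) →
         h (Summation.∑ M P? f) ≡ Summation.∑ N P? (h ∘ f)
∑-homo {_∙_ = _∙_} {_∘′_} {a} {b} M N h h-a h-∙ P? f = go elements
  where
  when-h : ∀ c x → h (if c then x else a) ≡ (if c then h x else b)
  when-h true  x = refl
  when-h false x = h-a
  go : ∀ xs → h (Summation.sum M (λ i → Summation.when M (P? i) (f i)) xs) ≡
              Summation.sum N (λ i → Summation.when N (P? i) (h (f i))) xs
  go []       = h-a
  go (x ∷ xs) = trans (h-∙ _ _) (cong₂ _∘′_ (when-h (does (P? x)) (f x)) (go xs))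

∑1 : {I : Set} {{_ : Enumeration I}} {P : I → Set} → (∀ i → Dec (P i)) → ℕ
∑1 P? = ℕ∑.∑ P? (λ _ → 1)

length-filter : {I : Set} {{_ : Enumeration I}} {P : I → Set} (P? : ∀ i → Dec (P i)) →
                length (filter P? (elementsOf I)) ≡ ∑1 P?
length-filter {I} P? = go (elementsOf I)
  where
  go : ∀ xs → length (filter P? xs) ≡ ℕ∑.sum (λ i → ℕ∑.when (P? i) 1) xs
  go []       = refl
  go (x ∷ xs) with does (P? x)
  ... | true  = cong suc (go xs)
  ... | false = go xs

∣∣-∑1 : (S : Subset n) → ∣ S ∣ ≡ ∑1 (_∈? S)
∣∣-∑1 = card
  where
  shift : ∀ {n} (b : Bool) (S : Subset n) {k} (f : Fin k → Fin n) →
          ℕ∑.sum (λ i → ℕ∑.when (i ∈? S) 1) (List.tabulate f) ≡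
          ℕ∑.sum (λ i → ℕ∑.when (i ∈? (b Vec.∷ S)) 1) (List.tabulate (suc ∘ f))
  shift b S {zero}  f = refl
  shift b S {suc k} f = cong₂ _+_
    (ℕ∑.when-cong (f zero ∈? S) (suc (f zero) ∈? (b Vec.∷ S)) Vec.there drop-there (λ _ → refl))
    (shift b S (f ∘ suc))
  card : ∀ {n} (S : Subset n) → ∣ S ∣ ≡ ℕ∑.sum (λ i → ℕ∑.when (i ∈? S) 1) (List.tabulate id)
  card Vec.[]            = refl
  card (true  Vec.∷ S) = cong suc (trans (card S) (shift true S id))
  card (false Vec.∷ S) = trans (card S) (shift false S id)

module _ {I : Set} {{_ : Enumeration I}} where

  term≤∑ : {P : I → Set} (P? : ∀ i → Dec (P i)) (_≟′_ : (i j : I) → Dec (i ≡ j))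
           (f : I → ℕ) {i : I} → P i → f i ≤ ℕ∑.∑ P? f
  term≤∑ P? _≟′_ f {i} p = subst (f i ≤_)
    (sym (trans (ℕ∑.∑-split P? (_≟′ i) f)
      (cong (_+ ℕ∑.∑ (λ j → P? j ×-dec ¬? (j ≟′ i)) f) (ℕ∑.∑-single (λ j → P? j ×-dec (j ≟′ i)) f (p , refl) (λ _ → proj₂)))))
    (ℕ.m≤m+n _ _)

  ∑≡0 : {P : I → Set} (P? : ∀ i → Dec (P i)) (_≟′_ : (i j : I) → Dec (i ≡ j))
        (f : I → ℕ) → ℕ∑.∑ P? f ≡ 0 → ∀ {i} → P i → f i ≡ 0
  ∑≡0 P? _≟′_ f h p = ℕ.n≤0⇒n≡0 (subst (_ ≤_) h (term≤∑ P? _≟′_ f p))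

  ∑1-nonempty : {P : I → Set} (P? : ∀ i → Dec (P i)) → 1 ≤ ∑1 P? → ∃ P
  ∑1-nonempty {P} P? = go (elementsOf I)
    where
    go : ∀ xs → 1 ≤ ℕ∑.sum (λ i → ℕ∑.when (P? i) 1) xs → ∃ P
    go (x ∷ xs) h with P? x
    ... | yes p = x , p
    ... | no  _ = go xs h

  -- Split `Q` along `P`: the counts leave nothing for the part of `Q` outside `P`. This yields that
  -- a circuit of a 2-factor uses all factor edges at its vertices.
  ∑1-antimono : {P Q : I → Set} (P? : ∀ i → Dec (P i)) (Q? : ∀ i → Dec (Q i))
                (_≟′_ : (i j : I) → Dec (i ≡ j)) →
                (∀ i → P i → Q i) → ∑1 Q? ≤ ∑1 P? → ∀ {i} → Q i → P i
  ∑1-antimono P? Q? _≟′_ sub le {i} q = decidable-stable (P? i) λ ¬p →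
    ℕ.1+n≢0 (∑≡0 (λ j → Q? j ×-dec ¬? (P? j)) _≟′_ (λ _ → 1)
      (ℕ.n≤0⇒n≡0 (ℕ.+-cancelˡ-≤ (∑1 P?) _ 0
        (subst₂ _≤_
          (trans (ℕ∑.∑-split Q? P? _)
            (cong (_+ ∑1 (λ j → Q? j ×-dec ¬? (P? j))) (ℕ∑.∑-cong (λ j → Q? j ×-dec P? j) P? (λ _ → proj₂)
              (λ j p → sub j p , p) (λ _ _ → refl))))
          (sym (ℕ.+-identityʳ _)) le)))
      (q , ¬p))

  ∑-mono-≤ : {P Q : I → Set} (P? : ∀ i → Dec (P i)) (Q? : ∀ i → Dec (Q i)) {f g : I → ℕ} →
             (∀ i → P i → Q i) → (∀ i → P i → f i ≤ g i) → ℕ∑.∑ P? f ≤ ℕ∑.∑ Q? g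
  ∑-mono-≤ P? Q? {f} {g} sub le = go (elementsOf I)
    where
    term : ∀ i → ℕ∑.when (P? i) (f i) ≤ ℕ∑.when (Q? i) (g i)
    term i with P? i
    ... | no  _ = z≤n
    ... | yes p = subst (f i ≤_) (sym (ℕ∑.when-yes (Q? i) (sub i p))) (le i p)
    go : ∀ xs → ℕ∑.sum (λ i → ℕ∑.when (P? i) (f i)) xs ≤ ℕ∑.sum (λ i → ℕ∑.when (Q? i) (g i)) xs
    go []       = z≤n
    go (x ∷ xs) = ℕ.+-mono-≤ (term x) (go xs)

module Fibres {A : Set} {_∙_ : Op₂ A} {𝟘 : A} (M : IsCommutativeMonoid _≡_ _∙_ 𝟘) where
  open Summation M

  -- With `t` the tail of a dart, this turns sums of degrees over vertices into sums over darts.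
  ∑-fibres : {I J : Set} {{_ : Enumeration I}} {{_ : Enumeration J}}
             {P : I → Set} {Q : J → Set} (P? : ∀ i → Dec (P i)) (Q? : ∀ j → Dec (Q j))
             (_≟′_ : (j j′ : J) → Dec (j ≡ j′)) (t : I → J) (f : I → A) →
             ∑ Q? (λ j → ∑ (λ i → P? i ×-dec (t i ≟′ j)) f) ≡ ∑ (λ i → P? i ×-dec Q? (t i)) f
  ∑-fibres P? Q? _≟′_ t f = trans
    (∑-swap Q? (λ j i → P? i ×-dec (t i ≟′ j)) (λ i → P? i ×-dec Q? (t i)) (λ i j → t i ≟′ j)
      (λ _ i → f i) (λ { _ i q (p , refl) → (p , q) , refl })
      (λ { _ i (p , q) refl → q , p , refl }))
    (∑-cong′ (λ i → P? i ×-dec Q? (t i)) (λ i _ → ∑-single (λ j → t i ≟′ j) (λ _ → f i) refl (λ _ → sym)))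

-- Parity of natural numbers

odd : ℕ → Bool
odd zero    = false
odd (suc n) = not (odd n)

odd-+ : ∀ m n → odd (m + n) ≡ odd m xor odd n
odd-+ zero    n = refl
odd-+ (suc m) n = trans (cong not (odd-+ m n)) (Bool.not-distribˡ-xor (odd m) (odd n))

odd-double : ∀ n → odd (n + n) ≡ false
odd-double n = trans (odd-+ n n) (Bool.xor-same (odd n))

odd-% : ∀ n → (odd n ≡ true → n % 2 ≡ 1) × (odd n ≡ false → n % 2 ≡ 0)
odd-% zero          = (λ ()) , (λ _ → refl)
odd-% (suc zero)    = (λ _ → refl) , (λ ())
odd-% (suc (suc n)) = subst (λ b → (b ≡ true → n % 2 ≡ 1) × (b ≡ false → n % 2 ≡ 0))
  (sym (Bool.not-involutive (odd n))) (odd-% n)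

%2≡1⇒odd : ∀ n → n % 2 ≡ 1 → odd n ≡ true
%2≡1⇒odd n h with odd n in eq
... | true  = refl
... | false = case trans (sym h) (proj₂ (odd-% n) eq) of λ ()

odd-∑ : {I : Set} {{_ : Enumeration I}} {P : I → Set} (P? : ∀ i → Dec (P i)) (f : I → ℕ) →
        odd (ℕ∑.∑ P? f) ≡ X∑.∑ P? (odd ∘ f)
odd-∑ = ∑-homo ℕ.+-0-isCommutativeMonoid xor-isCommutativeMonoid odd refl odd-+

-- Reachability

-- The reached vertices are kept as a `Subset`, since they serve as one shore of a cut whose other
-- shore is the complement.
record Closure {n : ℕ} (R : Fin n → Fin n → Set) (u : Fin n) : Set where
  field
    closure   : Subset n
    start     : u ∈ closure
    closed    : ∀ {s t} → s ∈ closure → R s t → t ∈ closure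
    reachable : ∀ {t} → t ∈ closure → Star R u t

-- One vertex is added at a time as long as some step leads out of the set; the complement shrinks
-- each time.
closureOf : {R : Fin n → Fin n → Set} → (∀ s t → Dec (R s t)) → ∀ u → Closure R u
closureOf {n} {R} R? u = grow ⁅ u ⁆ (ℕ.<-wellFounded _) (x∈⁅x⁆ u)
  λ t∈ → subst (Star R u) (sym (x∈⁅y⁆⇒x≡y u t∈)) ε
  where
  grow : (S : Subset n) → Acc ℕ._<_ ∣ ∁ S ∣ → u ∈ S → (∀ {t} → t ∈ S → Star R u t) → Closure R u
  grow S (acc rs) u∈ reach
    with Fin.any? (λ s → Fin.any? (λ t → (s ∈? S) ×-dec ¬? (t ∈? S) ×-dec R? s t))
  ... | no none = record
    { closure   = S
    ; start     = u∈
    ; closed    = λ {s} {t} s∈ r → decidable-stable (t ∈? S) λ t∉ → none (s , t , s∈ , t∉ , r)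
    ; reachable = reach
    }
  ... | yes (s , t , s∈ , t∉ , r) =
    grow (S ∪ ⁅ t ⁆)
      (rs (p⊂q⇒∣p∣<∣q∣
        ( (λ x∈ → x∉p⇒x∈∁p (λ x∈S → x∈∁p⇒x∉p x∈ (x∈p∪q⁺ (inj₁ x∈S))))
        , t , x∉p⇒x∈∁p t∉ , λ t∈ → x∈∁p⇒x∉p t∈ (x∈p∪q⁺ (inj₂ (x∈⁅x⁆ t))))))
      (x∈p∪q⁺ (inj₁ u∈))
      (λ {t′} t′∈ → case x∈p∪q⁻ S ⁅ t ⁆ t′∈ of λ
        { (inj₁ t′∈S) → reach t′∈S
        ; (inj₂ t′∈t) → subst (Star R u) (sym (x∈⁅y⁆⇒x≡y t t′∈t)) (reach s∈ ◅◅ (r ◅ ε)) })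

-- Degrees and circuits

edge : Dart m → Fin m
edge = proj₁

rev : Dart m → Dart m
rev (e , b) = e , not b

rev-rev : (d : Dart m) → rev (rev d) ≡ d
rev-rev (e , b) = cong (e ,_) (Bool.not-involutive b)

_≟ᵈ_ : (d d′ : Dart m) → Dec (d ≡ d′)
_≟ᵈ_ = Product.≡-dec _≟_ Bool._≟_

same-edge : (d d′ : Dart m) → edge d ≡ edge d′ → d′ ≡ d ⊎ d′ ≡ rev d
same-edge (e , false) (.e , false) refl = inj₁ refl
same-edge (e , false) (.e , true)  refl = inj₂ refl
same-edge (e , true)  (.e , false) refl = inj₂ refl
same-edge (e , true)  (.e , true)  refl = inj₁ refl

rev≢ : (d : Dart m) → rev d ≢ d
rev≢ (e , false) ()
rev≢ (e , true)  ()

head-rev : (G : Graph n m) (d : Dart m) → head G (rev d) ≡ tail G d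
head-rev G d = cong (tail G) (rev-rev d)

At : Graph n m → Subset m → Fin n → Dart m → Set
At G D v d = edge d ∈ D × tail G d ≡ v

At? : (G : Graph n m) (D : Subset m) (v : Fin n) → ∀ d → Dec (At G D v d)
At? G D v d = (edge d ∈? D) ×-dec (tail G d ≟ v)

degree-∑ : (G : Graph n m) (D : Subset m) (v : Fin n) → degree G D v ≡ ∑1 (At? G D v)
degree-∑ {m = m} G D v = length-filter {I = Fin m × Bool} (At? G D v)

outDegree-∑ : (G : Graph n m) (o : Orientation m) (D : Subset m) (v : Fin n) →
              outDegree G o D v ≡ ∑1 (λ e → (e ∈? D) ×-dec (tail G (e , o e) ≟ v))
outDegree-∑ {m = m} G o D v = length-filter {I = Fin m} _

inDegree-∑ : (G : Graph n m) (o : Orientation m) (D : Subset m) (v : Fin n) →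
             inDegree G o D v ≡ ∑1 (λ e → (e ∈? D) ×-dec (head G (e , o e) ≟ v))
inDegree-∑ {m = m} G o D v = length-filter {I = Fin m} _

∈-dartsAt : (G : Graph n m) (D : Subset m) (v : Fin n) {d : Dart m} →
            At G D v d → d List.∈ dartsAt G D v
∈-dartsAt G D v {d} p = List.∈-filter⁺ (At? G D v) (Enumeration.complete Dart-enumeration d) p

∈-dartsAt⁻ : (G : Graph n m) (D : Subset m) (v : Fin n) {d : Dart m} →
             d List.∈ dartsAt G D v → At G D v d
∈-dartsAt⁻ {m = m} G D v p =
  proj₂ (List.∈-filter⁻ (At? G D v) {xs = elementsOf (Fin m × Bool)} p)

dartsAt-unique : (G : Graph n m) (D : Subset m) (v : Fin n) → Unique (dartsAt G D v)
dartsAt-unique G D v = Unique.filter⁺ (At? G D v) (Enumeration.unique Dart-enumeration)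

length≤1 : {A : Set} {x y : A} (xs : List A) → length xs ≤ 1 →
           x List.∈ xs → y List.∈ xs → x ≡ y
length≤1 (_ ∷ [])    _ (here refl) (here refl) = refl
length≤1 (_ ∷ _ ∷ _) (s≤s ()) _ _

-- The form in which degree bounds are applied: once enough distinct darts at a vertex are known,
-- every further one is among them.
length≤2 : {A : Set} {x y z : A} (xs : List A) → length xs ≤ 2 → x ≢ y →
           x List.∈ xs → y List.∈ xs → z List.∈ xs → z ≡ x ⊎ z ≡ y
length≤2 (_ ∷ _ ∷ _ ∷ _) (s≤s (s≤s ()))
length≤2 (_ ∷ xs) _ x≢y (here refl) (here refl) _ = ⊥-elim (x≢y refl)
length≤2 (_ ∷ xs) _ x≢y (here refl) (there y∈) (here refl) = inj₁ refl
length≤2 (_ ∷ xs) (s≤s h) x≢y (here refl) (there y∈) (there z∈) = inj₂ (length≤1 xs h z∈ y∈)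
length≤2 (_ ∷ xs) _ x≢y (there x∈) (here refl) (here refl) = inj₂ refl
length≤2 (_ ∷ xs) (s≤s h) x≢y (there x∈) (here refl) (there z∈) = inj₁ (length≤1 xs h z∈ x∈)
length≤2 (_ ∷ xs) (s≤s h) x≢y (there x∈) (there y∈) _ = ⊥-elim (x≢y (length≤1 xs h x∈ y∈))

length≤3 : {A : Set} {x y z w : A} (xs : List A) → length xs ≤ 3 → x ≢ y → x ≢ z → y ≢ z →
           x List.∈ xs → y List.∈ xs → z List.∈ xs → w List.∈ xs → w ≡ x ⊎ w ≡ y ⊎ w ≡ z
length≤3 (_ ∷ xs) _ x≢y x≢z y≢z (here refl) (here refl) _ _ = ⊥-elim (x≢y refl)
length≤3 (_ ∷ xs) _ x≢y x≢z y≢z (here refl) _ (here refl) _ = ⊥-elim (x≢z refl)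
length≤3 (_ ∷ xs) _ x≢y x≢z y≢z _ (here refl) (here refl) _ = ⊥-elim (y≢z refl)
length≤3 (_ ∷ xs) _ x≢y x≢z y≢z (here refl) (there _) (there _) (here refl) = inj₁ refl
length≤3 (_ ∷ xs) _ x≢y x≢z y≢z (there _) (here refl) (there _) (here refl) = inj₂ (inj₁ refl)
length≤3 (_ ∷ xs) _ x≢y x≢z y≢z (there _) (there _) (here refl) (here refl) = inj₂ (inj₂ refl)
length≤3 (_ ∷ xs) (s≤s h) x≢y x≢z y≢z (here refl) (there p) (there q) (there r) =
  inj₂ (length≤2 xs h y≢z p q r)
length≤3 (_ ∷ xs) (s≤s h) x≢y x≢z y≢z (there p) (here refl) (there q) (there r) =
  Sum.map id inj₂ (length≤2 xs h x≢z p q r)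
length≤3 (_ ∷ xs) (s≤s h) x≢y x≢z y≢z (there p) (there q) (here refl) (there r) =
  Sum.map id inj₁ (length≤2 xs h x≢y p q r)
length≤3 (_ ∷ xs) (s≤s h) x≢y x≢z y≢z (there p) (there q) (there r) _ =
  ⊥-elim ([ x≢z ∘ sym , y≢z ∘ sym ]′ (length≤2 xs h x≢y p q r))

∈-inducedBy : (G : Graph n m) (S : Subset n) {e : Fin m} →
              (∀ b → tail G (e , b) ∈ S) → e ∈ inducedBy (ends G) S
∈-inducedBy G S {e} h = Vec.lookup⇒[]= e _ (trans (Vec.lookup∘tabulate _ e)
  (cong₂ _∧_ (Vec.[]=⇒lookup (h false)) (Vec.[]=⇒lookup (h true))))

∈-inducedBy⁻ : (G : Graph n m) (S : Subset n) {e : Fin m} →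
               e ∈ inducedBy (ends G) S → ∀ b → tail G (e , b) ∈ S
∈-inducedBy⁻ G S {e} e∈ = λ
  { false → Vec.lookup⇒[]= _ S (Bool.∧-conicalˡ _ _ both)
  ; true  → Vec.lookup⇒[]= _ S (Bool.∧-conicalʳ _ _ both) }
  where
  both : Vec.lookup S (proj₁ (ends G e)) ∧ Vec.lookup S (proj₂ (ends G e)) ≡ true
  both = trans (sym (Vec.lookup∘tabulate _ e)) (Vec.[]=⇒lookup e∈)

tail∈V : (G : Graph n m) (d : Dart m) → edge d ∈ E G → tail G d ∈ V G
tail∈V G (e , b) e∈ = ∈-inducedBy⁻ G (V G) (wf G e∈) b

─-∉ : (p q : Subset n) {x : Fin n} → x ∈ p ─ q → x ∉ q
─-∉ (_ Vec.∷ p) (true Vec.∷ q) {zero} () 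
─-∉ (_ Vec.∷ p) (false Vec.∷ q) {zero} x∈ ()
─-∉ (_ Vec.∷ p) (true Vec.∷ q) {suc x} (Vec.there x∈) (Vec.there x∈q) = ─-∉ p q x∈ x∈q
─-∉ (_ Vec.∷ p) (false Vec.∷ q) {suc x} (Vec.there x∈) (Vec.there x∈q) = ─-∉ p q x∈ x∈q

Adjacent? : (G : Graph n m) (A : Subset m) → ∀ u v → Dec (Adjacent G A u v)
Adjacent? G A u v = Fin.any? λ e → (e ∈? A) ×-dec map′
  (λ { (inj₁ p) → false , p ; (inj₂ p) → true , p })
  (λ { (false , p) → inj₁ p ; (true , p) → inj₂ p })
  (joined false ⊎-dec joined true)
  where
  joined : ∀ {e} b → Dec (tail G (e , b) ≡ u × head G (e , b) ≡ v)
  joined b = (_ ≟ u) ×-dec (_ ≟ v)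

Adjacent-dart : (G : Graph n m) (A : Subset m) (d : Dart m) → edge d ∈ A →
                Adjacent G A (tail G d) (head G d)
Adjacent-dart G A d e∈ = edge d , e∈ , proj₂ d , refl , refl

Adjacent-sym : (G : Graph n m) (A : Subset m) {u v : Fin n} → Adjacent G A u v → Adjacent G A v u
Adjacent-sym G A (e , e∈ , b , p , q) = e , e∈ , not b , q , trans (head-rev G (e , b)) p

Connected-sym : (G : Graph n m) (A : Subset m) {u v : Fin n} → Connected G A u v → Connected G A v u
Connected-sym G A = Star.reverse (Adjacent-sym G A)

reach : (G : Graph n m) (A : Subset m) (u : Fin n) → Closure (Adjacent G A) u
reach G A = closureOf (Adjacent? G A)

component : (G : Graph n m) (A : Subset m) → Fin n → Subset n
component G A u = Closure.closure (reach G A u)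

module _ (G : Graph n m) (A : Subset m) where

  ∈-component : ∀ {u v} → Connected G A u v → v ∈ component G A u
  ∈-component {u} = go (Closure.start (reach G A u))
    where
    go : ∀ {s t} → s ∈ component G A u → Connected G A s t → t ∈ component G A u
    go s∈ ε        = s∈
    go s∈ (r ◅ rs) = go (Closure.closed (reach G A u) s∈ r) rs

  ∈-component⁻ : ∀ {u v} → v ∈ component G A u → Connected G A u v
  ∈-component⁻ {u} = Closure.reachable (reach G A u)

  component-closed : ∀ u d → edge d ∈ A → tail G d ∈ component G A u → head G d ∈ component G A u
  component-closed u d e∈ t∈ = Closure.closed (reach G A u) t∈ (Adjacent-dart G A d e∈)

  component-edges : Fin n → Subset m
  component-edges u = A ∩ inducedBy (ends G) (component G A u)

  ∈-component-edges : ∀ {u} d → edge d ∈ A → tail G d ∈ component G A u →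
                      edge d ∈ component-edges u
  ∈-component-edges {u} (e , b) e∈ t∈ = x∈p∩q⁺ (e∈ , ∈-inducedBy G _ both)
    where
    both : ∀ b′ → tail G (e , b′) ∈ component G A u
    both b′ with same-edge (e , b) (e , b′) refl
    ... | inj₁ eq = subst (λ d → tail G d ∈ component G A u) (sym eq) t∈
    ... | inj₂ eq = subst (λ d → tail G d ∈ component G A u) (sym eq)
                      (component-closed u (e , b) e∈ t∈)

  component-edges⊆ : ∀ {u} → component-edges u ⊆ A
  component-edges⊆ {u} = p∩q⊆p A _

  VertexOf-component : ∀ {u v} → VertexOf G (component-edges u) v → v ∈ component G A u
  VertexOf-component {u} (e , e∈ , b , refl) =
    ∈-inducedBy⁻ G _ (proj₂ (x∈p∩q⁻ A _ e∈)) b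

  degree-component : ∀ {u v} → v ∈ component G A u → degree G (component-edges u) v ≡ degree G A v
  degree-component {u} {v} v∈ = trans (degree-∑ G _ v) (trans
    (ℕ∑.∑-cong (At? G (component-edges u) v) (At? G A v)
      (λ _ (e∈ , t) → component-edges⊆ e∈ , t)
      (λ { d (e∈ , refl) → ∈-component-edges d e∈ v∈ , refl })
      (λ _ _ → refl))
    (sym (degree-∑ G A v)))

TwoRegular : Graph n m → Subset m → Set
TwoRegular G A = ∀ v → degree G A v ≡ 0 ⊎ degree G A v ≡ 2

degree-at : (G : Graph n m) (A : Subset m) {v : Fin n} {d : Dart m} → At G A v d → 1 ≤ degree G A v
degree-at G A {v} {d} at = subst (1 ≤_) (sym (degree-∑ G A v))
  (term≤∑ (At? G A v) _≟ᵈ_ (λ _ → 1) {d} at)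

TwoRegular-at : (G : Graph n m) (A : Subset m) → TwoRegular G A → ∀ {v d} → At G A v d → degree G A v ≡ 2
TwoRegular-at G A reg {v} {d} at with reg v | degree-at G A {d = d} at
... | inj₂ two | _ = two
... | inj₁ nil | h = contradiction h (subst (λ k → ¬ 1 ≤ k) (sym nil) λ ())

-- A component contains all `A`-edges at each of its vertices, so degrees stay 2; a walk in `A`
-- never leaves the component, so it is also a walk in the component's own edges.
component-circuit : (G : Graph n m) (A : Subset m) → A ⊆ E G → TwoRegular G A →
                    ∀ d → edge d ∈ A → Circuit G (component-edges G A (tail G d))
component-circuit G A A⊆ reg d e∈ =
    A⊆ ∘ component-edges⊆ G A
  , (edge d , ∈-component-edges G A d e∈ (Closure.start (reach G A (tail G d))))
  , (λ { v vo@(e , e∈D , b , t) → trans (degree-component G A (VertexOf-component G A vo))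
          (TwoRegular-at G A reg {v} {e , b} (component-edges⊆ G A e∈D , t)) })
  , λ u v uo vo → connected (Connected-sym G A (∈-component⁻ G A (VertexOf-component G A uo))
                             ◅◅ ∈-component⁻ G A (VertexOf-component G A vo))
                            (VertexOf-component G A uo)
  where
  connected : ∀ {u v} → Connected G A u v → u ∈ component G A (tail G d) →
              Connected G (component-edges G A (tail G d)) u v
  connected ε _ = ε
  connected ((e , e∈A , b , refl , refl) ◅ rs) u∈ =
    Adjacent-dart G _ (e , b) (∈-component-edges G A (e , b) e∈A u∈)
    ◅ connected rs (component-closed G A _ (e , b) e∈A u∈)

-- Even subgraphs

infixl 6 _⊕_

-- Symmetric difference, the addition of the binary edge space.
_⊕_ : Subset n → Subset n → Subset n
_⊕_ = Vec.zipWith _xor_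

lookup-⊕ : (p q : Subset n) (x : Fin n) → Vec.lookup (p ⊕ q) x ≡ Vec.lookup p x xor Vec.lookup q x
lookup-⊕ p q x = Vec.lookup-zipWith _xor_ x p q

lookup-∉ : {p : Subset n} {x : Fin n} → x ∉ p → Vec.lookup p x ≡ false
lookup-∉ {p = p} {x} x∉ = Bool.¬-not λ eq → x∉ (Vec.lookup⇒[]= x p eq)

∈-⊕ : (p q : Subset n) {x : Fin n} → x ∈ p ⊕ q → x ∈ p ⊎ x ∈ q
∈-⊕ p q {x} x∈ with x ∈? p | x ∈? q
... | yes x∈p | _       = inj₁ x∈p
... | no  _   | yes x∈q = inj₂ x∈q
... | no  x∉p | no  x∉q = contradiction
  (trans (sym (Vec.[]=⇒lookup x∈)) (trans (lookup-⊕ p q x) (cong₂ _xor_ (lookup-∉ x∉p) (lookup-∉ x∉q))))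
  λ ()

xor≡false : ∀ x y → x xor y ≡ false → x ≡ y
xor≡false true  true  _ = refl
xor≡false false false _ = refl

lookup-ext : (p q : Subset n) → (∀ x → Vec.lookup p x ≡ Vec.lookup q x) → p ≡ q
lookup-ext p q h =
  trans (sym (Vec.tabulate∘lookup p)) (trans (Vec.tabulate-cong h) (Vec.tabulate∘lookup q))

⊕-nonempty : (p q : Subset n) → p ≢ q → Nonempty (p ⊕ q)
⊕-nonempty p q p≢q with nonempty? (p ⊕ q)
... | yes ne = ne
... | no  e  = contradiction
  (lookup-ext p q λ x → xor≡false _ _ (trans (sym (lookup-⊕ p q x)) (lookup-∉ λ x∈ → e (x , x∈))))
  p≢q

bit : Bool → Fin 2
bit false = zero
bit true  = suc zero

bool : Fin 2 → Bool
bool zero       = false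
bool (suc zero) = true

bit-injective : ∀ a b → bit a ≡ bit b → a ≡ b
bit-injective false false _ = refl
bit-injective true  true  _ = refl

bool-injective : ∀ a b → bool a ≡ bool b → a ≡ b
bool-injective zero       zero       _ = refl
bool-injective zero       (suc zero) ()
bool-injective (suc zero) zero       ()
bool-injective (suc zero) (suc zero) _ = refl

-- Codes the restriction of `g` to `Q` by a number below `2 ^ ∣ Q ∣`, and `subsetOf` decodes numbers
-- into subsets of `P`, so that the pigeonhole principle for `Fin` applies to edge sets and their
-- parity vectors.
restrict : (Q : Subset n) → (Fin n → Bool) → Fin (2 ^ ∣ Q ∣)
restrict Vec.[]          g = zero
restrict (true  Vec.∷ Q) g = Fin.combine (bit (g zero)) (restrict Q (g ∘ suc))
restrict (false Vec.∷ Q) g = restrict Q (g ∘ suc)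

restrict-injective : (Q : Subset n) (g h : Fin n → Bool) → restrict Q g ≡ restrict Q h →
                     ∀ {x} → x ∈ Q → g x ≡ h x
restrict-injective (true  Vec.∷ Q) g h eq Vec.here =
  bit-injective _ _ (proj₁ (Fin.combine-injective (bit (g zero)) _ _ _ eq))
restrict-injective (true  Vec.∷ Q) g h eq (Vec.there x∈) =
  restrict-injective Q (g ∘ suc) (h ∘ suc)
    (proj₂ (Fin.combine-injective (bit (g zero)) _ (bit (h zero)) _ eq)) x∈
restrict-injective (false Vec.∷ Q) g h eq (Vec.there x∈) =
  restrict-injective Q (g ∘ suc) (h ∘ suc) eq x∈

subsetOf : (P : Subset m) → Fin (2 ^ ∣ P ∣) → Subset m
subsetOf Vec.[]          i = Vec.[]
subsetOf (true  Vec.∷ P) i =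
  let (b , j) = Fin.remQuot {2} (2 ^ ∣ P ∣) i in bool b Vec.∷ subsetOf P j
subsetOf (false Vec.∷ P) i = false Vec.∷ subsetOf P i

subsetOf⊆ : (P : Subset m) (i : Fin (2 ^ ∣ P ∣)) → subsetOf P i ⊆ P
subsetOf⊆ (true  Vec.∷ P) i {zero}  x∈ = Vec.here
subsetOf⊆ (true  Vec.∷ P) i {suc x} (Vec.there x∈) = Vec.there (subsetOf⊆ P _ x∈)
subsetOf⊆ (false Vec.∷ P) i {suc x} (Vec.there x∈) = Vec.there (subsetOf⊆ P i x∈)

subsetOf-injective : (P : Subset m) (i j : Fin (2 ^ ∣ P ∣)) → subsetOf P i ≡ subsetOf P j → i ≡ j
subsetOf-injective Vec.[] zero zero _ = refl
subsetOf-injective (true  Vec.∷ P) i j eq =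
  trans (sym (Fin.combine-remQuot {2} (2 ^ ∣ P ∣) i)) (trans
    (cong₂ Fin.combine
      (bool-injective _ _ (Vec.∷-injectiveˡ eq))
      (subsetOf-injective P _ _ (Vec.∷-injectiveʳ eq)))
    (Fin.combine-remQuot {2} (2 ^ ∣ P ∣) j))
subsetOf-injective (false Vec.∷ P) i j eq = subsetOf-injective P i j (Vec.∷-injectiveʳ eq)

-- The binary boundary map. Summing the indicator of `D` over all darts at `v` makes additivity in
-- `D` immediate; `∂-degree` identifies the value with the parity of the degree.
∂ : Graph n m → Subset m → Fin n → Bool
∂ G D v = X∑.∑ (λ d → tail G d ≟ v) (λ d → Vec.lookup D (edge d))

∂-degree : (G : Graph n m) (D : Subset m) (v : Fin n) → odd (degree G D v) ≡ ∂ G D v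
∂-degree G D v = trans (cong odd (degree-∑ G D v)) (trans (odd-∑ (At? G D v) (λ _ → 1)) (trans
  (X∑.∑-cong (At? G D v) (λ d → (tail G d ≟ v) ×-dec (edge d ∈? D))
    (λ _ (p , q) → q , p) (λ _ (p , q) → q , p) (λ _ (p , _) → sym (Vec.[]=⇒lookup p)))
  (sym (trans (X∑.∑-split (λ d → tail G d ≟ v) (λ d → edge d ∈? D) _)
    (trans (cong (X∑.∑ (λ d → (tail G d ≟ v) ×-dec (edge d ∈? D)) _ xor_)
      (X∑.∑-𝟘 (λ d → (tail G d ≟ v) ×-dec ¬? (edge d ∈? D)) _ (λ _ (_ , e∉) → lookup-∉ e∉)))
      (Bool.xor-identityʳ _))))))

∂-⊕ : (G : Graph n m) (D D′ : Subset m) (v : Fin n) → ∂ G (D ⊕ D′) v ≡ ∂ G D v xor ∂ G D′ v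
∂-⊕ G D D′ v = trans
  (X∑.∑-cong′ (λ d → tail G d ≟ v) (λ d _ → lookup-⊕ D D′ (edge d)))
  (X∑.∑-∙ (λ d → tail G d ≟ v) _ _)

∑1-darts : (D : Subset m) → ∑1 (λ (d : Dart m) → edge d ∈? D) ≡ ∣ D ∣ + ∣ D ∣
∑1-darts {m} D = trans (ℕ∑.∑-darts (λ d → edge d ∈? D) (λ _ → 1))
  (trans (ℕ∑.sum-∙ _ _ (allFin m)) (sym (cong₂ _+_ (∣∣-∑1 D) (∣∣-∑1 D))))

handshake : (G : Graph n m) (S : Subset n) (D : Subset m) → D ⊆ inducedBy (ends G) S →
            ℕ∑.∑ (_∈? S) (degree G D) ≡ ∣ D ∣ + ∣ D ∣
handshake G S D D⊆ = trans
  (ℕ∑.∑-cong′ (_∈? S) (λ v _ → degree-∑ G D v)) (trans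
  (Fibres.∑-fibres ℕ.+-0-isCommutativeMonoid (λ d → edge d ∈? D) (_∈? S) _≟_ (tail G) (λ _ → 1)) (trans
  (ℕ∑.∑-cong (λ d → (edge d ∈? D) ×-dec (tail G d ∈? S)) (λ d → edge d ∈? D) (λ _ → proj₁)
    (λ (e , b) e∈ → e∈ , ∈-inducedBy⁻ G S (D⊆ e∈) b) (λ _ _ → refl))
  (∑1-darts D)))

degree-outside : (G : Graph n m) (S : Subset n) (D : Subset m) → D ⊆ inducedBy (ends G) S →
                 ∀ {v} → v ∉ S → degree G D v ≡ 0
degree-outside G S D D⊆ {v} v∉ = trans (degree-∑ G D v) (ℕ∑.∑-𝟘 (At? G D v) _
  (λ { (e , b) (e∈ , refl) → contradiction (∈-inducedBy⁻ G S (D⊆ e∈) b) v∉ }))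

-- Two of the 2 ^ ∣ P ∣ subsets of P have the same degree parities on S - s,
-- hence on S by the handshake lemma; take their symmetric difference.
even-subgraph : (G : Graph n m) (S : Subset n) {s : Fin n} → s ∈ S → (P : Subset m) →
                P ⊆ inducedBy (ends G) S → ∣ S ∣ ≤ ∣ P ∣ →
                ∃[ D ] D ⊆ P × Nonempty D × (∀ v → odd (degree G D v) ≡ false)
even-subgraph G S {s} s∈ P P⊆ S≤P = D , D⊆P , nonempty , even
  where
  parities : Fin (2 ^ ∣ P ∣) → Fin (2 ^ ∣ S - s ∣)
  parities i = restrict (S - s) (∂ G (subsetOf P i))

  -- Leaving out `s` makes the parity vectors strictly fewer than the subsets, even when `∣ S ∣`
  -- equals `∣ P ∣`.
  collision = Fin.pigeonhole
    (ℕ.^-monoʳ-< 2 (s≤s (s≤s z≤n)) (ℕ.<-≤-trans (x∈p⇒∣p-x∣<∣p∣ s∈) S≤P)) parities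
  i = proj₁ collision
  j = proj₁ (proj₂ collision)

  D = subsetOf P i ⊕ subsetOf P j

  D⊆P : D ⊆ P
  D⊆P e∈ = [ subsetOf⊆ P i , subsetOf⊆ P j ]′ (∈-⊕ (subsetOf P i) (subsetOf P j) e∈)

  nonempty : Nonempty D
  nonempty = ⊕-nonempty _ _ λ eq →
    Fin.<⇒≢ (proj₁ (proj₂ (proj₂ collision))) (subsetOf-injective P i j eq)

  even-Q : ∀ {v} → v ∈ S - s → ∂ G D v ≡ false
  even-Q {v} v∈ = trans (∂-⊕ G (subsetOf P i) (subsetOf P j) v) (trans
    (cong (_xor ∂ G (subsetOf P j) v)
      (restrict-injective (S - s) (∂ G (subsetOf P i)) (∂ G (subsetOf P j))
        (proj₂ (proj₂ (proj₂ collision))) v∈))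
    (Bool.xor-same (∂ G (subsetOf P j) v)))

  even-s : ∂ G D s ≡ false
  even-s = begin
    ∂ G D s
      ≡⟨ sym (Bool.xor-identityʳ _) ⟩
    ∂ G D s xor false
      ≡⟨ sym (cong₂ _xor_
           (X∑.∑-single (λ v → (v ∈? S) ×-dec (v ≟ s)) (∂ G D) (s∈ , refl) (λ _ → proj₂))
           (X∑.∑-𝟘 (λ v → (v ∈? S) ×-dec ¬? (v ≟ s)) (∂ G D)
             (λ v (v∈ , v≢s) → even-Q (x∈p∧x≢y⇒x∈p-y v∈ v≢s)))) ⟩
    X∑.∑ (λ v → (v ∈? S) ×-dec (v ≟ s)) (∂ G D) xor X∑.∑ (λ v → (v ∈? S) ×-dec ¬? (v ≟ s)) (∂ G D)
      ≡⟨ sym (X∑.∑-split (_∈? S) (_≟ s) (∂ G D)) ⟩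
    X∑.∑ (_∈? S) (∂ G D)
      ≡⟨ sym (X∑.∑-cong′ (_∈? S) (λ v _ → ∂-degree G D v)) ⟩
    X∑.∑ (_∈? S) (odd ∘ degree G D)
      ≡⟨ sym (odd-∑ (_∈? S) (degree G D)) ⟩
    odd (ℕ∑.∑ (_∈? S) (degree G D))
      ≡⟨ cong odd (handshake G S D (λ e∈ → P⊆ (D⊆P e∈))) ⟩
    odd (∣ D ∣ + ∣ D ∣)
      ≡⟨ odd-double ∣ D ∣ ⟩
    false ∎
    where open ≡-Reasoning

  even : ∀ v → odd (degree G D v) ≡ false
  even v with v ∈? S | v ≟ s
  ... | no v∉  | _        = cong odd (degree-outside G S D (λ e∈ → P⊆ (D⊆P e∈)) v∉)
  ... | yes v∈ | yes refl = trans (∂-degree G D s) even-s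
  ... | yes v∈ | no v≢s   = trans (∂-degree G D v) (even-Q (x∈p∧x≢y⇒x∈p-y v∈ v≢s))

-- Edge cuts of cubic graphs

-- Cuts are counted by leaving darts rather than by boundary edges, because a flow needs the
-- direction of each cut edge; `∣boundary∣` equates the two counts.
Leaves : Graph n m → Subset n → Dart m → Set
Leaves G S d = edge d ∈ E G × tail G d ∈ S × head G d ∉ S

Leaves? : (G : Graph n m) (S : Subset n) → ∀ d → Dec (Leaves G S d)
Leaves? G S d = (edge d ∈? E G) ×-dec (tail G d ∈? S) ×-dec ¬? (head G d ∈? S)

Leaves-boundary : (G : Graph n m) (S : Subset n) (d : Dart m) → Leaves G S d → edge d ∈ boundary G S
Leaves-boundary G S d@(e , b) (e∈ , t∈ , h∉) = x∈p∧x∉q⇒x∈p─q e∈ λ e∈∪ →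
  [ (λ in-S → h∉ (∈-inducedBy⁻ G S in-S (not b)))
  , (λ in-∁ → x∈∁p⇒x∉p (∈-inducedBy⁻ G (∁ S) in-∁ b) t∈) ]′ (x∈p∪q⁻ _ _ e∈∪)

boundary⊆E : (G : Graph n m) (S : Subset n) → boundary G S ⊆ E G
boundary⊆E G S = p─q⊆p (E G) _

boundary-Leaves : (G : Graph n m) (S : Subset n) {e : Fin m} → e ∈ boundary G S →
                  ∃[ b ] Leaves G S (e , b)
boundary-Leaves G S {e} e∈ with tail G (e , false) ∈? S | tail G (e , true) ∈? S
... | yes p | no  q = false , boundary⊆E G S e∈ , p , q
... | no  p | yes q = true , boundary⊆E G S e∈ , q , p
... | yes p | yes q = contradiction
  (x∈p∪q⁺ (inj₁ (∈-inducedBy G S λ { false → p ; true → q }))) (─-∉ (E G) _ e∈)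
... | no  p | no  q = contradiction
  (x∈p∪q⁺ (inj₂ (∈-inducedBy G (∁ S) λ { false → x∉p⇒x∈∁p p ; true → x∉p⇒x∈∁p q })))
  (─-∉ (E G) _ e∈)

Leaves-edge : (G : Graph n m) (S : Subset n) (d d′ : Dart m) → Leaves G S d → Leaves G S d′ →
              edge d ≡ edge d′ → d ≡ d′
Leaves-edge G S d d′ (_ , _ , h∉) (_ , t∈ , _) eq with same-edge d d′ eq
... | inj₁ d′≡d = sym d′≡d
... | inj₂ refl = contradiction t∈ h∉

∣boundary∣ : (G : Graph n m) (S : Subset n) → ∣ boundary G S ∣ ≡ ∑1 (Leaves? G S)
∣boundary∣ G S = trans (∣∣-∑1 (boundary G S))
  (sym (ℕ∑.∑-reindex (_∈? boundary G S) (Leaves? G S) _≟_ edge (λ _ → 1)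
    (Leaves-boundary G S) (Leaves-edge G S)
    (λ e e∈ → let (b , l) = boundary-Leaves G S e∈ in (e , b) , l , refl)))

Leaves-∁ : (G : Graph n m) (S : Subset n) (d : Dart m) → Leaves G S d → Leaves G (∁ S) (rev d)
Leaves-∁ G S d (e∈ , t∈ , h∉) =
  e∈ , x∉p⇒x∈∁p h∉ , λ h∈ → x∈∁p⇒x∉p (subst (_∈ ∁ S) (head-rev G d) h∈) t∈

Leaves-∁⁻ : (G : Graph n m) (S : Subset n) (d : Dart m) → Leaves G (∁ S) d → Leaves G S (rev d)
Leaves-∁⁻ G S d (e∈ , t∈ , h∉) =
  e∈ , x∉∁p⇒x∈p h∉ , λ h∈ → x∈∁p⇒x∉p t∈ (subst (_∈ S) (head-rev G d) h∈)

∑1-Leaves-∁ : (G : Graph n m) (S : Subset n) → ∑1 (Leaves? G (∁ S)) ≡ ∑1 (Leaves? G S)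
∑1-Leaves-∁ G S = ℕ∑.∑-reindex (Leaves? G S) (Leaves? G (∁ S)) _≟ᵈ_ rev (λ _ → 1)
  (Leaves-∁⁻ G S)
  (λ d d′ _ _ eq → trans (sym (rev-rev d)) (trans (cong rev eq) (rev-rev d′)))
  (λ d l → rev d , Leaves-∁ G S d l , rev-rev d)

-- A shore may contain labels that are no vertices of `G`; no edge ends there.
∑1-Leaves-V : (G : Graph n m) (S : Subset n) → ∑1 (Leaves? G (S ∩ V G)) ≡ ∑1 (Leaves? G S)
∑1-Leaves-V G S = ℕ∑.∑-cong (Leaves? G (S ∩ V G)) (Leaves? G S)
  (λ d (e∈ , t∈ , h∉) → e∈ , proj₁ (x∈p∩q⁻ S (V G) t∈) ,
    λ h∈ → h∉ (x∈p∩q⁺ (h∈ , tail∈V G (rev d) e∈)))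
  (λ d (e∈ , t∈ , h∉) → e∈ , x∈p∩q⁺ (t∈ , tail∈V G d e∈) ,
    λ h∈ → h∉ (proj₁ (x∈p∩q⁻ S (V G) h∈)))
  (λ _ _ → refl)

∑-const-3 : (S : Subset n) → ℕ∑.∑ (_∈? S) (λ _ → 3) ≡ ∣ S ∣ + (∣ S ∣ + ∣ S ∣)
∑-const-3 S = trans (ℕ∑.∑-∙ (_∈? S) (λ _ → 1) (λ _ → 2)) (sym (cong₂ _+_ (∣∣-∑1 S)
  (sym (trans (ℕ∑.∑-∙ (_∈? S) (λ _ → 1) (λ _ → 1)) (sym (cong₂ _+_ (∣∣-∑1 S) (∣∣-∑1 S)))))))

-- Both sides count the darts with tail in `S`: three at each vertex, and on the other hand two for
-- every inner edge and one for every leaving edge.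
cubic-count : (G : Graph n m) → Cubic G → (S : Subset n) → S ⊆ V G →
              let p = ∣ E G ∩ inducedBy (ends G) S ∣ in
              ∣ S ∣ + (∣ S ∣ + ∣ S ∣) ≡ (p + p) + ∑1 (Leaves? G S)
cubic-count G cubic S S⊆V = begin
  ∣ S ∣ + (∣ S ∣ + ∣ S ∣)
    ≡⟨ sym (∑-const-3 S) ⟩
  ℕ∑.∑ (_∈? S) (λ _ → 3)
    ≡⟨ sym (ℕ∑.∑-cong′ (_∈? S) (λ v v∈ → cubic v (S⊆V v∈))) ⟩
  ℕ∑.∑ (_∈? S) (degree G (E G))
    ≡⟨ ℕ∑.∑-cong′ (_∈? S) (λ v _ → degree-∑ G (E G) v) ⟩
  ℕ∑.∑ (_∈? S) (λ v → ∑1 (At? G (E G) v))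
    ≡⟨ Fibres.∑-fibres ℕ.+-0-isCommutativeMonoid (λ d → edge d ∈? E G) (_∈? S) _≟_ (tail G) (λ _ → 1) ⟩
  ∑1 from-S
    ≡⟨ ℕ∑.∑-split from-S (λ d → head G d ∈? S) (λ _ → 1) ⟩
  ∑1 (λ d → from-S d ×-dec (head G d ∈? S)) + ∑1 (λ d → from-S d ×-dec ¬? (head G d ∈? S))
    ≡⟨ cong₂ _+_
         (ℕ∑.∑-cong (λ d → from-S d ×-dec (head G d ∈? S)) (λ d → edge d ∈? P)
           (λ { (e , b) ((e∈ , t∈) , h∈) → x∈p∩q⁺ (e∈ , ∈-inducedBy G S (both (e , b) t∈ h∈)) })
           (λ (e , b) e∈P → let (e∈ , in-S) = x∈p∩q⁻ (E G) _ e∈P in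
             (e∈ , ∈-inducedBy⁻ G S in-S b) , ∈-inducedBy⁻ G S in-S (not b))
           (λ _ _ → refl))
         (ℕ∑.∑-cong (λ d → from-S d ×-dec ¬? (head G d ∈? S)) (Leaves? G S)
           (λ { _ ((e∈ , t∈) , h∉) → e∈ , t∈ , h∉ }) (λ { _ (e∈ , t∈ , h∉) → (e∈ , t∈) , h∉ })
           (λ _ _ → refl)) ⟩
  ∑1 (λ d → edge d ∈? P) + ∑1 (Leaves? G S)
    ≡⟨ cong (_+ ∑1 (Leaves? G S)) (∑1-darts P) ⟩
  (∣ P ∣ + ∣ P ∣) + ∑1 (Leaves? G S) ∎
  where
  open ≡-Reasoning
  P = E G ∩ inducedBy (ends G) S
  from-S : ∀ d → Dec (edge d ∈ E G × tail G d ∈ S)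
  from-S d = (edge d ∈? E G) ×-dec (tail G d ∈? S)
  both : ∀ d → tail G d ∈ S → head G d ∈ S → ∀ b → tail G (edge d , b) ∈ S
  both d t∈ h∈ b with same-edge d (edge d , b) refl
  ... | inj₁ eq = subst (λ d → tail G d ∈ S) (sym eq) t∈
  ... | inj₂ eq = subst (λ d → tail G d ∈ S) (sym eq) h∈

degree-mono : (G : Graph n m) {D D′ : Subset m} → D ⊆ D′ → ∀ v → degree G D v ≤ degree G D′ v
degree-mono G {D} {D′} D⊆ v = subst₂ _≤_ (sym (degree-∑ G D v)) (sym (degree-∑ G D′ v))
  (∑-mono-≤ (At? G D v) (At? G D′ v) (λ _ (p , q) → D⊆ p , q) (λ _ _ → ℕ.≤-refl))

degree≤3 : (G : Graph n m) → Cubic G → {D : Subset m} → D ⊆ E G → ∀ v → degree G D v ≤ 3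
degree≤3 G cubic {D} D⊆ v with v ∈? V G
... | yes v∈ = subst (degree G D v ≤_) (cubic v v∈) (degree-mono G D⊆ v)
... | no  v∉ = subst (_≤ 3) (sym (degree-outside G (V G) D (λ e∈ → wf G (D⊆ e∈)) v∉)) z≤n

-- This makes even subgraphs of a cubic graph 2-regular.
even≤3 : ∀ k → k ≤ 3 → odd k ≡ false → k ≡ 0 ⊎ k ≡ 2
even≤3 0 _ _ = inj₁ refl
even≤3 2 _ _ = inj₂ refl
even≤3 1 _ ()
even≤3 3 _ ()
even≤3 (suc (suc (suc (suc k)))) (s≤s (s≤s (s≤s ())))

-- With at most ∣ S ∣ edges leaving it, S spans at least ∣ S ∣ edges.
two-regular-inside : (G : Graph n m) → Cubic G → (S : Subset n) → S ⊆ V G → Nonempty S →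
                     ∑1 (Leaves? G S) ≤ ∣ S ∣ →
                     ∃[ D ] D ⊆ E G ∩ inducedBy (ends G) S × Nonempty D × TwoRegular G D
two-regular-inside G cubic S S⊆V (s , s∈) small =
  let (D , D⊆P , ne , even) = even-subgraph G S s∈ P (λ e∈ → p∩q⊆q (E G) _ e∈) S≤P in
  D , D⊆P , ne , λ v → even≤3 _ (degree≤3 G cubic (λ e∈ → p∩q⊆p (E G) _ (D⊆P e∈)) v) (even v)
  where
  P = E G ∩ inducedBy (ends G) S
  S≤P : ∣ S ∣ ≤ ∣ P ∣
  -- With b ≤ ∣S∣ leaving edges, ∣P∣ < ∣S∣ would give 2∣P∣ + b < 2∣S∣ + b ≤ 3∣S∣, against
  -- `cubic-count`.
  S≤P = ℕ.≮⇒≥ λ P<S → ℕ.<⇒≢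
    (ℕ.<-≤-trans (ℕ.+-monoˡ-< (∑1 (Leaves? G S)) (ℕ.+-mono-< P<S P<S))
      (ℕ.≤-trans (ℕ.+-monoʳ-≤ (∣ S ∣ + ∣ S ∣) small)
                 (ℕ.≤-reflexive (ℕ.+-comm (∣ S ∣ + ∣ S ∣) ∣ S ∣))))
    (sym (cubic-count G cubic S S⊆V))

tail-∖ : (G : Graph n m) (X : Subset m) (d : Dart m) → tail (G ∖ X) d ≡ tail G d
tail-∖ G X (e , false) = refl
tail-∖ G X (e , true)  = refl

degree-∖ : (G : Graph n m) (X D : Subset m) (v : Fin n) → degree (G ∖ X) D v ≡ degree G D v
degree-∖ G X D v = trans (degree-∑ (G ∖ X) D v) (trans
  (ℕ∑.∑-cong (At? (G ∖ X) D v) (At? G D v)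
    (λ d (p , q) → p , trans (sym (tail-∖ G X d)) q) (λ d (p , q) → p , trans (tail-∖ G X d) q)
    (λ _ _ → refl))
  (sym (degree-∑ G D v)))

Nonempty⇒0<∣∣ : {S : Subset n} → Nonempty S → 0 < ∣ S ∣
Nonempty⇒0<∣∣ (x , x∈) = ℕ.≤-<-trans z≤n (x∈p⇒∣p-x∣<∣p∣ x∈)

-- By the equation `s` and `b` have the same parity. This excludes the pairs (1, 2) and (2, 3) for
-- (s, b) and leaves (1, 3) as the only exception to b ≤ s.
small-or-singleton : ∀ s p b → 0 < s → b ≤ 3 → s + (s + s) ≡ (p + p) + b → b ≤ s ⊎ (b ≡ 3 × s ≡ 1)
small-or-singleton s p b 0<s b≤3 eq = go s b 0<s b≤3 parity
  where
  parity : odd s ≡ odd b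
  parity = begin
    odd s                         ≡⟨ sym (Bool.xor-identityʳ _) ⟩
    odd s xor false               ≡⟨ cong (odd s xor_) (sym (odd-double s)) ⟩
    odd s xor odd (s + s)         ≡⟨ sym (odd-+ s (s + s)) ⟩
    odd (s + (s + s))             ≡⟨ cong odd eq ⟩
    odd ((p + p) + b)             ≡⟨ odd-+ (p + p) b ⟩
    odd (p + p) xor odd b         ≡⟨ cong (_xor odd b) (odd-double p) ⟩
    odd b                         ∎
    where open ≡-Reasoning
  go : ∀ s b → 0 < s → b ≤ 3 → odd s ≡ odd b → b ≤ s ⊎ (b ≡ 3 × s ≡ 1)
  go (suc s) 0 _ _ _ = inj₁ z≤n
  go (suc s) 1 _ _ _ = inj₁ (s≤s z≤n)
  go (suc (suc s)) 2 _ _ _ = inj₁ (s≤s (s≤s z≤n))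
  go 1 3 _ _ _ = inj₂ (refl , refl)
  go (suc (suc (suc s))) 3 _ _ _ = inj₁ (s≤s (s≤s (s≤s z≤n)))
  go _ (suc (suc (suc (suc b)))) _ (s≤s (s≤s (s≤s ()))) _

circuit-inside : (G : Graph n m) (D : Subset m) → D ⊆ E G → Nonempty D → TwoRegular G D →
                 ∃[ D′ ] Circuit G D′ × D′ ⊆ D
circuit-inside G D D⊆E (e , e∈) reg =
  component-edges G D (tail G (e , false)) ,
  component-circuit G D D⊆E reg (e , false) e∈ ,
  component-edges⊆ G D

module SmallCut (G : Graph n m) (cubic : Cubic G) where

  SpansTwoRegular : Subset n → Set
  SpansTwoRegular S = ∃[ D ] D ⊆ E G ∩ inducedBy (ends G) S × Nonempty D × TwoRegular G D

  -- Makes cyclic edge-connectivity applicable to arbitrary small cuts: apart from a single vertex,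
  -- every shore provides the circuit that the definition asks for.
  side : (S : Subset n) → Nonempty (S ∩ V G) → ∑1 (Leaves? G S) ≤ 3 →
         (∑1 (Leaves? G S) ≡ 3 × ∣ S ∩ V G ∣ ≡ 1) ⊎ SpansTwoRegular S
  side S ne b≤3 = go (small-or-singleton ∣ S ∩ V G ∣ p _ (Nonempty⇒0<∣∣ ne) b≤3
    (subst (λ b → ∣ S ∩ V G ∣ + (∣ S ∩ V G ∣ + ∣ S ∩ V G ∣) ≡ (p + p) + b) (∑1-Leaves-V G S)
      (cubic-count G cubic (S ∩ V G) (p∩q⊆q S (V G)))))
    where
    p = ∣ E G ∩ inducedBy (ends G) (S ∩ V G) ∣
    b = ∑1 (Leaves? G S)
    go : b ≤ ∣ S ∩ V G ∣ ⊎ (b ≡ 3 × ∣ S ∩ V G ∣ ≡ 1) →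
         (b ≡ 3 × ∣ S ∩ V G ∣ ≡ 1) ⊎ SpansTwoRegular S
    go (inj₂ single) = inj₁ single
    go (inj₁ b≤s) =
      let (D , D⊆ , ne , reg) = two-regular-inside G cubic (S ∩ V G) (p∩q⊆q S (V G)) ne
                                  (subst (_≤ ∣ S ∩ V G ∣) (sym (∑1-Leaves-V G S)) b≤s) in
      inj₂ (D , (λ e∈ → let (e∈E , e∈T) = x∈p∩q⁻ (E G) _ (D⊆ e∈) in
        x∈p∩q⁺ (e∈E , ∈-inducedBy G S λ b → p∩q⊆p S (V G) (∈-inducedBy⁻ G _ e∈T b))) , ne , reg)

  not-joined : (S : Subset n) {u v : Fin n} → u ∈ S → Connected G (E G ─ boundary G S) u v → v ∈ S
  not-joined S u∈ ε = u∈
  not-joined S u∈ ((e , e∈ , b , refl , refl) ◅ rs) = not-joined S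
    (decidable-stable (_ ∈? S) λ h∉ →
      ─-∉ (E G) _ e∈ (Leaves-boundary G S (e , b) (p─q⊆p (E G) _ e∈ , u∈ , h∉)))
    rs

  -- A single vertex has three leaving edges, so with fewer than three both shores contain a
  -- circuit, and removing the boundary separates the two.
  cut≥3 : CyclicallyEdgeConnected 3 G → (S : Subset n) → Nonempty (S ∩ V G) → Nonempty (∁ S ∩ V G) →
          3 ≤ ∑1 (Leaves? G S)
  cut≥3 conn S ne ne′ = ℕ.≮⇒≥ λ b<3 → go b<3
    (side S ne (ℕ.<⇒≤ b<3))
    (side (∁ S) ne′ (subst (_≤ 3) (sym (∑1-Leaves-∁ G S)) (ℕ.<⇒≤ b<3)))
    where
    X = boundary G S
    inside-S : ∀ (T : Subset n) {D : Subset m} → D ⊆ E G ∩ inducedBy (ends G) T →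
               (∀ {e} → e ∈ inducedBy (ends G) T → e ∉ X) → D ⊆ E G ─ X
    inside-S T D⊆ avoid e∈ = let (e∈E , e∈T) = x∈p∩q⁻ (E G) _ (D⊆ e∈) in
      x∈p∧x∉q⇒x∈p─q e∈E (avoid e∈T)
    vertex : ∀ {D : Subset m} (T : Subset n) → Circuit (G ∖ X) D → D ⊆ inducedBy (ends G) T →
             ∃[ v ] VertexOf G D v × v ∈ T
    vertex T (_ , (e , e∈) , _) D⊆ =
      tail G (e , false) , (e , e∈ , false , refl) , ∈-inducedBy⁻ G T (D⊆ e∈) false
    go : ∑1 (Leaves? G S) < 3 →
         (∑1 (Leaves? G S) ≡ 3 × ∣ S ∩ V G ∣ ≡ 1) ⊎ SpansTwoRegular S →
         (∑1 (Leaves? G (∁ S)) ≡ 3 × ∣ ∁ S ∩ V G ∣ ≡ 1) ⊎ SpansTwoRegular (∁ S) → ⊥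
    go b<3 (inj₁ (b≡3 , _)) _ = ℕ.<⇒≢ b<3 b≡3
    go b<3 (inj₂ _) (inj₁ (b≡3 , _)) = ℕ.<⇒≢ b<3 (trans (sym (∑1-Leaves-∁ G S)) b≡3)
    go b<3 (inj₂ (D₁ , D₁⊆ , ne₁ , reg₁)) (inj₂ (D₂ , D₂⊆ , ne₂ , reg₂)) =
      conn X (boundary⊆E G S) (subst (_< 3) (sym (∣boundary∣ G S)) b<3)
        (proj₁ C₁ , proj₁ C₂ , proj₁ (proj₂ C₁) , proj₁ (proj₂ C₂) ,
         proj₁ v₁ , proj₁ v₂ , proj₁ (proj₂ v₁) , proj₁ (proj₂ v₂) ,
         λ path → x∈∁p⇒x∉p (proj₂ (proj₂ v₂)) (not-joined S (proj₂ (proj₂ v₁)) path))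
      where
      regular : ∀ {D} → TwoRegular G D → TwoRegular (G ∖ X) D
      regular {D} reg v = subst (λ k → k ≡ 0 ⊎ k ≡ 2) (sym (degree-∖ G X D v)) (reg v)
      C₁ = circuit-inside (G ∖ X) D₁
        (inside-S S D₁⊆ (λ e∈S e∈X → ─-∉ (E G) _ e∈X (x∈p∪q⁺ (inj₁ e∈S)))) ne₁ (regular reg₁)
      C₂ = circuit-inside (G ∖ X) D₂
        (inside-S (∁ S) D₂⊆ (λ e∈S e∈X → ─-∉ (E G) _ e∈X (x∈p∪q⁺ (inj₂ e∈S)))) ne₂ (regular reg₂)
      v₁ = vertex S (proj₁ (proj₂ C₁)) (λ e∈ → p∩q⊆q (E G) _ (D₁⊆ (proj₂ (proj₂ C₁) e∈)))
      v₂ = vertex (∁ S) (proj₁ (proj₂ C₂)) (λ e∈ → p∩q⊆q (E G) _ (D₂⊆ (proj₂ (proj₂ C₂) e∈)))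

  3-cut : (S : Subset n) → Nonempty (S ∩ V G) → Nonempty (∁ S ∩ V G) → ∑1 (Leaves? G S) ≡ 3 →
          ∣ S ∩ V G ∣ ≡ 1 ⊎ ∣ ∁ S ∩ V G ∣ ≡ 1 ⊎ CycleSeparatingCut G (boundary G S)
  3-cut S ne ne′ b≡3 = go (side S ne (ℕ.≤-reflexive b≡3))
    (side (∁ S) ne′ (ℕ.≤-reflexive (trans (∑1-Leaves-∁ G S) b≡3)))
    where
    circuit : ∀ (T : Subset n) → SpansTwoRegular T →
              ∃[ D ] Circuit G D × D ⊆ inducedBy (ends G) T
    circuit T (D , D⊆ , ne , reg) =
      let (D′ , c , D′⊆) = circuit-inside G D (λ e∈ → p∩q⊆p (E G) _ (D⊆ e∈)) ne reg in
      D′ , c , λ e∈ → p∩q⊆q (E G) _ (D⊆ (D′⊆ e∈))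
    go : (∑1 (Leaves? G S) ≡ 3 × ∣ S ∩ V G ∣ ≡ 1) ⊎ SpansTwoRegular S →
         (∑1 (Leaves? G (∁ S)) ≡ 3 × ∣ ∁ S ∩ V G ∣ ≡ 1) ⊎ SpansTwoRegular (∁ S) →
         ∣ S ∩ V G ∣ ≡ 1 ⊎ ∣ ∁ S ∩ V G ∣ ≡ 1 ⊎ CycleSeparatingCut G (boundary G S)
    go (inj₁ (_ , s≡1)) _ = inj₁ s≡1
    go (inj₂ _) (inj₁ (_ , s≡1)) = inj₂ (inj₁ s≡1)
    go (inj₂ c₁) (inj₂ c₂) = inj₂ (inj₂ (S , refl , circuit S c₁ , circuit (∁ S) c₂))

-- Flows and deletable edges

-- Steps along the darts that satisfy `P`. Directed walks can thus be treated before an orientation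
-- is fixed, for instance along the darts of positive flow.
Run : Graph n m → (Dart m → Set) → Fin n → Fin n → Set
Run G P u v = ∃[ d ] edge d ∈ E G × P d × tail G d ≡ u × head G d ≡ v

Run? : (G : Graph n m) {P : Dart m → Set} → (∀ d → Dec (P d)) → ∀ u v → Dec (Run G P u v)
Run? G {P} P? u v = map′
  (λ { (e , inj₁ p) → (e , false) , p ; (e , inj₂ p) → (e , true) , p })
  (λ { ((e , false) , p) → e , inj₁ p ; ((e , true) , p) → e , inj₂ p })
  (Fin.any? λ e → step (e , false) ⊎-dec step (e , true))
  where
  step : ∀ d → Dec (edge d ∈ E G × P d × tail G d ≡ u × head G d ≡ v)
  step d = (edge d ∈? E G) ×-dec P? d ×-dec (tail G d ≟ u) ×-dec (head G d ≟ v)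

x≡-x⇒x≡0 : ∀ x → x ≡ ℤ.- x → x ≡ 0ℤ
x≡-x⇒x≡0 (ℤ.+ zero)  _ = refl
x≡-x⇒x≡0 (ℤ.+ suc n) ()
x≡-x⇒x≡0 ℤ.-[1+ n ] ()

≯0⇒≡-∣∣ : ∀ {x} → ¬ 0ℤ ℤ.< x → x ≡ ℤ.- (ℤ.+ ℤ.∣ x ∣)
≯0⇒≡-∣∣ {ℤ.+ zero}  _ = refl
≯0⇒≡-∣∣ {ℤ.+ suc n} h = contradiction (ℤ.+<+ (s≤s z≤n)) h
≯0⇒≡-∣∣ {ℤ.-[1+ n ]} _ = refl

1≤∣∣ : ∀ {x} → x ≢ 0ℤ → 1 ≤ ℤ.∣ x ∣
1≤∣∣ {ℤ.+ zero}  h = contradiction refl h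
1≤∣∣ {ℤ.+ suc n} _ = s≤s z≤n
1≤∣∣ {ℤ.-[1+ n ]} _ = s≤s z≤n

>0⇒≡+∣∣ : ∀ {x} → 0ℤ ℤ.< x → x ≡ ℤ.+ ℤ.∣ x ∣
>0⇒≡+∣∣ {ℤ.+ n} _ = refl

∑-neg : {I : Set} {{_ : Enumeration I}} {P : I → Set} (P? : ∀ i → Dec (P i)) (f : I → ℤ) →
        (∀ i → P i → f i ≡ ℤ.- (ℤ.+ ℤ.∣ f i ∣)) →
        ℤ∑.∑ P? f ≡ ℤ.- (ℤ.+ ℕ∑.∑ P? (ℤ.∣_∣ ∘ f))
∑-neg P? f h = trans (ℤ∑.∑-cong′ P? h) (sym
  (∑-homo ℕ.+-0-isCommutativeMonoid ℤ.+-0-isCommutativeMonoid (λ k → ℤ.- (ℤ.+ k)) refl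
    (λ x y → ℤ.neg-distrib-+ (ℤ.+ x) (ℤ.+ y)) P? (ℤ.∣_∣ ∘ f)))

-- Being antisymmetric on darts, a flow needs no reference orientation, and the sum over the darts
-- starting at `v` is already the net outflow.
record IsFlow (G : Graph n m) (φ : Dart m → ℤ) : Set where
  field
    antisymmetric : ∀ d → edge d ∈ E G → φ (rev d) ≡ ℤ.- φ d
    conserved     : ∀ v → v ∈ V G → ℤ∑.∑ (At? G (E G) v) φ ≡ 0ℤ

module Flow {G : Graph n m} {φ : Dart m → ℤ} (flow : IsFlow G φ) where
  open IsFlow flow

  -- Reversal permutes the darts inside the shore and negates their values, so the sum equals its
  -- own negative.
  inside-∑ : (S : Subset n) (T : Subset n) → T ≡ S ∩ V G →
             ℤ∑.∑ (λ d → ((edge d ∈? E G) ×-dec (tail G d ∈? T)) ×-dec (head G d ∈? S)) φ ≡ 0ℤ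
  inside-∑ S T refl = x≡-x⇒x≡0 _ (begin
    ℤ∑.∑ P? φ                    ≡⟨ sym (ℤ∑.∑-reindex P? P? _≟ᵈ_ rev φ
                                      flip-P (λ d d′ _ _ eq → trans (sym (rev-rev d))
                                        (trans (cong rev eq) (rev-rev d′)))
                                      (λ d p → rev d , flip-P d p , rev-rev d)) ⟩
    ℤ∑.∑ P? (φ ∘ rev)            ≡⟨ ℤ∑.∑-cong′ P? (λ d ((e∈ , _) , _) → antisymmetric d e∈) ⟩
    ℤ∑.∑ P? (λ d → ℤ.- φ d)      ≡⟨ sym (∑-homo ℤ.+-0-isCommutativeMonoid ℤ.+-0-isCommutativeMonoid
                                      ℤ.-_ refl ℤ.neg-distrib-+ P? φ) ⟩
    ℤ.- ℤ∑.∑ P? φ                ∎)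
    where
    open ≡-Reasoning
    P? : ∀ d → Dec ((edge d ∈ E G × tail G d ∈ T) × head G d ∈ S)
    P? d = ((edge d ∈? E G) ×-dec (tail G d ∈? T)) ×-dec (head G d ∈? S)
    flip-P : ∀ d → (edge d ∈ E G × tail G d ∈ T) × head G d ∈ S →
             (edge d ∈ E G × head G d ∈ T) × head G (rev d) ∈ S
    flip-P d ((e∈ , t∈) , h∈) =
      (e∈ , x∈p∩q⁺ (h∈ , tail∈V G (rev d) e∈)) ,
      subst (_∈ S) (sym (head-rev G d)) (proj₁ (x∈p∩q⁻ S (V G) t∈))

  flow-cut : (S : Subset n) → ℤ∑.∑ (Leaves? G S) φ ≡ 0ℤ
  flow-cut S = begin
    ℤ∑.∑ (Leaves? G S) φ
      ≡⟨ ℤ∑.∑-cong (Leaves? G S) (λ d → from-T d ×-dec ¬? (head G d ∈? S))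
           (λ { d (e∈ , t∈ , h∉) → (e∈ , x∈p∩q⁺ (t∈ , tail∈V G d e∈)) , h∉ })
           (λ { d ((e∈ , t∈) , h∉) → e∈ , proj₁ (x∈p∩q⁻ S (V G) t∈) , h∉ }) (λ _ _ → refl) ⟩
    ℤ∑.∑ (λ d → from-T d ×-dec ¬? (head G d ∈? S)) φ
      ≡⟨ sym (ℤ.+-identityˡ _) ⟩
    0ℤ ℤ.+ ℤ∑.∑ (λ d → from-T d ×-dec ¬? (head G d ∈? S)) φ
      ≡⟨ cong (ℤ._+ ℤ∑.∑ (λ d → from-T d ×-dec ¬? (head G d ∈? S)) φ) (sym (inside-∑ S T refl)) ⟩
    ℤ∑.∑ (λ d → from-T d ×-dec (head G d ∈? S)) φ ℤ.+ ℤ∑.∑ (λ d → from-T d ×-dec ¬? (head G d ∈? S)) φ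
      ≡⟨ sym (ℤ∑.∑-split from-T (λ d → head G d ∈? S) φ) ⟩
    ℤ∑.∑ from-T φ
      ≡⟨ sym (Fibres.∑-fibres ℤ.+-0-isCommutativeMonoid (λ d → edge d ∈? E G) (_∈? T) _≟_ (tail G) φ) ⟩
    ℤ∑.∑ (_∈? T) (λ v → ℤ∑.∑ (At? G (E G) v) φ)
      ≡⟨ ℤ∑.∑-𝟘 (_∈? T) _ (λ v v∈ → conserved v (proj₂ (x∈p∩q⁻ S (V G) v∈))) ⟩
    0ℤ ∎
    where
    open ≡-Reasoning
    T = S ∩ V G
    from-T : ∀ d → Dec (edge d ∈ E G × tail G d ∈ T)
    from-T d = (edge d ∈? E G) ×-dec (tail G d ∈? T)

  module _ (nonzero : ∀ d → edge d ∈ E G → φ d ≢ 0ℤ) where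

    ∑1≤∑∣∣ : {P : Dart m → Set} (P? : ∀ d → Dec (P d)) → (∀ d → P d → edge d ∈ E G) →
             ∑1 P? ≤ ℕ∑.∑ P? (ℤ.∣_∣ ∘ φ)
    ∑1≤∑∣∣ P? P⊆ = ∑-mono-≤ P? P? (λ _ p → p) (λ d p → 1≤∣∣ (nonzero d (P⊆ d p)))

    -- The sum over the cut is minus the sum of the absolute values, each at least 1, and it is zero
    -- by `flow-cut`; so there are no terms.
    only-incoming : (S : Subset n) → (∀ d → Leaves G S d → ¬ 0ℤ ℤ.< φ d) → ∑1 (Leaves? G S) ≡ 0
    only-incoming S neg = ℕ.n≤0⇒n≡0 (ℕ.≤-trans (∑1≤∑∣∣ (Leaves? G S) (λ _ → proj₁))
      (ℕ.≤-reflexive (ℤ.+-injective (ℤ.neg-injective (trans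
        (sym (∑-neg (Leaves? G S) φ (λ d l → ≯0⇒≡-∣∣ (neg d l))))
        (flow-cut S))))))

    module _ (S : Subset n) (δ : Dart m) (δ-leaves : Leaves G S δ)
             (neg : ∀ d → Leaves G S d → d ≢ δ → ¬ 0ℤ ℤ.< φ d) where

      Others? : ∀ d → Dec (Leaves G S d × d ≢ δ)
      Others? d = Leaves? G S d ×-dec ¬? (d ≟ᵈ δ)

      single-outgoing : 0ℤ ℤ.< φ δ → ℕ∑.∑ Others? (ℤ.∣_∣ ∘ φ) ≡ ℤ.∣ φ δ ∣
      single-outgoing pos = ℤ.+-injective (sym (ℤ.i-j≡0⇒i≡j _ _ (begin
        ℤ.+ ℤ.∣ φ δ ∣ ℤ.- ℤ.+ ℕ∑.∑ Others? (ℤ.∣_∣ ∘ φ)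
          ≡⟨ cong₂ ℤ._+_
               (trans (sym (>0⇒≡+∣∣ pos)) (sym (ℤ∑.∑-single (λ d → Leaves? G S d ×-dec (d ≟ᵈ δ)) φ
                 (δ-leaves , refl) (λ _ → proj₂))))
               (sym (∑-neg Others? φ (λ d (l , d≢δ) → ≯0⇒≡-∣∣ (neg d l d≢δ)))) ⟩
        ℤ∑.∑ (λ d → Leaves? G S d ×-dec (d ≟ᵈ δ)) φ ℤ.+ ℤ∑.∑ Others? φ
          ≡⟨ sym (ℤ∑.∑-split (Leaves? G S) (_≟ᵈ δ) φ) ⟩
        ℤ∑.∑ (Leaves? G S) φ
          ≡⟨ flow-cut S ⟩
        0ℤ ∎)))
        where open ≡-Reasoning

      ∑1-Leaves-suc : ∑1 (Leaves? G S) ≡ suc (∑1 Others?)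
      ∑1-Leaves-suc = trans (ℕ∑.∑-split (Leaves? G S) (_≟ᵈ δ) (λ _ → 1))
        (cong (_+ ∑1 Others?) (ℕ∑.∑-single (λ d → Leaves? G S d ×-dec (d ≟ᵈ δ)) (λ _ → 1)
          (δ-leaves , refl) (λ _ → proj₂)))

      -- Each absolute value is at least 1, so equality of the totals leaves no excess over 1
      -- anywhere.
      others-unit : ∑1 Others? ≡ ℕ∑.∑ Others? (ℤ.∣_∣ ∘ φ) →
                    ∀ d → Leaves G S d → d ≢ δ → ℤ.∣ φ d ∣ ≡ 1
      others-unit eq d l d≢δ = ℕ.≤-antisym (ℕ.m∸n≡0⇒m≤n excess≡0) (1≤∣∣ (nonzero d (proj₁ l)))
        where
        total : ∑1 Others? + ℕ∑.∑ Others? (λ d → ℤ.∣ φ d ∣ ℕ.∸ 1) ≡ ℕ∑.∑ Others? (ℤ.∣_∣ ∘ φ)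
        total = trans (sym (ℕ∑.∑-∙ Others? _ _))
          (ℕ∑.∑-cong′ Others? (λ d ((e∈ , _) , _) → ℕ.m+[n∸m]≡n (1≤∣∣ (nonzero d e∈))))
        excess≡0 : ℤ.∣ φ d ∣ ℕ.∸ 1 ≡ 0
        excess≡0 = ∑≡0 Others? _≟ᵈ_ (λ d → ℤ.∣ φ d ∣ ℕ.∸ 1)
          (ℕ.+-cancelˡ-≡ (∑1 Others?) _ 0 (trans total (trans (sym eq) (sym (ℕ.+-identityʳ _))))) (l , d≢δ)

    -- By conservation, the only obstruction to deleting an edge that carries 2.
    Blocked : Dart m → Set
    Blocked d = ∃[ S ] Nonempty (S ∩ V G) × Nonempty (∁ S ∩ V G) × Leaves G S d ×
                ∑1 (Leaves? G S) ≡ 3 × ℤ.∣ φ d ∣ ≡ 2 ×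
                (∀ d′ → Leaves G S d′ → d′ ≢ d → ℤ.∣ φ d′ ∣ ≡ 1)

    -- Let `S` be the set reached from `u` by positive darts off `e`. If `v` is not in `S`, the only
    -- positive leaving dart can be one of `e`. If there is none, the cut is empty. Otherwise `e`
    -- balances all other cut edges; as there are at least two of these and `e` carries at most 2,
    -- the values are exactly 2, 1, 1, which is `Blocked`.
    strong-without : (∀ S → Nonempty (S ∩ V G) → Nonempty (∁ S ∩ V G) → 3 ≤ ∑1 (Leaves? G S)) →
                     (e : Fin m) → (∀ b → ℤ.∣ φ (e , b) ∣ ≤ 2) → (∀ b → ¬ Blocked (e , b)) →
                     ∀ u v → u ∈ V G → v ∈ V G →
                     Star (Run G (λ d → 0ℤ ℤ.< φ d × edge d ≢ e)) u v
    strong-without cut e ≤2 unblocked u v u∈ v∈ =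
      decide (v ∈? S)
      where
      P? : ∀ d → Dec (0ℤ ℤ.< φ d × edge d ≢ e)
      P? d = (0ℤ ℤ.<? φ d) ×-dec ¬? (edge d ≟ e)
      C = closureOf (Run? G P?) u
      S = Closure.closure C
      S-ne : Nonempty (S ∩ V G)
      S-ne = u , x∈p∩q⁺ (Closure.start C , u∈)

      outgoing : ∀ d → Leaves G S d → 0ℤ ℤ.< φ d → edge d ≡ e
      outgoing d (e∈ , t∈ , h∉) pos = decidable-stable (edge d ≟ e) λ ≢e →
        h∉ (Closure.closed C t∈ (d , e∈ , (pos , ≢e) , refl , refl))

      module _ (v∉ : v ∉ S) where
        S-ne′ : Nonempty (∁ S ∩ V G)
        S-ne′ = v , x∈p∩q⁺ (x∉p⇒x∈∁p v∉ , v∈)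

        impossible : ∀ b → Leaves G S (e , b) → 0ℤ ℤ.< φ (e , b) → ⊥
        impossible b l pos = unblocked b
          (S , S-ne , S-ne′ , l , ℕ.≤-antisym (subst (_≤ 3) (sym suc-eq) (s≤s (ℕ.≤-trans le (≤2 b)))) (cut S S-ne S-ne′)
          , ℕ.≤-antisym (≤2 b) (ℕ.≤-trans 2≤ le)
          , others-unit S (e , b) l neg (ℕ.≤-antisym le′ (ℕ.≤-trans (ℕ.≤-reflexive single) (ℕ.≤-trans (≤2 b) 2≤))))
          where
          neg : ∀ d → Leaves G S d → d ≢ (e , b) → ¬ 0ℤ ℤ.< φ d
          neg d l′ d≢ pos′ = d≢ (Leaves-edge G S d (e , b) l′ l (outgoing d l′ pos′))
          single = single-outgoing S (e , b) l neg pos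
          suc-eq = ∑1-Leaves-suc S (e , b) l neg
          le′ : ∑1 (Others? S (e , b) l neg) ≤ ℕ∑.∑ (Others? S (e , b) l neg) (ℤ.∣_∣ ∘ φ)
          le′ = ∑1≤∑∣∣ (Others? S (e , b) l neg) (λ _ → proj₁ ∘ proj₁)
          le : ∑1 (Others? S (e , b) l neg) ≤ ℤ.∣ φ (e , b) ∣
          le = ℕ.≤-trans le′ (ℕ.≤-reflexive single)
          2≤ : 2 ≤ ∑1 (Others? S (e , b) l neg)
          2≤ = ℕ.≤-pred (subst (3 ≤_) suc-eq (cut S S-ne S-ne′))

        contradict : ⊥
        contradict = ℕ.1+n≰n (ℕ.≤-trans (ℕ.≤-trans (s≤s z≤n) (cut S S-ne S-ne′)) (ℕ.≤-reflexive
          (only-incoming S λ { d@(e′ , b) l pos → case outgoing d l pos of λ { refl → impossible b l pos } })))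

      decide : Dec (v ∈ S) → Star (Run G (λ d → 0ℤ ℤ.< φ d × edge d ≢ e)) u v
      decide (yes v∈S) = Closure.reachable C v∈S
      decide (no v∉S)  = ⊥-elim (contradict v∉S)

-- Smoothing

∈- : (S : Subset n) {x y : Fin n} → x ∈ S - y → x ∈ S × x ≢ y
∈- S {x} {y} x∈ = p─q⊆p S ⁅ y ⁆ x∈ , λ { refl → ─-∉ S ⁅ y ⁆ x∈ (x∈⁅x⁆ y) }

-- `smooth` reads the ends of the new edge off the list of darts at `v`, whose order depends on the
-- labelling; this determines that list up to order.
two-element : {A : Set} {x y : A} (xs : List A) → Unique xs → x ≢ y → x List.∈ xs → y List.∈ xs →
              (∀ z → z List.∈ xs → z ≡ x ⊎ z ≡ y) → xs ≡ x ∷ y ∷ [] ⊎ xs ≡ y ∷ x ∷ []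
two-element (_ ∷ []) _ x≢y (here refl) (here refl) _ = ⊥-elim (x≢y refl)
two-element (p ∷ q ∷ []) ((p≢q ∷ []) ∷ _) x≢y _ _ only
  with only p (here refl) | only q (there (here refl))
... | inj₁ refl | inj₁ refl = ⊥-elim (p≢q refl)
... | inj₁ refl | inj₂ refl = inj₁ refl
... | inj₂ refl | inj₁ refl = inj₂ refl
... | inj₂ refl | inj₂ refl = ⊥-elim (p≢q refl)
two-element (p ∷ q ∷ r ∷ _) ((p≢q ∷ p≢r ∷ _) ∷ (q≢r ∷ _) ∷ _) x≢y _ _ only
  with only p (here refl) | only q (there (here refl)) | only r (there (there (here refl)))
... | inj₁ refl | inj₁ refl | _         = ⊥-elim (p≢q refl)
... | inj₂ refl | inj₂ refl | _         = ⊥-elim (p≢q refl)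
... | inj₁ refl | inj₂ refl | inj₁ refl = ⊥-elim (p≢r refl)
... | inj₁ refl | inj₂ refl | inj₂ refl = ⊥-elim (q≢r refl)
... | inj₂ refl | inj₁ refl | inj₁ refl = ⊥-elim (q≢r refl)
... | inj₂ refl | inj₁ refl | inj₂ refl = ⊥-elim (p≢r refl)

-- R sends a dart of the smaller graph to the first dart, in the larger graph,
-- of the path it replaces.
record Reduction {n k l : ℕ} (K : Graph n k) (L : Graph n l) (Q : Fin n → Set) : Set where
  field
    R      : Dart l → Dart k
    R-tail : ∀ d → edge d ∈ E L → tail K (R d) ≡ tail L d
    R-edge : ∀ d → edge d ∈ E L → edge (R d) ∈ E K
    R-inj  : ∀ d d′ → edge d ∈ E L → edge d′ ∈ E L → R d ≡ R d′ → d ≡ d′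
    R-surj : ∀ d → edge d ∈ E K → Q (tail K d) → ∃[ d′ ] edge d′ ∈ E L × R d′ ≡ d

Reduction-trans : ∀ {n j k l} {J : Graph n j} {K : Graph n k} {L : Graph n l} {Q Q′ : Fin n → Set} →
                  (∀ {v} → Q′ v → Q v) → Reduction J K Q → Reduction K L Q′ → Reduction J L Q′
Reduction-trans {J = J} {Q′ = Q′} Q′⊆Q r s = record
  { R      = r.R ∘ s.R
  ; R-tail = λ d e∈ → trans (r.R-tail _ (s.R-edge d e∈)) (s.R-tail d e∈)
  ; R-edge = λ d e∈ → r.R-edge _ (s.R-edge d e∈)
  ; R-inj  = λ d d′ e∈ e∈′ eq → s.R-inj d d′ e∈ e∈′ (r.R-inj _ _ (s.R-edge d e∈) (s.R-edge d′ e∈′) eq)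
  ; R-surj = λ d e∈ q →
      let (d₁ , e₁∈ , eq₁) = r.R-surj d e∈ (Q′⊆Q q)
          (d₂ , e₂∈ , eq₂) = s.R-surj d₁ e₁∈ (subst Q′ (trans (cong (tail J) (sym eq₁)) (r.R-tail d₁ e₁∈)) q)
      in d₂ , e₂∈ , trans (cong r.R eq₂) eq₁
  }
  where
  module r = Reduction r
  module s = Reduction s

Reduction-weaken : ∀ {n k l} {K : Graph n k} {L : Graph n l} {Q Q′ : Fin n → Set} →
                   (∀ {v} → Q′ v → Q v) → Reduction K L Q → Reduction K L Q′
Reduction-weaken Q′⊆Q r = record
  { Reduction r hiding (R-surj)
  ; R-surj = λ d e∈ q → Reduction.R-surj r d e∈ (Q′⊆Q q)
  }

-- In the smaller graph `P` is tested only on the first dart of a replaced path. Lifting therefore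
-- requires `P` to pass from that dart to the rest of the path.
Lifts : ∀ {n k l} (K : Graph n k) (L : Graph n l) → (Dart l → Dart k) → (Dart k → Set) → Set
Lifts K L R P = ∀ {s t} → Star (Run L (P ∘ R)) s t → Star (Run K P) s t

delete-reduction : (K : Graph n k) (e : Fin k) → Reduction K (K ∖ ⁅ e ⁆) (λ v → ∀ b → tail K (e , b) ≢ v)
delete-reduction K e = record
  { R      = id
  ; R-tail = λ d _ → sym (tail-∖ K ⁅ e ⁆ d)
  ; R-edge = λ d e∈ → proj₁ (∈- (E K) e∈)
  ; R-inj  = λ _ _ _ _ eq → eq
  ; R-surj = λ { d@(e′ , b) e∈ q → d , x∈p∧x≢y⇒x∈p-y e∈ (λ { refl → q b refl }) , refl }
  }

delete-lifts : (K : Graph n k) (e : Fin k) (P : Dart k → Set) → Lifts K (K ∖ ⁅ e ⁆) id P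
delete-lifts K e P = Star.map λ (d , e∈ , p , s , t) →
  d , proj₁ (∈- (E K) e∈) , p , trans (sym (tail-∖ K ⁅ e ⁆ d)) s , trans (sym (tail-∖ K ⁅ e ⁆ (rev d))) t

suc-dart : Dart k → Dart (suc k)
suc-dart (e , b) = suc e , b

record TwoDarts (K : Graph n k) (v : Fin n) (a₁ a₂ : Dart k) : Set where
  field
    distinct : a₁ ≢ a₂
    at₁      : At K (E K) v a₁
    at₂      : At K (E K) v a₂
    only     : ∀ d → At K (E K) v d → d ≡ a₁ ⊎ d ≡ a₂
    head₁    : head K a₁ ≢ v
    head₂    : head K a₂ ≢ v

-- What the later arguments use of a smoothed graph. Which direction of the new edge runs from the
-- end of `a₁` to the end of `a₂` depends on the labelling, hence the existential in `new`.
record Smoothing (K : Graph n k) (v : Fin n) (a₁ a₂ : Dart k) (K′ : Graph n (suc k)) : Set where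
  field
    tail-old : ∀ d → tail K′ (suc-dart d) ≡ tail K d
    V-K′     : ∀ {w} → w ∈ V K′ → w ∈ V K × w ≢ v
    V-K′⁺    : ∀ {w} → w ∈ V K → w ≢ v → w ∈ V K′
    new      : ∃[ b ] tail K′ (zero , b) ≡ head K a₁ × head K′ (zero , b) ≡ head K a₂
    new∈     : zero ∈ E K′
    old∈     : ∀ {e} → suc e ∈ E K′ → e ∈ E K × (∀ b → tail K (e , b) ≢ v)
    old∈⁺    : ∀ {e} → e ∈ E K → (∀ b → tail K (e , b) ≢ v) → suc e ∈ E K′

module SmoothedGraph (K : Graph n k) (v : Fin n) (a₁ a₂ : Dart k) (two : TwoDarts K v a₁ a₂) where
  open TwoDarts two

  private
    K′ = smooth K v

  tail-old : ∀ d → tail K′ (suc-dart d) ≡ tail K d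
  tail-old (e , false) = refl
  tail-old (e , true)  = refl

  V-K′ : ∀ {w} → w ∈ V K′ → w ∈ V K × w ≢ v
  V-K′ = ∈- (V K)

  V-K′⁺ : ∀ {w} → w ∈ V K → w ≢ v → w ∈ V K′
  V-K′⁺ = x∈p∧x≢y⇒x∈p-y

  new-ends : ends K′ zero ≡ (head K a₁ , head K a₂) ⊎ ends K′ zero ≡ (head K a₂ , head K a₁)
  new-ends with dartsAt K (E K) v | two-element (dartsAt K (E K) v) (dartsAt-unique K (E K) v) distinct
      (∈-dartsAt K (E K) v {a₁} at₁) (∈-dartsAt K (E K) v {a₂} at₂)
      (λ z z∈ → only z (∈-dartsAt⁻ K (E K) v z∈))
  ... | _ | inj₁ refl = inj₁ refl
  ... | _ | inj₂ refl = inj₂ refl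

  new : ∃[ b ] tail K′ (zero , b) ≡ head K a₁ × head K′ (zero , b) ≡ head K a₂
  new with new-ends
  ... | inj₁ eq = false , cong proj₁ eq , cong proj₂ eq
  ... | inj₂ eq = true , cong proj₂ eq , cong proj₁ eq

  head∈V : ∀ a → At K (E K) v a → head K a ∈ V K
  head∈V a at = tail∈V K (rev a) (proj₁ at)

  new∈ : zero ∈ E K′
  new∈ = x∈p∩q⁺ {p = inside Vec.∷ E K} (Vec.here , ∈-inducedBy K′ (V K′) both)
    where
    both : ∀ b → tail K′ (zero , b) ∈ V K′
    both b with same-edge (zero , proj₁ new) (zero , b) refl
    ... | inj₁ eq = subst (_∈ V K′) (sym (trans (cong (tail K′) eq) (proj₁ (proj₂ new)))) (V-K′⁺ (head∈V a₁ at₁) head₁)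
    ... | inj₂ eq = subst (_∈ V K′) (sym (trans (cong (tail K′) eq) (proj₂ (proj₂ new)))) (V-K′⁺ (head∈V a₂ at₂) head₂)

  old∈ : ∀ {e} → suc e ∈ E K′ → e ∈ E K × (∀ b → tail K (e , b) ≢ v)
  old∈ {e} e∈ = let (e∈E , e∈V) = x∈p∩q⁻ (inside Vec.∷ E K) _ e∈ in
    drop-there e∈E , λ b eq → proj₂ (V-K′ (∈-inducedBy⁻ K′ (V K′) e∈V b)) (trans (tail-old (e , b)) eq)

  old∈⁺ : ∀ {e} → e ∈ E K → (∀ b → tail K (e , b) ≢ v) → suc e ∈ E K′
  old∈⁺ {e} e∈ avoid = x∈p∩q⁺ {p = inside Vec.∷ E K} (Vec.there e∈ , ∈-inducedBy K′ (V K′) λ b →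
    subst (_∈ V K′) (sym (tail-old (e , b))) (V-K′⁺ (tail∈V K (e , b) e∈) (avoid b)))

  smooth-smoothing : Smoothing K v a₁ a₂ (smooth K v)
  smooth-smoothing = record
    { tail-old = tail-old ; V-K′ = V-K′ ; V-K′⁺ = V-K′⁺ ; new = new ; new∈ = new∈
    ; old∈ = old∈ ; old∈⁺ = old∈⁺ }

module Smooth {K : Graph n k} {v : Fin n} {a₁ a₂ : Dart k} (two : TwoDarts K v a₁ a₂)
  {K′ : Graph n (suc k)} (smoothing : Smoothing K v a₁ a₂ K′) where
  open TwoDarts two
  open Smoothing smoothing public

  α : Dart (suc k)
  α = zero , proj₁ new

  tail-α : tail K′ α ≡ head K a₁
  tail-α = proj₁ (proj₂ new)

  head-α : head K′ α ≡ head K a₂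
  head-α = proj₂ (proj₂ new)

  data View : Dart (suc k) → Set where
    old   : ∀ d → View (suc-dart d)
    new-α : View α
    new-ρ : View (rev α)

  view : ∀ d → View d
  view (suc e , b) = old (e , b)
  view (zero , b) with same-edge α (zero , b) refl
  ... | inj₁ refl = new-α
  ... | inj₂ eq   = subst View (sym eq) new-ρ

  -- `α` stands for the path `rev a₁`, `a₂` through `v`, and its reverse for `rev a₂`, `a₁`.
  R : Dart (suc k) → Dart k
  R (suc e , b) = e , b
  R (zero , b)  = if does (b Bool.≟ proj₁ new) then rev a₁ else rev a₂

  R-α : R α ≡ rev a₁
  R-α = cong (if_then rev a₁ else rev a₂) (dec-true (proj₁ new Bool.≟ proj₁ new) refl)

  R-ρ : R (rev α) ≡ rev a₂
  R-ρ = cong (if_then rev a₁ else rev a₂)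
    (dec-false (not (proj₁ new) Bool.≟ proj₁ new) (Bool.not-¬ refl ∘ sym))

  old-avoids : ∀ d a → edge (suc-dart d) ∈ E K′ → At K (E K) v a → d ≢ rev a
  old-avoids d a e∈ (_ , t) refl = proj₂ (old∈ e∈) (proj₂ a) t

  rev-distinct : rev a₁ ≢ rev a₂
  rev-distinct eq = distinct (trans (sym (rev-rev a₁)) (trans (cong rev eq) (rev-rev a₂)))

  reduction : Reduction K K′ (_≢ v)
  reduction = record { R = R ; R-tail = λ d → R-tail (view d) ; R-edge = λ d → R-edge (view d)
                     ; R-inj = λ d d′ → R-inj (view d) (view d′) ; R-surj = R-surj }
    where
    R-tail : ∀ {d} → View d → edge d ∈ E K′ → tail K (R d) ≡ tail K′ d
    R-tail (old d) _ = sym (tail-old d)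
    R-tail new-α   _ = trans (cong (tail K) R-α) (sym tail-α)
    R-tail new-ρ   _ = trans (cong (tail K) R-ρ) (sym head-α)
    R-edge : ∀ {d} → View d → edge d ∈ E K′ → edge (R d) ∈ E K
    R-edge (old d) e∈ = proj₁ (old∈ e∈)
    R-edge new-α   _  = subst (λ d → edge d ∈ E K) (sym R-α) (proj₁ at₁)
    R-edge new-ρ   _  = subst (λ d → edge d ∈ E K) (sym R-ρ) (proj₁ at₂)
    R-inj : ∀ {d d′} → View d → View d′ → edge d ∈ E K′ → edge d′ ∈ E K′ → R d ≡ R d′ → d ≡ d′
    R-inj (old d) (old d′) _ _ refl = refl
    R-inj (old d) new-α e∈ _ eq = ⊥-elim (old-avoids d a₁ e∈ at₁ (trans eq R-α))
    R-inj (old d) new-ρ e∈ _ eq = ⊥-elim (old-avoids d a₂ e∈ at₂ (trans eq R-ρ))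
    R-inj new-α (old d) _ e∈ eq = ⊥-elim (old-avoids d a₁ e∈ at₁ (trans (sym eq) R-α))
    R-inj new-ρ (old d) _ e∈ eq = ⊥-elim (old-avoids d a₂ e∈ at₂ (trans (sym eq) R-ρ))
    R-inj new-α new-α _ _ _ = refl
    R-inj new-ρ new-ρ _ _ _ = refl
    R-inj new-α new-ρ _ _ eq = ⊥-elim (rev-distinct (trans (sym R-α) (trans eq R-ρ)))
    R-inj new-ρ new-α _ _ eq = ⊥-elim (rev-distinct (sym (trans (sym R-ρ) (trans eq R-α))))
    R-surj : ∀ d → edge d ∈ E K → tail K d ≢ v → ∃[ d′ ] edge d′ ∈ E K′ × R d′ ≡ d
    R-surj d@(e , b) e∈ t≢ with head K d ≟ v
    ... | no h≢ = suc-dart d , old∈⁺ e∈ avoid , refl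
      where
      avoid : ∀ b′ → tail K (e , b′) ≢ v
      avoid b′ with same-edge d (e , b′) refl
      ... | inj₁ eq = subst (λ d → tail K d ≢ v) (sym eq) t≢
      ... | inj₂ eq = subst (λ d → tail K d ≢ v) (sym eq) h≢
    ... | yes h≡ with only (rev d) (e∈ , h≡)
    ...   | inj₁ eq = α , new∈ , trans R-α (trans (cong rev (sym eq)) (rev-rev d))
    ...   | inj₂ eq = rev α , new∈ , trans R-ρ (trans (cong rev (sym eq)) (rev-rev d))

  lifts : (P : Dart k → Set) → (P (rev a₁) → P a₂) → (P (rev a₂) → P a₁) → Lifts K K′ R P
  lifts P c₁ c₂ = kleisliStar id λ (d , e∈ , p , s , t) → step (view d) e∈ p s t
    where
    through : ∀ a a′ → At K (E K) v a → At K (E K) v a′ → P (rev a) → P a′ →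
              Star (Run K P) (head K a) (head K a′)
    through a a′ (e∈ , t) (e∈′ , t′) p p′ =
      (rev a , e∈ , p , refl , trans (head-rev K a) t) ◅ (a′ , e∈′ , p′ , t′ , refl) ◅ ε
    step : ∀ {d} → View d → edge d ∈ E K′ → P (R d) → ∀ {s t} → tail K′ d ≡ s → head K′ d ≡ t →
           Star (Run K P) s t
    step (old d) e∈ p s t = (d , proj₁ (old∈ e∈) , p , trans (sym (tail-old d)) s ,
                             trans (sym (tail-old (rev d))) t) ◅ ε
    step new-α _ p refl refl = subst₂ (Star (Run K P)) (sym tail-α) (sym head-α)
      (through a₁ a₂ at₁ at₂ (subst P R-α p) (c₁ (subst P R-α p)))
    step new-ρ _ p refl refl = subst₂ (Star (Run K P)) (sym head-α)
      (trans (sym tail-α) (sym (head-rev K′ α)))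
      (through a₂ a₁ at₂ at₁ (subst P R-ρ p) (c₂ (subst P R-ρ p)))

-- Describes `K ∼ e` with the ends of `e` named by the user: `α` is the new edge at `x`, `β` the one
-- at `y`. Which of them has label 0 depends on the order in which `ends K e` lists the ends;
-- `labels` keeps both cases, so that the description is symmetric.
record Tilde (K : Graph n k) (e : Fin k) (L : Graph n (2 + k)) (x y : Fin n)
             (a₁ a₂ b₁ b₂ : Dart k) : Set₁ where
  field
    reduction : Reduction (K ∖ ⁅ e ⁆) L (λ v → v ≢ x × v ≢ y)
  open Reduction reduction public
  field
    R-old     : ∀ d → R (suc-dart (suc-dart d)) ≡ d
    tail-old  : ∀ d → tail L (suc-dart (suc-dart d)) ≡ tail K d
    α β       : Dart (2 + k)
    R-α       : R α ≡ rev a₁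
    R-α′      : R (rev α) ≡ rev a₂
    R-β       : R β ≡ rev b₁
    R-β′      : R (rev β) ≡ rev b₂
    labels    : (edge α ≡ zero × edge β ≡ suc zero) ⊎ (edge α ≡ suc zero × edge β ≡ zero)
    α∈        : edge α ∈ E L
    β∈        : edge β ∈ E L
    old∈      : ∀ {f} → suc (suc f) ∈ E L →
                f ∈ E K × f ≢ e × (∀ b → tail K (f , b) ≢ x) × (∀ b → tail K (f , b) ≢ y)
    old∈⁺     : ∀ {f} → f ∈ E K → f ≢ e → (∀ b → tail K (f , b) ≢ x) → (∀ b → tail K (f , b) ≢ y) →
                suc (suc f) ∈ E L
    V-∼       : ∀ {v} → v ∈ V L → v ∈ V K × v ≢ x × v ≢ y
    V-∼⁺      : ∀ {v} → v ∈ V K → v ≢ x → v ≢ y → v ∈ V L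
    lifts     : (P : Dart k → Set) → (P (rev a₁) → P a₂) → (P (rev a₂) → P a₁) →
                (P (rev b₁) → P b₂) → (P (rev b₂) → P b₁) → Lifts (K ∖ ⁅ e ⁆) L R P

  view : ∀ d → (∃[ d₀ ] d ≡ suc-dart (suc-dart d₀)) ⊎ edge d ≡ edge α ⊎ edge d ≡ edge β
  view (suc (suc f) , b) = inj₁ ((f , b) , refl)
  view (zero , b) =
    inj₂ ([ (λ (p , q) → inj₁ (sym p)) , (λ (p , q) → inj₂ (sym q)) ]′ labels)
  view (suc zero , b) =
    inj₂ ([ (λ (p , q) → inj₂ (sym q)) , (λ (p , q) → inj₁ (sym p)) ]′ labels)

Tilde-swap : ∀ {K : Graph n k} {e L x y a₁ a₂ b₁ b₂} →
             Tilde K e L x y a₁ a₂ b₁ b₂ → Tilde K e L y x b₁ b₂ a₁ a₂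
Tilde-swap t = record
  { reduction = record { R = R ; R-tail = R-tail ; R-edge = R-edge ; R-inj = R-inj
                       ; R-surj = λ d e∈ (p , q) → R-surj d e∈ (q , p) }
  ; R-old = R-old ; tail-old = tail-old ; α = β ; β = α
  ; R-α = R-β ; R-α′ = R-β′ ; R-β = R-α ; R-β′ = R-α′
  ; labels = Sum.swap (Sum.map (λ (p , q) → q , p) (λ (p , q) → q , p) labels)
  ; α∈ = β∈ ; β∈ = α∈
  ; old∈ = λ f∈ → let (p , q , r , s) = old∈ f∈ in p , q , s , r
  ; old∈⁺ = λ p q r s → old∈⁺ p q s r
  ; V-∼ = λ v∈ → let (p , q , r) = V-∼ v∈ in p , r , q
  ; V-∼⁺ = λ p q r → V-∼⁺ p r q
  ; lifts = λ P p q r s → lifts P r s p q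
  }
  where open Tilde t

-- The conditions on heads say that no edge other than `e` joins `p` and `q`, so that smoothing `p`
-- leaves both darts at `q` intact.
module TwoSmoothings {K : Graph n k} {e : Fin k} {p q : Fin n} {a₁ a₂ b₁ b₂ : Dart k}
  (at-p : TwoDarts (K ∖ ⁅ e ⁆) p a₁ a₂) (at-q : TwoDarts (K ∖ ⁅ e ⁆) q b₁ b₂) (p≢q : p ≢ q)
  (a₁≢q : head (K ∖ ⁅ e ⁆) a₁ ≢ q) (a₂≢q : head (K ∖ ⁅ e ⁆) a₂ ≢ q)
  (b₁≢p : head (K ∖ ⁅ e ⁆) b₁ ≢ p) (b₂≢p : head (K ∖ ⁅ e ⁆) b₂ ≢ p)
  {L₁ : Graph n (suc k)} (first : Smoothing (K ∖ ⁅ e ⁆) p a₁ a₂ L₁) where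

  private
    L = K ∖ ⁅ e ⁆
    module S = Smooth at-p first

  open TwoDarts at-q

  new-tail≢q : ∀ {d} → S.View d → edge d ≡ zero → tail L₁ d ≢ q
  new-tail≢q (S.old d) ()
  new-tail≢q S.new-α _ t = a₁≢q (trans (sym S.tail-α) t)
  new-tail≢q S.new-ρ _ t = a₂≢q (trans (sym S.head-α) t)

  new-avoids-q : ∀ b → tail L₁ (edge S.α , b) ≢ q
  new-avoids-q b = new-tail≢q (S.view (zero , b)) refl

  avoids-p : ∀ d → At L (E L) q d → head L d ≢ p → ∀ b → tail L (edge d , b) ≢ p
  avoids-p d (_ , t) h≢ b eq with same-edge d (edge d , b) refl
  ... | inj₁ d≡ = p≢q (trans (sym eq) (trans (cong (tail L) d≡) t))
  ... | inj₂ d≡ = h≢ (trans (sym (cong (tail L) d≡)) eq)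

  lift-at : ∀ d → At L (E L) q d → head L d ≢ p → At L₁ (E L₁) q (suc-dart d)
  lift-at d at h≢ = S.old∈⁺ (proj₁ at) (avoids-p d at h≢) , trans (S.tail-old d) (proj₂ at)

  only₁ : ∀ {d} → S.View d → At L₁ (E L₁) q d → d ≡ suc-dart b₁ ⊎ d ≡ suc-dart b₂
  only₁ (S.old d) (e∈ , t) = Sum.map (cong suc-dart) (cong suc-dart)
    (only d (proj₁ (S.old∈ e∈) , trans (sym (S.tail-old d)) t))
  only₁ S.new-α (_ , t) = ⊥-elim (new-tail≢q S.new-α refl t)
  only₁ S.new-ρ (_ , t) = ⊥-elim (new-tail≢q S.new-ρ refl t)

  at-q₁ : TwoDarts L₁ q (suc-dart b₁) (suc-dart b₂)
  at-q₁ = record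
    { distinct = λ { refl → distinct refl }
    ; at₁ = lift-at b₁ at₁ b₁≢p ; at₂ = lift-at b₂ at₂ b₂≢p
    ; only = λ d → only₁ (S.view d)
    ; head₁ = λ h → head₁ (trans (sym (S.tail-old (rev b₁))) h)
    ; head₂ = λ h → head₂ (trans (sym (S.tail-old (rev b₂))) h)
    }

  module _ {L₂ : Graph n (2 + k)} (second : Smoothing L₁ q (suc-dart b₁) (suc-dart b₂) L₂) where
    private module T = Smooth at-q₁ second

    two-smoothings : Tilde K e L₂ p q a₁ a₂ b₁ b₂
    two-smoothings = record
      { reduction = Reduction-trans proj₁ S.reduction
          (Reduction-weaken proj₂ T.reduction)
      ; R-old    = λ _ → refl
      ; tail-old = λ d → trans (T.tail-old (suc-dart d)) (trans (S.tail-old d) (tail-∖ K ⁅ e ⁆ d))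
      ; α        = suc-dart S.α
      ; β        = T.α
      ; R-α      = S.R-α
      ; R-α′     = S.R-ρ
      ; R-β      = cong S.R T.R-α
      ; R-β′     = cong S.R T.R-ρ
      ; labels   = inj₂ (refl , refl)
      ; α∈       = T.old∈⁺ S.new∈ new-avoids-q
      ; β∈       = T.new∈
      ; old∈     = λ {f} f∈ →
          let (f∈₁ , ≢q) = T.old∈ f∈
              (f∈₀ , ≢p) = S.old∈ f∈₁
              (f∈E , f≢e) = ∈- (E K) f∈₀
          in f∈E , f≢e , (λ b t → ≢p b (trans (tail-∖ K ⁅ e ⁆ (f , b)) t)) ,
             (λ b t → ≢q b (trans (S.tail-old (f , b)) (trans (tail-∖ K ⁅ e ⁆ (f , b)) t)))
      ; old∈⁺    = λ {f} f∈ f≢e ≢p ≢q → T.old∈⁺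
          (S.old∈⁺ (x∈p∧x≢y⇒x∈p-y f∈ f≢e) (λ b t → ≢p b (trans (sym (tail-∖ K ⁅ e ⁆ (f , b))) t)))
          (λ b t → ≢q b (trans (sym (trans (S.tail-old (f , b)) (tail-∖ K ⁅ e ⁆ (f , b)))) t))
      ; V-∼      = λ v∈ → let (v∈₁ , ≢q) = T.V-K′ v∈ ; (v∈₀ , ≢p) = S.V-K′ v∈₁ in v∈₀ , ≢p , ≢q
      ; V-∼⁺     = λ v∈ ≢p ≢q → T.V-K′⁺ (S.V-K′⁺ v∈ ≢p) ≢q
      ; lifts    = λ P c₁ c₂ c₃ c₄ → S.lifts P c₁ c₂ ∘ T.lifts (P ∘ S.R) c₃ c₄
      }

tilde-in-order : (K : Graph n k) (e : Fin k) {a₁ a₂ b₁ b₂ : Dart k} →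
  let p = proj₁ (ends K e) ; q = proj₂ (ends K e) ; L = K ∖ ⁅ e ⁆ in
  TwoDarts L p a₁ a₂ → TwoDarts L q b₁ b₂ → p ≢ q →
  head L a₁ ≢ q → head L a₂ ≢ q → head L b₁ ≢ p → head L b₂ ≢ p →
  Tilde K e (K ∼ e) p q a₁ a₂ b₁ b₂
tilde-in-order K e at-p at-q p≢q h₁ h₂ h₃ h₄ =
  TwoSmoothings.two-smoothings {K = K} at-p at-q p≢q h₁ h₂ h₃ h₄ first
    (SmoothedGraph.smooth-smoothing _ _ _ _ (TwoSmoothings.at-q₁ {K = K} at-p at-q p≢q h₁ h₂ h₃ h₄ first))
  where
  first = SmoothedGraph.smooth-smoothing _ _ _ _ at-p

tilde : (K : Graph n k) (e : Fin k) {x y : Fin n} {a₁ a₂ b₁ b₂ : Dart k} → Joins K e x y →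
        TwoDarts (K ∖ ⁅ e ⁆) x a₁ a₂ → TwoDarts (K ∖ ⁅ e ⁆) y b₁ b₂ → x ≢ y →
        head (K ∖ ⁅ e ⁆) a₁ ≢ y → head (K ∖ ⁅ e ⁆) a₂ ≢ y →
        head (K ∖ ⁅ e ⁆) b₁ ≢ x → head (K ∖ ⁅ e ⁆) b₂ ≢ x → Tilde K e (K ∼ e) x y a₁ a₂ b₁ b₂
tilde K e (false , refl , refl) at-x at-y x≢y h₁ h₂ h₃ h₄ =
  tilde-in-order K e at-x at-y x≢y h₁ h₂ h₃ h₄
tilde K e (true , refl , refl) at-x at-y x≢y h₁ h₂ h₃ h₄ =
  Tilde-swap (tilde-in-order K e at-y at-x (x≢y ∘ sym) h₃ h₄ h₁ h₂)

-- Subgraphs with prescribed odd vertices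

lookup-⁅⁆ : (x v : Fin n) → Vec.lookup ⁅ x ⁆ v ≡ does (x ≟ v)
lookup-⁅⁆ x v with x ≟ v
... | yes refl = Vec.[]=⇒lookup (x∈⁅x⁆ x)
... | no x≢v   = lookup-∉ λ v∈ → x≢v (sym (x∈⁅y⁆⇒x≡y x v∈))

X∑-point : {I : Set} {{_ : Enumeration I}} {P : I → Set} (P? : ∀ i → Dec (P i))
           (_≟′_ : (i j : I) → Dec (i ≡ j)) (x : I) →
           X∑.∑ P? (λ i → does (x ≟′ i)) ≡ does (P? x)
X∑-point P? _≟′_ x = trans
  (X∑.∑-split P? (x ≟′_) _) (trans (cong₂ _xor_ (at-x (P? x)) (X∑.∑-𝟘 (λ i → P? i ×-dec ¬? (x ≟′ i)) _
    (λ i (_ , x≢i) → dec-false (x ≟′ i) x≢i))) (Bool.xor-identityʳ _))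
  where
  at-x : (Px? : Dec _) → X∑.∑ (λ i → P? i ×-dec (x ≟′ i)) (λ i → does (x ≟′ i)) ≡ does Px?
  at-x (yes p) = trans (X∑.∑-single (λ i → P? i ×-dec (x ≟′ i)) _ (p , refl) (λ _ → sym ∘ proj₂))
                       (dec-true (x ≟′ x) refl)
  at-x (no ¬p) = X∑.∑-𝟘 (λ i → P? i ×-dec (x ≟′ i)) _ (λ { i (p , refl) → contradiction p ¬p })

∂-⊥ : (G : Graph n m) (v : Fin n) → ∂ G ∅ v ≡ false
∂-⊥ G v = X∑.∑-𝟘 (λ d → tail G d ≟ v) _ (λ d _ → lookup-∉ {x = edge d} ∉⊥)

-- The two directions of the edge contribute at one end each; for a loop the contributions cancel.
∂-edge : (G : Graph n m) (d : Dart m) (v : Fin n) →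
         ∂ G ⁅ edge d ⁆ v ≡ does (tail G d ≟ v) xor does (head G d ≟ v)
∂-edge G d v = begin
  ∂ G ⁅ edge d ⁆ v
    ≡⟨ X∑.∑-cong′ (λ d′ → tail G d′ ≟ v) (λ d′ _ → trans (lookup-⁅⁆ (edge d) (edge d′)) (ends-of d d′)) ⟩
  X∑.∑ (λ d′ → tail G d′ ≟ v) (λ d′ → does (d ≟ᵈ d′) xor does (rev d ≟ᵈ d′))
    ≡⟨ X∑.∑-∙ (λ d′ → tail G d′ ≟ v) _ _ ⟩
  X∑.∑ (λ d′ → tail G d′ ≟ v) (λ d′ → does (d ≟ᵈ d′)) xor
  X∑.∑ (λ d′ → tail G d′ ≟ v) (λ d′ → does (rev d ≟ᵈ d′))
    ≡⟨ cong₂ _xor_ (X∑-point (λ d′ → tail G d′ ≟ v) _≟ᵈ_ d) (X∑-point (λ d′ → tail G d′ ≟ v) _≟ᵈ_ (rev d)) ⟩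
  does (tail G d ≟ v) xor does (head G d ≟ v) ∎
  where
  open ≡-Reasoning
  ends-of : ∀ d d′ → does (edge d ≟ edge d′) ≡ does (d ≟ᵈ d′) xor does (rev d ≟ᵈ d′)
  ends-of d d′ = by-cases (edge d ≟ edge d′)
    where
    by-cases : (e? : Dec (edge d ≡ edge d′)) → does e? ≡ does (d ≟ᵈ d′) xor does (rev d ≟ᵈ d′)
    by-cases (no e≢) = sym (cong₂ _xor_ (dec-false (d ≟ᵈ d′) (e≢ ∘ cong edge))
                                        (dec-false (rev d ≟ᵈ d′) (e≢ ∘ cong edge)))
    by-cases (yes e≡) with same-edge d d′ e≡
    ... | inj₁ refl = sym (cong₂ _xor_ (dec-true (d ≟ᵈ d) refl) (dec-false (rev d ≟ᵈ d) (rev≢ d)))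
    ... | inj₂ refl = sym (cong₂ _xor_ (dec-false (d ≟ᵈ rev d) (rev≢ d ∘ sym))
                                       (dec-true (rev d ≟ᵈ rev d) refl))

xor-cancel : ∀ a b c → (a xor b) xor (b xor c) ≡ a xor c
xor-cancel true  true  c = refl
xor-cancel true  false c = refl
xor-cancel false true  c = Bool.not-involutive c
xor-cancel false false c = refl

-- Adding the edges of the walk modulo 2 telescopes at inner vertices. The walk may repeat edges,
-- which then cancel.
path-subgraph : (G : Graph n m) (A : Subset m) {u v : Fin n} → Connected G A u v →
                ∃[ J ] J ⊆ A × (∀ w → ∂ G J w ≡ does (u ≟ w) xor does (v ≟ w))
path-subgraph G A {u} ε =
  ∅ , (λ e∈ → contradiction e∈ ∉⊥) , λ w → trans (∂-⊥ G w) (sym (Bool.xor-same (does (u ≟ w))))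
path-subgraph G A {v = v} ((e , e∈ , b , refl , refl) ◅ rs) =
  let (J , J⊆ , ∂J) = path-subgraph G A rs in
  ⁅ e ⁆ ⊕ J ,
  (λ {f} f∈ → [ (λ f∈e → subst (_∈ A) (sym (x∈⁅y⁆⇒x≡y e f∈e)) e∈) , J⊆ ]′ (∈-⊕ ⁅ e ⁆ J f∈)) ,
  λ w → trans (∂-⊕ G ⁅ e ⁆ J w) (trans (cong₂ _xor_ (∂-edge G (e , b) w) (∂J w))
          (xor-cancel (does (tail G (e , b) ≟ w)) (does (head G (e , b) ≟ w)) (does (v ≟ w))))

-- Pair up the vertices of U inside each component and add paths joining the pairs.
subgraph-with-odd-set : (G : Graph n m) (A : Subset m) (U : Subset n) →
                        (∀ v → X∑.∑ (_∈? component G A v) (Vec.lookup U) ≡ false) →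
                        ∃[ J ] J ⊆ A × (∀ v → ∂ G J v ≡ Vec.lookup U v)
subgraph-with-odd-set {n} {m} G A U = go U (ℕ.<-wellFounded ∣ U ∣)
  where
  Even : Subset n → Set
  Even U = ∀ v → X∑.∑ (_∈? component G A v) (Vec.lookup U) ≡ false

  go : (U : Subset n) → Acc ℕ._<_ ∣ U ∣ → Even U → ∃[ J ] J ⊆ A × (∀ v → ∂ G J v ≡ Vec.lookup U v)
  go U (acc rec) even with nonempty? U
  ... | no empty = ∅ , (λ e∈ → contradiction e∈ ∉⊥) ,
                   λ v → trans (∂-⊥ G v) (sym (lookup-∉ λ v∈ → empty (v , v∈)))
  ... | yes (u , u∈) with Fin.any? (λ v → (v ∈? component G A u) ×-dec (v ∈? U) ×-dec ¬? (v ≟ u))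
  -- With `u` as the only vertex of `U` in its component, the parity of that component would be odd.
  ...   | no alone = contradiction (trans (sym (even u)) one) λ ()
    where
    one : X∑.∑ (_∈? component G A u) (Vec.lookup U) ≡ true
    one = trans (X∑.∑-cong′ (_∈? component G A u) agree)
      (trans (X∑-point (_∈? component G A u) _≟_ u) (dec-true (u ∈? component G A u) (Closure.start (reach G A u))))
      where
      agree : ∀ v → v ∈ component G A u → Vec.lookup U v ≡ does (u ≟ v)
      agree v v∈ with u ≟ v
      ... | yes refl = Vec.[]=⇒lookup u∈
      ... | no u≢v   = lookup-∉ λ v∈U → alone (v , v∈ , v∈U , u≢v ∘ sym)
  ...   | yes (w , w∈ , w∈U , w≢u) =
    let (J , J⊆ , ∂J) = go U′ (rec (p⊂q⇒∣p∣<∣q∣ (U′⊆U , u , u∈ , u∉U′))) even′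
        (P , P⊆ , ∂P) = path-subgraph G A (∈-component⁻ G A w∈)
    in J ⊕ P , (λ e∈ → [ J⊆ , P⊆ ]′ (∈-⊕ J P e∈)) , λ v → begin
      ∂ G (J ⊕ P) v                                                   ≡⟨ ∂-⊕ G J P v ⟩
      ∂ G J v xor ∂ G P v                                             ≡⟨ cong₂ _xor_ (∂J v) (∂P v) ⟩
      Vec.lookup U′ v xor (does (u ≟ v) xor does (w ≟ v))
        ≡⟨ cong (_xor (does (u ≟ v) xor does (w ≟ v))) (lookup-U′ v) ⟩
      (Vec.lookup U v xor (does (u ≟ v) xor does (w ≟ v))) xor (does (u ≟ v) xor does (w ≟ v))
        ≡⟨ Bool.xor-assoc (Vec.lookup U v) _ _ ⟩
      Vec.lookup U v xor ((does (u ≟ v) xor does (w ≟ v)) xor (does (u ≟ v) xor does (w ≟ v)))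
        ≡⟨ cong (Vec.lookup U v xor_) (Bool.xor-same (does (u ≟ v) xor does (w ≟ v))) ⟩
      Vec.lookup U v xor false                                        ≡⟨ Bool.xor-identityʳ _ ⟩
      Vec.lookup U v                                                  ∎
    where
    open ≡-Reasoning
    U′ = U ⊕ (⁅ u ⁆ ⊕ ⁅ w ⁆)

    lookup-U′ : ∀ v → Vec.lookup U′ v ≡ Vec.lookup U v xor (does (u ≟ v) xor does (w ≟ v))
    lookup-U′ v = trans (lookup-⊕ U _ v) (cong (Vec.lookup U v xor_)
      (trans (lookup-⊕ ⁅ u ⁆ ⁅ w ⁆ v) (cong₂ _xor_ (lookup-⁅⁆ u v) (lookup-⁅⁆ w v))))

    U′⊆U : U′ ⊆ U
    U′⊆U {v} v∈ = [ id , (λ v∈uw → [ (λ p → subst (_∈ U) (sym (x∈⁅y⁆⇒x≡y u p)) u∈)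
                                    , (λ p → subst (_∈ U) (sym (x∈⁅y⁆⇒x≡y w p)) w∈U) ]′
                                    (∈-⊕ ⁅ u ⁆ ⁅ w ⁆ v∈uw)) ]′ (∈-⊕ U _ v∈)

    u∉U′ : u ∉ U′
    u∉U′ u∈′ = contradiction (trans (sym (Vec.[]=⇒lookup u∈′)) (trans (lookup-U′ u)
      (cong₂ _xor_ (Vec.[]=⇒lookup u∈) (cong₂ _xor_ (dec-true (u ≟ u) refl) (dec-false (w ≟ u) w≢u))))) λ ()

    even′ : Even U′
    even′ v = begin
      X∑.∑ K? (Vec.lookup U′)
        ≡⟨ X∑.∑-cong′ K? (λ x _ → lookup-U′ x) ⟩
      X∑.∑ K? (λ x → Vec.lookup U x xor (does (u ≟ x) xor does (w ≟ x)))
        ≡⟨ trans (X∑.∑-∙ K? _ _) (cong₂ _xor_ (even v) (X∑.∑-∙ K? _ _)) ⟩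
      X∑.∑ K? (λ x → does (u ≟ x)) xor X∑.∑ K? (λ x → does (w ≟ x))
        ≡⟨ cong₂ _xor_ (X∑-point K? _≟_ u) (X∑-point K? _≟_ w) ⟩
      does (K? u) xor does (K? w)
        ≡⟨ cong (_xor does (K? w)) same ⟩
      does (K? w) xor does (K? w)
        ≡⟨ Bool.xor-same (does (K? w)) ⟩
      false ∎
      where
      K? = _∈? component G A v
      same : does (K? u) ≡ does (K? w)
      same with K? u
      ... | yes p = sym (dec-true (K? w) (∈-component G A (∈-component⁻ G A p ◅◅ ∈-component⁻ G A w∈)))
      ... | no ¬p = sym (dec-false (K? w) λ p → ¬p (∈-component G A
                      (∈-component⁻ G A p ◅◅ Connected-sym G A (∈-component⁻ G A w∈))))

-- The configuration around the path x₁ y₁ y₂ x₂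

-- p i and q i are the darts from x i to its neighbours on N i, t i is the dart
-- from x i to y i, r i the dart from y i to w i, and s the dart from y₁ to y₂.
record Configuration {n m : ℕ} (G : Graph n m) : Set where
  field
    cubic         : Cubic G
    C N₁ N₂ W     : Subset m
    factor        : TwoFactor G C
    circuit₁      : Circuit G N₁
    circuit₂      : Circuit G N₂
    circuit-W     : Circuit G W
    N₁⊆C          : N₁ ⊆ C
    N₂⊆C          : N₂ ⊆ C
    W⊆C           : W ⊆ C
    odd₁          : OddSize N₁
    odd₂          : OddSize N₂
    even-W        : EvenSize W
    N₁≢N₂         : N₁ ≢ N₂
    odd-circuits  : ∀ D → Circuit G D → D ⊆ C → OddSize D → D ≡ N₁ ⊎ D ≡ N₂
    p₁ q₁ t₁ r₁ p₂ q₂ t₂ r₂ s : Dart m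
    p₁∈ : edge p₁ ∈ N₁
    q₁∈ : edge q₁ ∈ N₁
    p₂∈ : edge p₂ ∈ N₂
    q₂∈ : edge q₂ ∈ N₂
    r₁∈ : edge r₁ ∈ W
    r₂∈ : edge r₂ ∈ W
    t₁∈ : edge t₁ ∈ E G
    t₂∈ : edge t₂ ∈ E G
    s∈  : edge s ∈ E G
    tail-p₁ : tail G p₁ ≡ tail G t₁
    tail-q₁ : tail G q₁ ≡ tail G t₁
    tail-p₂ : tail G p₂ ≡ tail G t₂
    tail-q₂ : tail G q₂ ≡ tail G t₂
    tail-r₁ : tail G r₁ ≡ head G t₁
    tail-r₂ : tail G r₂ ≡ head G t₂
    tail-s  : tail G s ≡ head G t₁
    head-s  : head G s ≡ head G t₂
    p₁≢q₁   : head G p₁ ≢ head G q₁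
    p₂≢q₂   : head G p₂ ≢ head G q₂
    r₁≢y₂   : head G r₁ ≢ head G t₂
    r₂≢y₁   : head G r₂ ≢ head G t₁

  x₁ y₁ x₂ y₂ : Fin n
  x₁ = tail G t₁
  y₁ = head G t₁
  x₂ = tail G t₂
  y₂ = head G t₂

  OffPath : Fin n → Set
  OffPath v = v ≢ x₁ × v ≢ y₁ × v ≢ x₂ × v ≢ y₂

-- Exchanges the indices 1 and 2 and reverses `s`; each fact proved for index 1 then holds for index
-- 2 as well.
reflect : {G : Graph n m} → Configuration G → Configuration G
reflect {G = G} c = record
  { cubic = cubic ; C = C ; N₁ = N₂ ; N₂ = N₁ ; W = W ; factor = factor
  ; circuit₁ = circuit₂ ; circuit₂ = circuit₁ ; circuit-W = circuit-W
  ; N₁⊆C = N₂⊆C ; N₂⊆C = N₁⊆C ; W⊆C = W⊆C ; odd₁ = odd₂ ; odd₂ = odd₁ ; even-W = even-W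
  ; N₁≢N₂ = N₁≢N₂ ∘ sym ; odd-circuits = λ D c D⊆ o → Sum.swap (odd-circuits D c D⊆ o)
  ; p₁ = p₂ ; q₁ = q₂ ; t₁ = t₂ ; r₁ = r₂ ; p₂ = p₁ ; q₂ = q₁ ; t₂ = t₁ ; r₂ = r₁ ; s = rev s
  ; p₁∈ = p₂∈ ; q₁∈ = q₂∈ ; p₂∈ = p₁∈ ; q₂∈ = q₁∈ ; r₁∈ = r₂∈ ; r₂∈ = r₁∈
  ; t₁∈ = t₂∈ ; t₂∈ = t₁∈ ; s∈ = s∈
  ; tail-p₁ = tail-p₂ ; tail-q₁ = tail-q₂ ; tail-p₂ = tail-p₁ ; tail-q₂ = tail-q₁
  ; tail-r₁ = tail-r₂ ; tail-r₂ = tail-r₁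
  ; tail-s = head-s ; head-s = trans (head-rev G s) tail-s
  ; p₁≢q₁ = p₂≢q₂ ; p₂≢q₂ = p₁≢q₁ ; r₁≢y₂ = r₂≢y₁ ; r₂≢y₁ = r₁≢y₂
  }
  where open Configuration c

module Facts {G : Graph n m} (c : Configuration G) where
  open Configuration c

  C⊆E : C ⊆ E G
  C⊆E = proj₁ factor

  at-V : ∀ {v d} → At G (E G) v d → v ∈ V G
  at-V {d = d} (e∈ , refl) = tail∈V G d e∈

  C-degree : ∀ {v d} → At G C v d → degree G C v ≡ 2
  C-degree {d = d} (e∈ , t) = proj₂ factor _ (at-V {d = d} (C⊆E e∈ , t))

  degree-split : ∀ v → degree G (E G) v ≡ degree G C v + degree G (E G ─ C) v
  degree-split v = trans (degree-∑ G (E G) v) (trans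
    (ℕ∑.∑-split (At? G (E G) v) (λ d → edge d ∈? C) (λ _ → 1)) (sym (cong₂ _+_
      (trans (degree-∑ G C v) (ℕ∑.∑-cong (At? G C v) (λ d → At? G (E G) v d ×-dec (edge d ∈? C))
        (λ _ (e∈ , t) → (C⊆E e∈ , t) , e∈) (λ _ ((_ , t) , e∈) → e∈ , t) (λ _ _ → refl)))
      (trans (degree-∑ G (E G ─ C) v) (ℕ∑.∑-cong (At? G (E G ─ C) v)
        (λ d → At? G (E G) v d ×-dec ¬? (edge d ∈? C))
        (λ _ (e∈ , t) → (p─q⊆p (E G) C e∈ , t) , ─-∉ (E G) C e∈)
        (λ _ ((e∈ , t) , e∉) → x∈p∧x∉q⇒x∈p─q e∈ e∉ , t) (λ _ _ → refl))))))

  F-degree : ∀ {v} → v ∈ V G → degree G (E G ─ C) v ≡ 1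
  F-degree {v} v∈ = ℕ.+-cancelˡ-≡ 2 _ _ (trans
    (cong (_+ degree G (E G ─ C) v) (sym (proj₂ factor v v∈))) (trans (sym (degree-split v)) (cubic v v∈)))

  C-two : ∀ {v a b d} → a ≢ b → At G C v a → At G C v b → At G C v d → d ≡ a ⊎ d ≡ b
  C-two {v} {a} {b} {d} a≢b a-at b-at d-at = length≤2 (dartsAt G C v)
    (ℕ.≤-reflexive (C-degree {d = a} a-at)) a≢b
    (∈-dartsAt G C v {a} a-at) (∈-dartsAt G C v {b} b-at) (∈-dartsAt G C v {d} d-at)

  F-one : ∀ {v d d′} → At G (E G) v d → edge d ∉ C → At G (E G) v d′ → edge d′ ∉ C → d ≡ d′
  F-one {v} {d} {d′} (e∈ , t) e∉ (e∈′ , t′) e∉′ = length≤1 (dartsAt G (E G ─ C) v)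
    (ℕ.≤-reflexive (F-degree (at-V {d = d} (e∈ , t))))
    (∈-dartsAt G (E G ─ C) v (x∈p∧x∉q⇒x∈p─q e∈ e∉ , t))
    (∈-dartsAt G (E G ─ C) v (x∈p∧x∉q⇒x∈p─q e∈′ e∉′ , t′))

  -- A loop `a` would use up both darts of `C` at `v`, so `b` would be `a` or its reverse and have
  -- the same head.
  no-loop : ∀ {v a b} → head G a ≢ head G b → At G C v a → At G C v b → head G a ≢ v
  no-loop {v} {a} {b} a≢b a-at b-at h≡ with C-two {a = a} {rev a} {b} (rev≢ a ∘ sym) a-at (proj₁ a-at , h≡) b-at
  ... | inj₁ refl = a≢b refl
  ... | inj₂ refl = a≢b (trans h≡ (trans (sym (proj₂ a-at)) (sym (head-rev G a))))

  vertex : ∀ {D v} d → edge d ∈ D → tail G d ≡ v → VertexOf G D v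
  vertex (e , b) e∈ t = e , e∈ , b , t

  -- `D` and `C` both have degree 2 at `v`, so `D` takes every edge of `C` there. Consequently
  -- circuits of `C` that share a vertex coincide.
  circuit-closed : ∀ {D v} → Circuit G D → D ⊆ C → VertexOf G D v → ∀ d → At G C v d → edge d ∈ D
  circuit-closed {D} {v} circ D⊆C v∈ d d-at = proj₁ (∑1-antimono (At? G D v) (At? G C v) _≟ᵈ_
    (λ _ (e∈ , t) → D⊆C e∈ , t)
    (ℕ.≤-reflexive (trans (sym (degree-∑ G C v)) (trans (C-degree {d = d} d-at)
      (trans (sym (proj₁ (proj₂ (proj₂ circ)) v v∈)) (degree-∑ G D v)))))
    {i = d} d-at)

  circuits-nested : ∀ {D D′ v} → Circuit G D → D ⊆ C → Circuit G D′ → D′ ⊆ C →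
                    VertexOf G D v → VertexOf G D′ v → D′ ⊆ D
  circuits-nested {D} {D′} {v} circ D⊆C circ′ D′⊆C v∈ v∈′ {e} e∈ =
    circuit-closed circ D⊆C
      (walk v∈ (proj₂ (proj₂ (proj₂ circ′)) v _ v∈′ (vertex (e , false) e∈ refl)))
      (e , false) (D′⊆C e∈ , refl)
    where
    walk : ∀ {u w} → VertexOf G D u → Connected G D′ u w → VertexOf G D w
    walk u∈ ε = u∈
    walk u∈ ((f , f∈ , b , refl , refl) ◅ rs) = walk
      (vertex (rev (f , b)) (circuit-closed circ D⊆C u∈ (f , b) (D′⊆C f∈ , refl)) refl) rs

  circuits-equal : ∀ {D D′ v} → Circuit G D → D ⊆ C → Circuit G D′ → D′ ⊆ C →
                   VertexOf G D v → VertexOf G D′ v → D ≡ D′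
  circuits-equal circ D⊆C circ′ D′⊆C v∈ v∈′ = ⊆-antisym
    (circuits-nested circ′ D′⊆C circ D⊆C v∈′ v∈) (circuits-nested circ D⊆C circ′ D′⊆C v∈ v∈′)

  N₁#N₂ : ∀ {v} → VertexOf G N₁ v → ¬ VertexOf G N₂ v
  N₁#N₂ v∈ v∈′ = N₁≢N₂ (circuits-equal circuit₁ N₁⊆C circuit₂ N₂⊆C v∈ v∈′)

  odd≢even : ∀ {D} → OddSize D → D ≢ W
  odd≢even o refl = case trans (sym o) even-W of λ ()

  N₁#W : ∀ {v} → VertexOf G N₁ v → ¬ VertexOf G W v
  N₁#W v∈ v∈′ = odd≢even odd₁ (circuits-equal circuit₁ N₁⊆C circuit-W W⊆C v∈ v∈′)

  N₂#W : ∀ {v} → VertexOf G N₂ v → ¬ VertexOf G W v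
  N₂#W v∈ v∈′ = odd≢even odd₂ (circuits-equal circuit₂ N₂⊆C circuit-W W⊆C v∈ v∈′)

  x₁∈N₁ : VertexOf G N₁ x₁
  x₁∈N₁ = vertex p₁ p₁∈ tail-p₁

  x₂∈N₂ : VertexOf G N₂ x₂
  x₂∈N₂ = vertex p₂ p₂∈ tail-p₂

  y₁∈W : VertexOf G W y₁
  y₁∈W = vertex r₁ r₁∈ tail-r₁

  y₂∈W : VertexOf G W y₂
  y₂∈W = vertex r₂ r₂∈ tail-r₂

  distinct-by : ∀ {D D′ u v} → (∀ {v} → VertexOf G D v → ¬ VertexOf G D′ v) →
                VertexOf G D u → VertexOf G D′ v → u ≢ v
  distinct-by D#D′ u∈ v∈ refl = D#D′ u∈ v∈

  x₁≢x₂ : x₁ ≢ x₂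
  x₁≢x₂ = distinct-by N₁#N₂ x₁∈N₁ x₂∈N₂

  x₁≢y₁ : x₁ ≢ y₁
  x₁≢y₁ = distinct-by N₁#W x₁∈N₁ y₁∈W

  x₁≢y₂ : x₁ ≢ y₂
  x₁≢y₂ = distinct-by N₁#W x₁∈N₁ y₂∈W

  x₂≢y₁ : x₂ ≢ y₁
  x₂≢y₁ = distinct-by N₂#W x₂∈N₂ y₁∈W

  x₂≢y₂ : x₂ ≢ y₂
  x₂≢y₂ = distinct-by N₂#W x₂∈N₂ y₂∈W

  p₁-at : At G C x₁ p₁
  p₁-at = N₁⊆C p₁∈ , tail-p₁

  q₁-at : At G C x₁ q₁
  q₁-at = N₁⊆C q₁∈ , tail-q₁

  r₁-at : At G C y₁ r₁
  r₁-at = W⊆C r₁∈ , tail-r₁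

  -- Otherwise `t₁` would belong to `N₁`, which would then contain the vertex `y₁` of `W`.
  t₁∉C : edge t₁ ∉ C
  t₁∉C t∈ = N₁#W (vertex (rev t₁) (circuit-closed circuit₁ N₁⊆C x₁∈N₁ t₁ (t∈ , refl)) refl) y₁∈W

  t₁′-at : At G (E G) y₁ (rev t₁)
  t₁′-at = t₁∈ , refl

  -- `t₁` is the only edge at `y₁` outside `C`; if `s` were another name for it, then `y₂` would be
  -- `x₁`.
  s∈C : edge s ∈ C
  s∈C = decidable-stable (edge s ∈? C) λ s∉ →
    x₁≢y₂ (trans (sym (head-rev G t₁)) (trans
      (cong (head G) (F-one {d = rev t₁} {s} t₁′-at t₁∉C (s∈ , tail-s) s∉)) head-s))

  s-at : At G C y₁ s
  s-at = s∈C , tail-s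

  s∈W : edge s ∈ W
  s∈W = circuit-closed circuit-W W⊆C y₁∈W s s-at

  r₁≢s : head G r₁ ≢ head G s
  r₁≢s eq = r₁≢y₂ (trans eq head-s)

  y₁≢y₂ : y₁ ≢ y₂
  y₁≢y₂ eq = no-loop {a = s} {r₁} (r₁≢s ∘ sym) s-at r₁-at (trans head-s (sym eq))

  only-x₁ : ∀ d → At G (E G) x₁ d → d ≡ t₁ ⊎ d ≡ p₁ ⊎ d ≡ q₁
  only-x₁ d at with edge d ∈? C
  ... | yes d∈ = inj₂ (C-two (λ eq → p₁≢q₁ (cong (head G) eq)) p₁-at q₁-at (d∈ , proj₂ at))
  ... | no d∉  = inj₁ (F-one {d = d} {t₁} at d∉ (t₁∈ , refl) t₁∉C)

  only-y₁ : ∀ d → At G (E G) y₁ d → d ≡ rev t₁ ⊎ d ≡ r₁ ⊎ d ≡ s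
  only-y₁ d at with edge d ∈? C
  ... | yes d∈ = inj₂ (C-two (λ eq → r₁≢s (cong (head G) eq)) r₁-at s-at (d∈ , proj₂ at))
  ... | no d∉  = inj₁ (F-one {d = d} {rev t₁} at d∉ t₁′-at t₁∉C)

  off-N₁ : ∀ {v} → VertexOf G N₁ v → v ≢ x₁ → OffPath v
  off-N₁ v∈ v≢ = v≢ , distinct-by N₁#W v∈ y₁∈W , distinct-by N₁#N₂ v∈ x₂∈N₂ , distinct-by N₁#W v∈ y₂∈W

  p₁-off : OffPath (head G p₁)
  p₁-off = off-N₁ (vertex (rev p₁) p₁∈ refl) (no-loop {a = p₁} {q₁} p₁≢q₁ p₁-at q₁-at)

  q₁-off : OffPath (head G q₁)
  q₁-off = off-N₁ (vertex (rev q₁) q₁∈ refl) (no-loop {a = q₁} {p₁} (p₁≢q₁ ∘ sym) q₁-at p₁-at)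

  r₁-off : OffPath (head G r₁)
  r₁-off = distinct-by (flip N₁#W) w∈ x₁∈N₁ , no-loop {a = r₁} {s} r₁≢s r₁-at s-at
         , distinct-by (flip N₂#W) w∈ x₂∈N₂ , r₁≢y₂
    where
    w∈ : VertexOf G W (head G r₁)
    w∈ = vertex (rev r₁) r₁∈ refl

-- The maximum matching is perfect off the path

circuit-two-regular : (G : Graph n m) {D : Subset m} → Circuit G D → TwoRegular G D
circuit-two-regular G {D} (_ , _ , two , _) v with degree G D v in eq
... | zero  = inj₁ refl
... | suc k = inj₂ (trans (sym eq) (two v
  (let ((e , b) , e∈ , t) = ∑1-nonempty (At? G D v)
         (subst (1 ≤_) (trans (sym eq) (degree-∑ G D v)) (s≤s z≤n))
   in e , e∈ , b , t)))

two-regular-∂ : (G : Graph n m) {D : Subset m} → TwoRegular G D → ∀ v → ∂ G D v ≡ false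
two-regular-∂ G {D} reg v with ∂-degree G D v | reg v
... | eq | inj₁ nil = trans (sym eq) (cong odd nil)
... | eq | inj₂ two = trans (sym eq) (cong odd two)

xor-cancelʳ : ∀ a b c → (a xor b) xor (c xor b) ≡ a xor c
xor-cancelʳ a b c = trans (cong ((a xor b) xor_) (Bool.xor-comm c b)) (xor-cancel a b c)

module PerfectMatching {G : Graph n m} (c : Configuration G) where
  open Configuration c
  open Facts c
  private module Reflected = Facts (reflect c)

  -- The vertices off the path. The four path vertices are distinct vertices of `G`, so `⊕` amounts
  -- to removal, and parities of `U` split into parities of the five summands.
  U : Subset n
  U = V G ⊕ ((⁅ x₁ ⁆ ⊕ ⁅ y₁ ⁆) ⊕ (⁅ x₂ ⁆ ⊕ ⁅ y₂ ⁆))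

  lookup-U : ∀ v → Vec.lookup U v ≡ Vec.lookup (V G) v xor
             ((does (x₁ ≟ v) xor does (y₁ ≟ v)) xor (does (x₂ ≟ v) xor does (y₂ ≟ v)))
  lookup-U v = trans (lookup-⊕ (V G) _ v) (cong (Vec.lookup (V G) v xor_)
    (trans (lookup-⊕ (⁅ x₁ ⁆ ⊕ ⁅ y₁ ⁆) _ v) (cong₂ _xor_
      (trans (lookup-⊕ ⁅ x₁ ⁆ ⁅ y₁ ⁆ v) (cong₂ _xor_ (lookup-⁅⁆ x₁ v) (lookup-⁅⁆ y₁ v)))
      (trans (lookup-⊕ ⁅ x₂ ⁆ ⁅ y₂ ⁆ v) (cong₂ _xor_ (lookup-⁅⁆ x₂ v) (lookup-⁅⁆ y₂ v))))))

  x₁∈V : x₁ ∈ V G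
  x₁∈V = tail∈V G t₁ t₁∈
  y₁∈V : y₁ ∈ V G
  y₁∈V = tail∈V G (rev t₁) t₁∈
  x₂∈V : x₂ ∈ V G
  x₂∈V = tail∈V G t₂ t₂∈
  y₂∈V : y₂ ∈ V G
  y₂∈V = tail∈V G (rev t₂) t₂∈

  U-off : ∀ {v} → v ∈ V G → OffPath v → Vec.lookup U v ≡ true
  U-off {v} v∈ (≢x₁ , ≢y₁ , ≢x₂ , ≢y₂) = trans (lookup-U v) (cong₂ _xor_ (Vec.[]=⇒lookup v∈)
    (cong₂ _xor_ (cong₂ _xor_ (dec-false (x₁ ≟ v) (≢x₁ ∘ sym)) (dec-false (y₁ ≟ v) (≢y₁ ∘ sym)))
                 (cong₂ _xor_ (dec-false (x₂ ≟ v) (≢x₂ ∘ sym)) (dec-false (y₂ ≟ v) (≢y₂ ∘ sym)))))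

  U-out : ∀ {v} → v ∉ V G → Vec.lookup U v ≡ false
  U-out {v} v∉ = trans (lookup-U v) (cong₂ _xor_ (lookup-∉ v∉)
    (cong₂ _xor_ (cong₂ _xor_ (other x₁∈V) (other y₁∈V)) (cong₂ _xor_ (other x₂∈V) (other y₂∈V))))
    where
    other : ∀ {x} → x ∈ V G → does (x ≟ v) ≡ false
    other {x} x∈ = dec-false (x ≟ v) λ { refl → v∉ x∈ }

  on-path : ∀ {v a b c d} → v ∈ V G → does (x₁ ≟ v) ≡ a → does (y₁ ≟ v) ≡ b → does (x₂ ≟ v) ≡ c →
            does (y₂ ≟ v) ≡ d → Vec.lookup U v ≡ true xor ((a xor b) xor (c xor d))
  on-path {v} v∈ refl refl refl refl = trans (lookup-U v)
    (cong (_xor ((does (x₁ ≟ v) xor does (y₁ ≟ v)) xor (does (x₂ ≟ v) xor does (y₂ ≟ v)))) (Vec.[]=⇒lookup v∈))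

  U-x₁ : Vec.lookup U x₁ ≡ false
  U-x₁ = on-path x₁∈V (dec-true (x₁ ≟ x₁) refl) (dec-false (y₁ ≟ x₁) (x₁≢y₁ ∘ sym))
    (dec-false (x₂ ≟ x₁) (x₁≢x₂ ∘ sym)) (dec-false (y₂ ≟ x₁) (x₁≢y₂ ∘ sym))
  U-y₁ : Vec.lookup U y₁ ≡ false
  U-y₁ = on-path y₁∈V (dec-false (x₁ ≟ y₁) x₁≢y₁) (dec-true (y₁ ≟ y₁) refl)
    (dec-false (x₂ ≟ y₁) x₂≢y₁) (dec-false (y₂ ≟ y₁) (y₁≢y₂ ∘ sym))
  U-x₂ : Vec.lookup U x₂ ≡ false
  U-x₂ = on-path x₂∈V (dec-false (x₁ ≟ x₂) x₁≢x₂) (dec-false (y₁ ≟ x₂) (x₂≢y₁ ∘ sym))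
    (dec-true (x₂ ≟ x₂) refl) (dec-false (y₂ ≟ x₂) (x₂≢y₂ ∘ sym))
  U-y₂ : Vec.lookup U y₂ ≡ false
  U-y₂ = on-path y₂∈V (dec-false (x₁ ≟ y₂) x₁≢y₂) (dec-false (y₁ ≟ y₂) y₁≢y₂)
    (dec-false (x₂ ≟ y₂) x₂≢y₂) (dec-true (y₂ ≟ y₂) refl)

  C-TwoRegular : TwoRegular G C
  C-TwoRegular v with v ∈? V G
  ... | yes v∈ = inj₂ (proj₂ factor v v∈)
  ... | no v∉  = inj₁ (degree-outside G (V G) C (λ e∈ → wf G (C⊆E e∈)) v∉)

  stays-in-V : ∀ {u w} → Connected G C u w → u ∈ V G → w ∈ V G
  stays-in-V ε u∈ = u∈
  stays-in-V ((e , e∈ , b , _ , refl) ◅ rs) _ = stays-in-V rs (tail∈V G (e , not b) (C⊆E e∈))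

  module _ (d : Dart m) (d∈ : edge d ∈ C) where
    private
      v  = tail G d
      K  = component G C v
      K? = _∈? K
      D  = component-edges G C v

      D-circuit : Circuit G D
      D-circuit = component-circuit G C C⊆E C-TwoRegular d d∈

      D⊆C : D ⊆ C
      D⊆C = component-edges⊆ G C

      K⊆V : K ⊆ V G
      K⊆V w∈ = stays-in-V (∈-component⁻ G C w∈) (tail∈V G d (C⊆E d∈))

    ∣K∣≡∣D∣ : ∣ K ∣ ≡ ∣ D ∣
    ∣K∣≡∣D∣ = ℕ.*-cancelˡ-≡ ∣ K ∣ ∣ D ∣ 2 (trans (double ∣ K ∣) (trans (begin
      ∣ K ∣ + ∣ K ∣                       ≡⟨ cong₂ _+_ (∣∣-∑1 K) (∣∣-∑1 K) ⟩
      ∑1 K? + ∑1 K?                       ≡⟨ sym (ℕ∑.∑-∙ K? (λ _ → 1) (λ _ → 1)) ⟩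
      ℕ∑.∑ K? (λ _ → 2)                   ≡⟨ sym (ℕ∑.∑-cong′ K? (λ w w∈ →
                                               trans (degree-component G C w∈) (proj₂ factor w (K⊆V w∈)))) ⟩
      ℕ∑.∑ K? (degree G D)                ≡⟨ handshake G K D (p∩q⊆q C _) ⟩
      ∣ D ∣ + ∣ D ∣                       ∎) (sym (double ∣ D ∣))))
      where
      open ≡-Reasoning
      double : ∀ k → 2 * k ≡ k + k
      double k = cong (k +_) (ℕ.+-identityʳ k)

    same-y : does (K? y₁) ≡ does (K? y₂)
    same-y with K? y₁
    ... | yes p = sym (dec-true (K? y₂) (subst (_∈ K) head-s
                    (component-closed G C v s s∈C (subst (_∈ K) (sym tail-s) p))))
    ... | no ¬p = sym (dec-false (K? y₂) λ p → ¬p (subst (_∈ K) (trans (head-rev G s) tail-s)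
                    (component-closed G C v (rev s) s∈C (subst (_∈ K) (sym head-s) p))))

    in-N₁ : x₁ ∈ K → D ≡ N₁
    in-N₁ x∈ = circuits-equal D-circuit D⊆C circuit₁ N₁⊆C
      (vertex p₁ (∈-component-edges G C p₁ (N₁⊆C p₁∈) (subst (_∈ K) (sym tail-p₁) x∈)) tail-p₁) x₁∈N₁

    in-N₂ : x₂ ∈ K → D ≡ N₂
    in-N₂ x∈ = circuits-equal D-circuit D⊆C circuit₂ N₂⊆C
      (vertex p₂ (∈-component-edges G C p₂ (N₂⊆C p₂∈) (subst (_∈ K) (sym tail-p₂) x∈)) tail-p₂) x₂∈N₂

    x∈K : ∀ {D′ x} → (∃[ a ] edge a ∈ D′ × tail G a ≡ x) → D ≡ D′ → x ∈ K
    x∈K ((e , b) , e∈ , refl) refl = ∈-inducedBy⁻ G K (p∩q⊆q C _ e∈) b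

    -- Exactly the odd circuits of `C` lose a vertex of the path among x₁, x₂: containing `x₁` or
    -- `x₂` makes the circuit `N₁` or `N₂`, never both, and an odd circuit is one of these. The pair
    -- y₁, y₂ does not matter for parity, since `s` keeps both in the same circuit.
    parity-D : (a? : Dec (x₁ ∈ K)) (b? : Dec (x₂ ∈ K)) → odd ∣ D ∣ xor (does a? xor does b?) ≡ false
    parity-D (yes p) (yes q) = contradiction (trans (sym (in-N₁ p)) (in-N₂ q)) N₁≢N₂
    parity-D (yes p) (no  _) = cong (_xor true) (trans (cong (odd ∘ ∣_∣) (in-N₁ p)) (%2≡1⇒odd ∣ N₁ ∣ odd₁))
    parity-D (no  _) (yes q) = cong (_xor true) (trans (cong (odd ∘ ∣_∣) (in-N₂ q)) (%2≡1⇒odd ∣ N₂ ∣ odd₂))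
    parity-D (no ¬p) (no ¬q) with odd ∣ D ∣ in eq
    ... | false = refl
    ... | true  = [ (λ D≡ → contradiction (x∈K (p₁ , p₁∈ , tail-p₁) D≡) ¬p)
                  , (λ D≡ → contradiction (x∈K (p₂ , p₂∈ , tail-p₂) D≡) ¬q) ]′
                  (odd-circuits D D-circuit D⊆C (proj₁ (odd-% ∣ D ∣) eq))

    even-component : X∑.∑ K? (Vec.lookup U) ≡ false
    even-component = begin
      X∑.∑ K? (Vec.lookup U)
        ≡⟨ X∑.∑-cong′ K? (λ w _ → lookup-U w) ⟩
      X∑.∑ K? (λ w → Vec.lookup (V G) w xor
        ((does (x₁ ≟ w) xor does (y₁ ≟ w)) xor (does (x₂ ≟ w) xor does (y₂ ≟ w))))
        ≡⟨ trans (X∑.∑-∙ K? _ _) (cong₂ _xor_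
             (X∑.∑-cong′ K? (λ w w∈ → Vec.[]=⇒lookup (K⊆V w∈)))
             (trans (X∑.∑-∙ K? _ _) (cong₂ _xor_
               (trans (X∑.∑-∙ K? _ _) (cong₂ _xor_ (X∑-point K? _≟_ x₁) (X∑-point K? _≟_ y₁)))
               (trans (X∑.∑-∙ K? _ _) (cong₂ _xor_ (X∑-point K? _≟_ x₂) (X∑-point K? _≟_ y₂)))))) ⟩
      X∑.∑ K? (λ _ → true) xor ((does (K? x₁) xor does (K? y₁)) xor (does (K? x₂) xor does (K? y₂)))
        ≡⟨ cong₂ _xor_
             (trans (sym (odd-∑ K? (λ _ → 1))) (cong odd (trans (sym (∣∣-∑1 K)) ∣K∣≡∣D∣)))
             (trans (cong (λ b → (does (K? x₁) xor b) xor (does (K? x₂) xor does (K? y₂))) same-y)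
                    (xor-cancelʳ (does (K? x₁)) (does (K? y₂)) (does (K? x₂)))) ⟩
      odd ∣ D ∣ xor (does (K? x₁) xor does (K? x₂))
        ≡⟨ parity-D (K? x₁) (K? x₂) ⟩
      false ∎
      where open ≡-Reasoning

  even-components : ∀ v → X∑.∑ (_∈? component G C v) (Vec.lookup U) ≡ false
  even-components v with v ∈? V G
  ... | no v∉ = X∑.∑-𝟘 (_∈? component G C v) _ λ w w∈ → U-out λ w∈V →
          v∉ (stays-in-V (Connected-sym G C (∈-component⁻ G C w∈)) w∈V)
  ... | yes v∈ with ∑1-nonempty (At? G C v)
          (subst (1 ≤_) (trans (sym (proj₂ factor v v∈)) (degree-∑ G C v)) (s≤s z≤n))
  ...   | d , d∈ , refl = even-component d d∈

  -- Adding a circuit D of C does not change the degree parities.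
  avoid : ∀ {D} → Circuit G D → D ⊆ C → ∀ {e} → e ∈ D → (J : Subset m) → J ⊆ C →
          ∃[ J′ ] J′ ⊆ C × (∀ v → ∂ G J′ v ≡ ∂ G J v) × e ∉ J′ × (∀ {f} → f ∉ D → f ∈ J′ → f ∈ J)
  avoid {D} circ D⊆C {e} e∈D J J⊆C with e ∈? J
  ... | no e∉  = J , J⊆C , (λ _ → refl) , e∉ , λ _ f∈ → f∈
  ... | yes e∈ =
    J ⊕ D ,
    (λ f∈ → [ J⊆C , D⊆C ]′ (∈-⊕ J D f∈)) ,
    (λ v → trans (∂-⊕ G J D v) (trans
      (cong (∂ G J v xor_) (two-regular-∂ G (circuit-two-regular G circ) v)) (Bool.xor-identityʳ _))) ,
    (λ e∈′ → contradiction (trans (sym (Vec.[]=⇒lookup e∈′)) (trans (lookup-⊕ J D e)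
      (cong₂ _xor_ (Vec.[]=⇒lookup e∈) (Vec.[]=⇒lookup e∈D)))) λ ()) ,
    λ f∉ f∈ → [ id , (λ f∈D → contradiction f∈D f∉) ]′ (∈-⊕ J D f∈)

  abstract
    -- On each of `N₁`, `N₂`, `W` one edge at the path is cleared by adding that circuit if
    -- necessary. The circuits are disjoint, so clearing one edge does not restore another.
    joining : ∃[ J ] J ⊆ C × (∀ v → ∂ G J v ≡ Vec.lookup U v) ×
              edge p₁ ∉ J × edge p₂ ∉ J × edge s ∉ J
    joining =
      let (J₀ , J₀⊆ , ∂₀)                 = subgraph-with-odd-set G C U even-components
          (J₁ , J₁⊆ , ∂₁ , p₁∉ , keep₁)   = avoid circuit₁ N₁⊆C p₁∈ J₀ J₀⊆
          (J₂ , J₂⊆ , ∂₂ , p₂∉ , keep₂)   = avoid circuit₂ N₂⊆C p₂∈ J₁ J₁⊆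
          (J₃ , J₃⊆ , ∂₃ , s∉ , keep₃)    = avoid circuit-W W⊆C s∈W J₂ J₂⊆
      in J₃ , J₃⊆ , (λ v → trans (∂₃ v) (trans (∂₂ v) (trans (∂₁ v) (∂₀ v))))
       , (λ p₁∈J → p₁∉ (keep₂ (λ e∈ → N₁#N₂ x₁∈N₁ (vertex p₁ e∈ tail-p₁))
                     (keep₃ (λ e∈ → N₁#W x₁∈N₁ (vertex p₁ e∈ tail-p₁)) p₁∈J)))
       , (λ p₂∈J → p₂∉ (keep₃ (λ e∈ → N₂#W x₂∈N₂ (vertex p₂ e∈ tail-p₂)) p₂∈J))
       , s∉

  J : Subset m
  J = proj₁ joining

  J⊆C : J ⊆ C
  J⊆C = proj₁ (proj₂ joining)

  ∂-J : ∀ v → ∂ G J v ≡ Vec.lookup U v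
  ∂-J = proj₁ (proj₂ (proj₂ joining))

  -- If `b` were present while `a` is absent, `v` would have degree 1 in `J`, against its even
  -- parity.
  other-absent : ∀ {v a b} → a ≢ b → At G C v a → At G C v b → Vec.lookup U v ≡ false →
                 edge a ∉ J → edge b ∉ J
  other-absent {v} {a} {b} a≢b a-at b-at even a∉ b∈ = contradiction
    (trans (sym (cong odd one)) (trans (∂-degree G J v) (trans (∂-J v) even))) λ ()
    where
    one : degree G J v ≡ 1
    one = trans (degree-∑ G J v) (ℕ∑.∑-single (At? G J v) (λ _ → 1) {b} (b∈ , proj₂ b-at)
      (λ d (d∈ , t) → [ (λ { refl → contradiction d∈ a∉ }) , id ]′
        (C-two {a = a} {b} {d} a≢b a-at b-at (J⊆C d∈ , t))))

  none-at : ∀ {v a b} → a ≢ b → At G C v a → At G C v b → Vec.lookup U v ≡ false → edge a ∉ J →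
            ∀ d → edge d ∈ J → tail G d ≢ v
  none-at {v} {a} {b} a≢b a-at b-at even a∉ d d∈ t with C-two {a = a} {b} {d} a≢b a-at b-at (J⊆C d∈ , t)
  ... | inj₁ refl = a∉ d∈
  ... | inj₂ refl = other-absent {a = a} {b} a≢b a-at b-at even a∉ d∈

  J-off : ∀ d → edge d ∈ J → OffPath (tail G d)
  J-off d d∈ =
      none-at {a = p₁} {q₁} (λ eq → p₁≢q₁ (cong (head G) eq)) p₁-at q₁-at U-x₁ p₁∉ d d∈
    , none-at {a = s} {r₁} (λ eq → r₁≢s (cong (head G) (sym eq))) s-at r₁-at U-y₁ s∉ d d∈
    , none-at {a = p₂} {q₂} (λ eq → p₂≢q₂ (cong (head G) eq)) Reflected.p₁-at Reflected.q₁-at U-x₂ p₂∉ d d∈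
    , none-at {a = rev s} {r₂} (λ eq → Reflected.r₁≢s (cong (head G) (sym eq))) Reflected.s-at Reflected.r₁-at U-y₂ s∉ d d∈
    where
    p₁∉ = proj₁ (proj₂ (proj₂ (proj₂ joining)))
    p₂∉ = proj₁ (proj₂ (proj₂ (proj₂ (proj₂ joining))))
    s∉  = proj₂ (proj₂ (proj₂ (proj₂ (proj₂ joining))))

  odd≤2 : ∀ k → k ≤ 2 → odd k ≡ true → k ≡ 1
  odd≤2 1 _ _ = refl
  odd≤2 0 _ ()
  odd≤2 2 _ ()
  odd≤2 (suc (suc (suc k))) (s≤s (s≤s ())) _

  -- The degree is odd and, inside `C`, at most 2. This is how a parity condition produces a
  -- matching.
  J-degree : ∀ {v} → v ∈ V G → OffPath v → degree G J v ≡ 1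
  J-degree {v} v∈ off = odd≤2 _ (subst (degree G J v ≤_) (proj₂ factor v v∈) (degree-mono G J⊆C v))
    (trans (∂-degree G J v) (trans (∂-J v) (U-off v∈ off)))

  J-degree-0 : ∀ {v} → ¬ (v ∈ V G × OffPath v) → degree G J v ≡ 0
  J-degree-0 {v} h = trans (degree-∑ G J v) (ℕ∑.∑-𝟘 (At? G J v) _
    (λ { d (d∈ , refl) → contradiction (tail∈V G d (C⊆E (J⊆C d∈)) , J-off d d∈) h }))

  OffPath? : ∀ v → Dec (v ∈ V G × OffPath v)
  OffPath? v = (v ∈? V G) ×-dec ¬? (v ≟ x₁) ×-dec ¬? (v ≟ y₁) ×-dec ¬? (v ≟ x₂) ×-dec ¬? (v ≟ y₂)

  U⁺ : ∀ {v} → v ∈ V G × OffPath v → v ∈ U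
  U⁺ {v} (v∈ , off) = Vec.lookup⇒[]= v U (U-off v∈ off)

  U⁻ : ∀ {v} → v ∈ U → v ∈ V G × OffPath v
  U⁻ {v} v∈ = decidable-stable (OffPath? v) λ h → contradiction
    (trans (sym (Vec.[]=⇒lookup v∈)) (trans (sym (∂-J v)) (trans (sym (∂-degree G J v)) (cong odd (J-degree-0 h))))) λ ()

  path-vertices : Subset n
  path-vertices = ⁅ x₁ ⁆ ∪ ⁅ y₁ ⁆ ∪ ⁅ y₂ ⁆ ∪ ⁅ x₂ ⁆

  OffPath⇒∉ : ∀ {v} → OffPath v → v ∉ path-vertices
  OffPath⇒∉ (≢x₁ , ≢y₁ , ≢x₂ , ≢y₂) v∈ = case x∈p∪q⁻ _ _ v∈ of λ
    { (inj₁ p) → ≢x₁ (x∈⁅y⁆⇒x≡y x₁ p)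
    ; (inj₂ v∈) → case x∈p∪q⁻ _ _ v∈ of λ
      { (inj₁ p) → ≢y₁ (x∈⁅y⁆⇒x≡y y₁ p)
      ; (inj₂ v∈) → case x∈p∪q⁻ _ _ v∈ of λ
        { (inj₁ p) → ≢y₂ (x∈⁅y⁆⇒x≡y y₂ p)
        ; (inj₂ p) → ≢x₂ (x∈⁅y⁆⇒x≡y x₂ p) } } }

  ∉⇒OffPath : ∀ {v} → v ∉ path-vertices → OffPath v
  ∉⇒OffPath v∉ =
      (λ { refl → v∉ (x∈p∪q⁺ (inj₁ (x∈⁅x⁆ _))) })
    , (λ { refl → v∉ (x∈p∪q⁺ {p = ⁅ x₁ ⁆} (inj₂ (x∈p∪q⁺ (inj₁ (x∈⁅x⁆ _))))) })
    , (λ { refl → v∉ (x∈p∪q⁺ {p = ⁅ x₁ ⁆} (inj₂ (x∈p∪q⁺ {p = ⁅ y₁ ⁆} (inj₂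
             (x∈p∪q⁺ {p = ⁅ y₂ ⁆} (inj₂ (x∈⁅x⁆ _))))))) })
    , (λ { refl → v∉ (x∈p∪q⁺ {p = ⁅ x₁ ⁆} (inj₂ (x∈p∪q⁺ {p = ⁅ y₁ ⁆} (inj₂
             (x∈p∪q⁺ (inj₁ (x∈⁅x⁆ _))))))) })

  J-matching : Matching G (deleteVertices G C path-vertices) J
  J-matching =
    (λ {e} e∈ → x∈p∩q⁺ (J⊆C e∈ , ∈-inducedBy G _ λ b →
      x∉p⇒x∈∁p (OffPath⇒∉ (J-off (e , b) e∈)))) ,
    λ v → at-most v (OffPath? v)
    where
    at-most : ∀ v → Dec (v ∈ V G × OffPath v) → degree G J v ≤ 1
    at-most v (yes (v∈ , off)) = ℕ.≤-reflexive (J-degree v∈ off)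
    at-most v (no h)           = ℕ.≤-trans (ℕ.≤-reflexive (J-degree-0 h)) z≤n

  module _ {M : Subset m} (maximum : MaximumMatching G (deleteVertices G C path-vertices) M) where

    M⊆C : M ⊆ C
    M⊆C e∈ = p∩q⊆p C _ (proj₁ (proj₁ maximum) e∈)

    M-off : ∀ d → edge d ∈ M → OffPath (tail G d)
    M-off (e , b) e∈ = ∉⇒OffPath (x∈∁p⇒x∉p (∈-inducedBy⁻ G _ (p∩q⊆q C _ (proj₁ (proj₁ maximum) e∈)) b))

    ⊆-inducedBy-U : ∀ {D} → D ⊆ C → (∀ d → edge d ∈ D → OffPath (tail G d)) → D ⊆ inducedBy (ends G) U
    ⊆-inducedBy-U D⊆C off {e} e∈ = ∈-inducedBy G U λ b →
      U⁺ (tail∈V G (e , b) (C⊆E (D⊆C e∈)) , off (e , b) e∈)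

    -- `J` covers all of `U` exactly once and is no larger than `M`. So the degrees of `M` sum to at
    -- least `∣ U ∣`, while each is at most 1, and the total deficit is zero.
    M-degree : ∀ {v} → v ∈ V G → OffPath v → degree G M v ≡ 1
    M-degree {v} v∈ off = ℕ.≤-antisym (proj₂ (proj₁ maximum) v)
      (ℕ.m∸n≡0⇒m≤n (∑≡0 (_∈? U) _≟_ (λ v → 1 ℕ.∸ degree G M v) unmatched≡0 (U⁺ (v∈ , off))))
      where
      open ℕ.≤-Reasoning
      total : ℕ∑.∑ (_∈? U) (degree G M) + ℕ∑.∑ (_∈? U) (λ v → 1 ℕ.∸ degree G M v) ≡
              ℕ∑.∑ (_∈? U) (degree G J)
      total = trans (sym (ℕ∑.∑-∙ (_∈? U) _ _)) (ℕ∑.∑-cong′ (_∈? U) (λ v v∈ →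
        trans (ℕ.m+[n∸m]≡n (proj₂ (proj₁ maximum) v)) (sym (let (v∈V , off) = U⁻ v∈ in J-degree v∈V off))))
      J≤M : ℕ∑.∑ (_∈? U) (degree G J) ≤ ℕ∑.∑ (_∈? U) (degree G M)
      J≤M = begin
        ℕ∑.∑ (_∈? U) (degree G J) ≡⟨ handshake G U J (⊆-inducedBy-U J⊆C J-off) ⟩
        ∣ J ∣ + ∣ J ∣             ≤⟨ ℕ.+-mono-≤ (proj₂ maximum J J-matching) (proj₂ maximum J J-matching) ⟩
        ∣ M ∣ + ∣ M ∣             ≡⟨ sym (handshake G U M (⊆-inducedBy-U M⊆C M-off)) ⟩
        ℕ∑.∑ (_∈? U) (degree G M) ∎
      unmatched≡0 : ℕ∑.∑ (_∈? U) (λ v → 1 ℕ.∸ degree G M v) ≡ 0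
      unmatched≡0 = ℕ.n≤0⇒n≡0 (ℕ.+-cancelˡ-≤ (ℕ∑.∑ (_∈? U) (degree G M)) _ 0 (begin
        ℕ∑.∑ (_∈? U) (degree G M) + ℕ∑.∑ (_∈? U) (λ v → 1 ℕ.∸ degree G M v) ≡⟨ total ⟩
        ℕ∑.∑ (_∈? U) (degree G J) ≤⟨ J≤M ⟩
        ℕ∑.∑ (_∈? U) (degree G M) ≡⟨ sym (ℕ.+-identityʳ _) ⟩
        ℕ∑.∑ (_∈? U) (degree G M) + 0 ∎))

-- The two smoothings applied to the configuration

two-darts-∖ : (K : Graph n k) (e : Fin k) {v : Fin n} {a₁ a₂ : Dart k} → a₁ ≢ a₂ →
              At K (E K) v a₁ → edge a₁ ≢ e → At K (E K) v a₂ → edge a₂ ≢ e →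
              (∀ d → At K (E K) v d → edge d ≢ e → d ≡ a₁ ⊎ d ≡ a₂) →
              head K a₁ ≢ v → head K a₂ ≢ v → TwoDarts (K ∖ ⁅ e ⁆) v a₁ a₂
two-darts-∖ K e {a₁ = a₁} {a₂} a₁≢a₂ (e₁∈ , t₁) e₁≢ (e₂∈ , t₂) e₂≢ only h₁ h₂ = record
  { distinct = a₁≢a₂
  ; at₁      = x∈p∧x≢y⇒x∈p-y e₁∈ e₁≢ , trans (tail-∖ K ⁅ e ⁆ a₁) t₁
  ; at₂      = x∈p∧x≢y⇒x∈p-y e₂∈ e₂≢ , trans (tail-∖ K ⁅ e ⁆ a₂) t₂
  ; only     = λ d (e∈ , t) → let (e∈E , e≢) = ∈- (E K) e∈ in
                 only d (e∈E , trans (sym (tail-∖ K ⁅ e ⁆ d)) t) e≢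
  ; head₁    = λ h → h₁ (trans (sym (tail-∖ K ⁅ e ⁆ (rev a₁))) h)
  ; head₂    = λ h → h₂ (trans (sym (tail-∖ K ⁅ e ⁆ (rev a₂))) h)
  }

head-∖≢ : (K : Graph n k) (e : Fin k) {v : Fin n} (a : Dart k) → head K a ≢ v → head (K ∖ ⁅ e ⁆) a ≢ v
head-∖≢ K e a h eq = h (trans (sym (tail-∖ K ⁅ e ⁆ (rev a))) eq)

module Smoothings {G : Graph n m} (c : Configuration G) where
  open Configuration c
  open Facts c
  private module Reflected = Facts (reflect c)

  C≢t₁ : ∀ {e} → e ∈ C → e ≢ edge t₁
  C≢t₁ e∈ refl = t₁∉C e∈

  C≢t₂ : ∀ {e} → e ∈ C → e ≢ edge t₂
  C≢t₂ e∈ refl = Reflected.t₁∉C e∈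

  abstract
    first-tilde : ∀ e → e ≡ edge t₁ → Tilde G (edge t₁) (G ∼ e) x₁ y₁ p₁ q₁ r₁ s
    first-tilde _ refl = tilde G (edge t₁) (proj₂ t₁ , refl , refl)
      (two-darts-∖ G (edge t₁) (λ eq → p₁≢q₁ (cong (head G) eq))
        (C⊆E (proj₁ p₁-at) , tail-p₁) (C≢t₁ (proj₁ p₁-at)) (C⊆E (proj₁ q₁-at) , tail-q₁) (C≢t₁ (proj₁ q₁-at))
        (λ d at ≢t → [ (λ { refl → contradiction refl ≢t }) , id ]′ (only-x₁ d at))
        (proj₁ p₁-off) (proj₁ q₁-off))
      (two-darts-∖ G (edge t₁) (λ eq → r₁≢s (cong (head G) eq))
        (C⊆E (proj₁ r₁-at) , tail-r₁) (C≢t₁ (proj₁ r₁-at)) (s∈ , tail-s) (C≢t₁ s∈C)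
        (λ d at ≢t → [ (λ { refl → contradiction refl ≢t }) , id ]′ (only-y₁ d at))
        (proj₁ (proj₂ r₁-off)) (λ h → y₁≢y₂ (trans (sym h) head-s)))
      x₁≢y₁
      (head-∖≢ G (edge t₁) p₁ (proj₁ (proj₂ p₁-off))) (head-∖≢ G (edge t₁) q₁ (proj₁ (proj₂ q₁-off)))
      (head-∖≢ G (edge t₁) r₁ (proj₁ r₁-off)) (head-∖≢ G (edge t₁) s (λ h → x₁≢y₂ (trans (sym h) head-s)))

  module Reduced {G₁ : Graph n (2 + m)} (T₁ : Tilde G (edge t₁) G₁ x₁ y₁ p₁ q₁ r₁ s) where
    private module T₁ = Tilde T₁

    ss : Dart k → Dart (2 + k)
    ss d = suc-dart (suc-dart d)

    tail-new₁ : ∀ d → edge d ∈ E G₁ → tail G₁ d ≡ tail G (T₁.R d)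
    tail-new₁ d e∈ = trans (sym (T₁.R-tail d e∈)) (tail-∖ G ⁅ edge t₁ ⁆ (T₁.R d))

    tail-α₁ : tail G₁ T₁.α ≡ head G p₁
    tail-α₁ = trans (tail-new₁ T₁.α T₁.α∈) (cong (tail G) T₁.R-α)

    head-α₁ : head G₁ T₁.α ≡ head G q₁
    head-α₁ = trans (tail-new₁ (rev T₁.α) T₁.α∈) (cong (tail G) T₁.R-α′)

    tail-β₁ : tail G₁ T₁.β ≡ head G r₁
    tail-β₁ = trans (tail-new₁ T₁.β T₁.β∈) (cong (tail G) T₁.R-β)

    -- The new edge at `y₁` replaces the path w₁y₁y₂ and still ends at `y₂`; the second smoothing
    -- therefore meets `rev T₁.β` at `y₂` and extends the replaced path to w₂.
    head-β₁ : head G₁ T₁.β ≡ y₂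
    head-β₁ = trans (tail-new₁ (rev T₁.β) T₁.β∈) (trans (cong (tail G) T₁.R-β′) head-s)

    data View₁ : Dart (2 + m) → Set where
      old : ∀ d → edge d ∈ E G → edge d ≢ edge t₁ → (∀ b → tail G (edge d , b) ≢ x₁) →
            (∀ b → tail G (edge d , b) ≢ y₁) → View₁ (ss d)
      α₁  : View₁ T₁.α
      α₁′ : View₁ (rev T₁.α)
      β₁  : View₁ T₁.β
      β₁′ : View₁ (rev T₁.β)

    view₁ : ∀ d → edge d ∈ E G₁ → View₁ d
    view₁ d e∈ with T₁.view d
    ... | inj₁ (d₀ , refl) = let (p , q , r , s) = T₁.old∈ e∈ in old d₀ p q r s
    ... | inj₂ (inj₁ eq) = [ (λ eq′ → subst View₁ (sym eq′) α₁) , (λ eq′ → subst View₁ (sym eq′) α₁′) ]′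
                             (same-edge T₁.α d (sym eq))
    ... | inj₂ (inj₂ eq) = [ (λ eq′ → subst View₁ (sym eq′) β₁) , (λ eq′ → subst View₁ (sym eq′) β₁′) ]′
                             (same-edge T₁.β d (sym eq))

    e₂ : Fin (2 + m)
    e₂ = suc (suc (edge t₂))

    old-at : ∀ {v} d → edge d ∈ C → tail G d ≡ v → (∀ b → tail G (edge d , b) ≢ x₁) →
             (∀ b → tail G (edge d , b) ≢ y₁) → At G₁ (E G₁) v (ss d)
    old-at d d∈ t ≢x₁ ≢y₁ = T₁.old∈⁺ (C⊆E d∈) (C≢t₁ d∈) ≢x₁ ≢y₁ , trans (T₁.tail-old d) t

    ends-avoid : ∀ {v} d → tail G d ≢ v → head G d ≢ v → ∀ b → tail G (edge d , b) ≢ v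
    ends-avoid d t≢ h≢ b eq with same-edge d (edge d , b) refl
    ... | inj₁ d≡ = t≢ (trans (sym (cong (tail G) d≡)) eq)
    ... | inj₂ d≡ = h≢ (trans (sym (cong (tail G) d≡)) eq)

    ≢-from : ∀ {u v w : Fin n} → u ≡ v → v ≢ w → u ≢ w
    ≢-from refl v≢w = v≢w

    abstract
      second-tilde : ∀ e → e ≡ e₂ → Tilde G₁ e₂ (G₁ ∼ e) x₂ y₂ (ss p₂) (ss q₂) (ss r₂) (rev T₁.β)
      second-tilde _ refl = tilde G₁ e₂
        (proj₂ t₂ , T₁.tail-old t₂ , T₁.tail-old (rev t₂))
        (two-darts-∖ G₁ e₂ (λ eq → p₂≢q₂ (cong (head G) (ss-injective eq)))
          (at-x₂ p₂ (N₂⊆C p₂∈) tail-p₂ Reflected.p₁-off) (C≢t₂ (N₂⊆C p₂∈) ∘ ss-edge)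
          (at-x₂ q₂ (N₂⊆C q₂∈) tail-q₂ Reflected.q₁-off) (C≢t₂ (N₂⊆C q₂∈) ∘ ss-edge)
          (λ d at ≢e₂ → only-x₂ (view₁ d (proj₁ at)) (proj₂ at) ≢e₂)
          (head-old p₂ (proj₁ Reflected.p₁-off)) (head-old q₂ (proj₁ Reflected.q₁-off)))
        (two-darts-∖ G₁ e₂ (λ eq → r≢β eq (T₁.labels))
          at-r₂ (C≢t₂ (W⊆C r₂∈) ∘ ss-edge)
          (T₁.β∈ , head-β₁) (β≢e₂ T₁.labels)
          (λ d at ≢e₂ → only-y₂ (view₁ d (proj₁ at)) (proj₂ at) ≢e₂)
          (head-old r₂ (proj₁ (proj₂ Reflected.r₁-off))) (≢-from head-β₁′ r₁≢y₂))
        x₂≢y₂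
        (head-∖≢ G₁ e₂ (ss p₂) (head-old p₂ (proj₁ (proj₂ Reflected.p₁-off))))
        (head-∖≢ G₁ e₂ (ss q₂) (head-old q₂ (proj₁ (proj₂ Reflected.q₁-off))))
        (head-∖≢ G₁ e₂ (ss r₂) (head-old r₂ (proj₁ Reflected.r₁-off)))
        (head-∖≢ G₁ e₂ (rev T₁.β) (≢-from head-β₁′ (proj₁ (proj₂ (proj₂ r₁-off)))))
        where
        ss-injective : ∀ {d d′ : Dart m} → ss d ≡ ss d′ → d ≡ d′
        ss-injective refl = refl
        ss-edge : ∀ {e : Fin m} → _≡_ {A = Fin (2 + m)} (suc (suc e)) e₂ → e ≡ edge t₂
        ss-edge refl = refl
        head-old : ∀ {v} d → head G d ≢ v → head G₁ (ss d) ≢ v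
        head-old d = ≢-from (T₁.tail-old (rev d))
        head-β₁′ : head G₁ (rev T₁.β) ≡ head G r₁
        head-β₁′ = trans (head-rev G₁ T₁.β) tail-β₁
        at-x₂ : ∀ d → edge d ∈ C → tail G d ≡ x₂ → Configuration.OffPath (reflect c) (head G d) → At G₁ (E G₁) x₂ (ss d)
        at-x₂ d d∈ t (_ , _ , h≢x₁ , h≢y₁) = old-at d d∈ t
          (ends-avoid d (≢-from t (x₁≢x₂ ∘ sym)) h≢x₁) (ends-avoid d (≢-from t x₂≢y₁) h≢y₁)
        at-r₂ : At G₁ (E G₁) y₂ (ss r₂)
        at-r₂ = old-at r₂ (W⊆C r₂∈) tail-r₂
          (ends-avoid r₂ (≢-from tail-r₂ (x₁≢y₂ ∘ sym)) (proj₁ (proj₂ (proj₂ Reflected.r₁-off))))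
          (ends-avoid r₂ (≢-from tail-r₂ (y₁≢y₂ ∘ sym)) r₂≢y₁)
        r≢β : ss r₂ ≡ rev T₁.β → (edge T₁.α ≡ zero × edge T₁.β ≡ suc zero) ⊎ (edge T₁.α ≡ suc zero × edge T₁.β ≡ zero) → ⊥
        r≢β eq (inj₁ (_ , l)) = case trans (cong edge eq) l of λ ()
        r≢β eq (inj₂ (_ , l)) = case trans (cong edge eq) l of λ ()
        β≢e₂ : (edge T₁.α ≡ zero × edge T₁.β ≡ suc zero) ⊎ (edge T₁.α ≡ suc zero × edge T₁.β ≡ zero) → edge T₁.β ≢ e₂
        β≢e₂ (inj₁ (_ , l)) eq = case trans (sym l) eq of λ ()
        β≢e₂ (inj₂ (_ , l)) eq = case trans (sym l) eq of λ ()
        only-x₂ : ∀ {d} → View₁ d → tail G₁ d ≡ x₂ → edge d ≢ e₂ → d ≡ ss p₂ ⊎ d ≡ ss q₂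
        only-x₂ (old d d∈ _ _ _) t ≢e₂ with Reflected.only-x₁ d (d∈ , trans (sym (T₁.tail-old d)) t)
        ... | inj₁ refl        = contradiction refl ≢e₂
        ... | inj₂ (inj₁ refl) = inj₁ refl
        ... | inj₂ (inj₂ refl) = inj₂ refl
        only-x₂ α₁  t _ = contradiction (trans (sym tail-α₁) t) (proj₁ (proj₂ (proj₂ p₁-off)))
        only-x₂ α₁′ t _ = contradiction (trans (sym head-α₁) t) (proj₁ (proj₂ (proj₂ q₁-off)))
        only-x₂ β₁  t _ = contradiction (trans (sym tail-β₁) t) (proj₁ (proj₂ (proj₂ r₁-off)))
        only-x₂ β₁′ t _ = contradiction (trans (sym t) head-β₁) x₂≢y₂
        only-y₂ : ∀ {d} → View₁ d → tail G₁ d ≡ y₂ → edge d ≢ e₂ → d ≡ ss r₂ ⊎ d ≡ rev T₁.β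
        only-y₂ (old d d∈ _ _ ≢y₁) t ≢e₂ with Reflected.only-y₁ d (d∈ , trans (sym (T₁.tail-old d)) t)
        ... | inj₁ refl        = contradiction refl ≢e₂
        ... | inj₂ (inj₁ refl) = inj₁ refl
        ... | inj₂ (inj₂ refl) = contradiction tail-s (≢y₁ (proj₂ s))
        only-y₂ α₁  t _ = contradiction (trans (sym tail-α₁) t) (proj₂ (proj₂ (proj₂ p₁-off)))
        only-y₂ α₁′ t _ = contradiction (trans (sym head-α₁) t) (proj₂ (proj₂ (proj₂ q₁-off)))
        only-y₂ β₁  t _ = contradiction (trans (sym tail-β₁) t) (proj₂ (proj₂ (proj₂ r₁-off)))
        only-y₂ β₁′ _ _ = inj₂ refl

    module Final {H : Graph n (4 + m)} (T₂ : Tilde G₁ e₂ H x₂ y₂ (ss p₂) (ss q₂) (ss r₂) (rev T₁.β)) where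
      private module T₂ = Tilde T₂

      R : Dart (4 + m) → Dart m
      R = T₁.R ∘ T₂.R

      old⁴ : Dart m → Dart (4 + m)
      old⁴ d = ss (ss d)

      R-old : ∀ d → R (old⁴ d) ≡ d
      R-old d = trans (cong T₁.R (T₂.R-old (ss d))) (T₁.R-old d)

      -- The new edges u₁v₁, u₂v₂ and w₁w₂. As `new₃` is created at `y₂`, it runs from w₂ to w₁.
      new₁ new₂ new₃ : Dart (4 + m)
      new₁ = ss T₁.α
      new₂ = T₂.α
      new₃ = T₂.β

      R-new₁ : R new₁ ≡ rev p₁
      R-new₁ = trans (cong T₁.R (T₂.R-old T₁.α)) T₁.R-α

      R-new₁′ : R (rev new₁) ≡ rev q₁
      R-new₁′ = trans (cong T₁.R (T₂.R-old (rev T₁.α))) T₁.R-α′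

      R-new₂ : R new₂ ≡ rev p₂
      R-new₂ = trans (cong T₁.R T₂.R-α) (T₁.R-old (rev p₂))

      R-new₂′ : R (rev new₂) ≡ rev q₂
      R-new₂′ = trans (cong T₁.R T₂.R-α′) (T₁.R-old (rev q₂))

      R-new₃ : R new₃ ≡ rev r₂
      R-new₃ = trans (cong T₁.R T₂.R-β) (T₁.R-old (rev r₂))

      R-new₃′ : R (rev new₃) ≡ rev r₁
      R-new₃′ = trans (cong T₁.R (trans T₂.R-β′ (rev-rev T₁.β))) T₁.R-β

      abstract
        off-e₂ : ∀ {v} → OffPath v → ∀ b → tail G₁ (e₂ , b) ≢ v
        off-e₂ (_ , _ , ≢x₂ , ≢y₂) b eq with same-edge t₂ (edge t₂ , b) refl
        ... | inj₁ d≡ = ≢x₂ (trans (sym eq) (trans (T₁.tail-old (edge t₂ , b)) (cong (tail G) d≡)))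
        ... | inj₂ d≡ = ≢y₂ (trans (sym eq) (trans (T₁.tail-old (edge t₂ , b)) (cong (tail G) d≡)))

        off-t₁ : ∀ {v} → OffPath v → ∀ b → tail G (edge t₁ , b) ≢ v
        off-t₁ (≢x₁ , ≢y₁ , _) b eq with same-edge t₁ (edge t₁ , b) refl
        ... | inj₁ d≡ = ≢x₁ (trans (sym eq) (cong (tail G) d≡))
        ... | inj₂ d≡ = ≢y₁ (trans (sym eq) (cong (tail G) d≡))

      reduction : Reduction G H OffPath
      reduction =
        Reduction-trans {Q = OffPath} id (Reduction-weaken off-t₁ (delete-reduction G (edge t₁)))
        (Reduction-trans {Q = OffPath} id (Reduction-weaken (λ (p , q , _) → p , q) T₁.reduction)
        (Reduction-trans {Q = OffPath} id (Reduction-weaken off-e₂ (delete-reduction G₁ e₂))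
        (Reduction-weaken (λ (_ , _ , r , s) → r , s) T₂.reduction)))

      abstract
        new₁∈ : edge new₁ ∈ E H
        new₁∈ = T₂.old∈⁺ T₁.α∈ (≢e₂ T₁.labels) (avoid (proj₁ (proj₂ (proj₂ p₁-off))) (proj₁ (proj₂ (proj₂ q₁-off))))
                                                (avoid (proj₂ (proj₂ (proj₂ p₁-off))) (proj₂ (proj₂ (proj₂ q₁-off))))
          where
          ≢e₂ : (edge T₁.α ≡ zero × edge T₁.β ≡ suc zero) ⊎ (edge T₁.α ≡ suc zero × edge T₁.β ≡ zero) → edge T₁.α ≢ e₂
          ≢e₂ (inj₁ (l , _)) eq = case trans (sym l) eq of λ ()
          ≢e₂ (inj₂ (l , _)) eq = case trans (sym l) eq of λ ()
          avoid : ∀ {v} → head G p₁ ≢ v → head G q₁ ≢ v → ∀ b → tail G₁ (edge T₁.α , b) ≢ v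
          avoid p≢ q≢ b eq with same-edge T₁.α (edge T₁.α , b) refl
          ... | inj₁ d≡ = p≢ (trans (sym tail-α₁) (trans (sym (cong (tail G₁) d≡)) eq))
          ... | inj₂ d≡ = q≢ (trans (sym head-α₁) (trans (sym (cong (tail G₁) d≡)) eq))

        new₂∈ : edge new₂ ∈ E H
        new₂∈ = T₂.α∈

        new₃∈ : edge new₃ ∈ E H
        new₃∈ = T₂.β∈

        V-H : ∀ {v} → v ∈ V H → v ∈ V G × OffPath v
        V-H v∈ = let (v∈₁ , ≢x₂ , ≢y₂) = T₂.V-∼ v∈ ; (v∈₀ , ≢x₁ , ≢y₁) = T₁.V-∼ v∈₁ in
          v∈₀ , ≢x₁ , ≢y₁ , ≢x₂ , ≢y₂

        V-H⁺ : ∀ {v} → v ∈ V G → OffPath v → v ∈ V H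
        V-H⁺ v∈ (≢x₁ , ≢y₁ , ≢x₂ , ≢y₂) = T₂.V-∼⁺ (T₁.V-∼⁺ v∈ ≢x₁ ≢y₁) ≢x₂ ≢y₂

        old⁴∈ : ∀ {e} → e ∈ E G → (∀ b → OffPath (tail G (e , b))) → suc (suc (suc (suc e))) ∈ E H
        old⁴∈ {e} e∈ off = T₂.old∈⁺ (T₁.old∈⁺ e∈ (λ { refl → proj₁ (off (proj₂ t₁)) refl })
            (proj₁ ∘ off) (proj₁ ∘ proj₂ ∘ off))
          (λ { refl → proj₁ (proj₂ (proj₂ (off (proj₂ t₂)))) refl })
          (λ b → ≢-from (T₁.tail-old (e , b)) (proj₁ (proj₂ (proj₂ (off b)))))
          (λ b → ≢-from (T₁.tail-old (e , b)) (proj₂ (proj₂ (proj₂ (off b)))))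

      NewEdge : Fin (4 + m) → Set
      NewEdge e = e ≡ edge new₁ ⊎ e ≡ edge new₂ ⊎ e ≡ edge new₃

      data View : Dart (4 + m) → Set where
        old : ∀ d → edge d ∈ E G → (∀ b → OffPath (tail G (edge d , b))) → View (old⁴ d)
        new : ∀ {d} → NewEdge (edge d) → View d

      abstract
        view : ∀ d → edge d ∈ E H → View d
        view d e∈ with T₂.view d
        ... | inj₂ (inj₁ eq) = new (inj₂ (inj₁ eq))
        ... | inj₂ (inj₂ eq) = new (inj₂ (inj₂ eq))
        ... | inj₁ (d₁ , refl) = let (e₁∈ , _ , ≢x₂ , ≢y₂) = T₂.old∈ e∈ in go (view₁ d₁ e₁∈) ≢x₂ ≢y₂
          where
          go : ∀ {d₁} → View₁ d₁ → (∀ b → tail G₁ (edge d₁ , b) ≢ x₂) → (∀ b → tail G₁ (edge d₁ , b) ≢ y₂) →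
               View (ss d₁)
          go (old d d∈ _ ≢x₁ ≢y₁) ≢x₂ ≢y₂ = old d d∈ λ b → ≢x₁ b , ≢y₁ b ,
            ≢-from (sym (T₁.tail-old (edge d , b))) (≢x₂ b) , ≢-from (sym (T₁.tail-old (edge d , b))) (≢y₂ b)
          go α₁  _ _ = new (inj₁ refl)
          go α₁′ _ _ = new (inj₁ refl)
          -- The intermediate edge from w₁ to y₂ disappears with `y₂`, so one of the four additional
          -- labels of `H` belongs to no edge.
          go β₁  _ ≢y₂ = contradiction head-β₁ (≢y₂ (not (proj₂ T₁.β)))
          go β₁′ _ ≢y₂ = contradiction head-β₁ (≢y₂ (not (proj₂ T₁.β)))

        new-label : ∀ {e} → NewEdge e → ∃[ i ] e ≡ i ↑ˡ m
        new-label (inj₁ refl) with T₁.labels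
        ... | inj₁ (l , _) = suc (suc zero) , cong (λ e → suc (suc e)) l
        ... | inj₂ (l , _) = suc (suc (suc zero)) , cong (λ e → suc (suc e)) l
        new-label (inj₂ (inj₁ refl)) with T₂.labels
        ... | inj₁ (l , _) = zero , l
        ... | inj₂ (l , _) = suc zero , l
        new-label (inj₂ (inj₂ refl)) with T₂.labels
        ... | inj₁ (_ , l) = suc zero , l
        ... | inj₂ (_ , l) = zero , l

      -- `P` propagates along the three replaced paths in both directions: u₁x₁v₁, u₂x₂v₂, and
      -- w₁y₁y₂w₂, whose three edges take four of the conditions.
      record Coherent (P : Dart m → Set) : Set where
        field
          p→q₁ : P (rev p₁) → P q₁
          q→p₁ : P (rev q₁) → P p₁
          p→q₂ : P (rev p₂) → P q₂
          q→p₂ : P (rev q₂) → P p₂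
          r→s  : P (rev r₁) → P s
          s→r  : P (rev s) → P r₁
          s→r₂ : P s → P r₂
          r→s₂ : P (rev r₂) → P (rev s)

      abstract
        lifts : (P : Dart m → Set) → Coherent P → Lifts G H R P
        lifts P coh =
          delete-lifts G (edge t₁) P ∘ T₁.lifts P p→q₁ q→p₁ r→s s→r ∘
          delete-lifts G₁ e₂ (P ∘ T₁.R) ∘
          T₂.lifts (P ∘ T₁.R)
            (λ p → back q₂ (p→q₂ (forth (rev p₂) p)))
            (λ p → back p₂ (q→p₂ (forth (rev q₂) p)))
            (λ p → subst P (sym T₁.R-β′) (r→s₂ (forth (rev r₂) p)))
            (λ p → back r₂ (s→r₂ (r→s (subst P (trans (cong T₁.R (rev-rev T₁.β)) T₁.R-β) p))))
          where
          open Coherent coh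
          forth : ∀ d → P (T₁.R (ss d)) → P d
          forth d = subst P (T₁.R-old d)
          back : ∀ d → P d → P (T₁.R (ss d))
          back d = subst P (sym (T₁.R-old d))

-- Unit flows from smooth orientations

Directed : Orientation m → Dart m → Set
Directed o d = o (edge d) ≡ proj₂ d

unit : Subset m → Orientation m → Dart m → ℤ
unit A o (e , b) = if does (e ∈? A) then (if does (o e Bool.≟ b) then 1ℤ else -1ℤ) else 0ℤ

IsUnit : ℤ → Set
IsUnit x = x ≡ 1ℤ ⊎ x ≡ -1ℤ

module _ (A : Subset m) (o : Orientation m) where

  unit-zero : ∀ d → edge d ∉ A → unit A o d ≡ 0ℤ
  unit-zero d d∉ = cong (λ c → if c then (if does (o (edge d) Bool.≟ proj₂ d) then 1ℤ else -1ℤ) else 0ℤ) (dec-false (edge d ∈? A) d∉)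

  unit-on : ∀ d → edge d ∈ A → unit A o d ≡ (if does (o (edge d) Bool.≟ proj₂ d) then 1ℤ else -1ℤ)
  unit-on d d∈ = cong (λ c → if c then (if does (o (edge d) Bool.≟ proj₂ d) then 1ℤ else -1ℤ) else 0ℤ) (dec-true (edge d ∈? A) d∈)

  unit-forward : ∀ d → edge d ∈ A → Directed o d → unit A o d ≡ 1ℤ
  unit-forward d d∈ eq = trans (unit-on d d∈) (cong (if_then 1ℤ else -1ℤ) (dec-true (o (edge d) Bool.≟ proj₂ d) eq))

  unit-backward : ∀ d → edge d ∈ A → ¬ Directed o d → unit A o d ≡ -1ℤ
  unit-backward d d∈ neq = trans (unit-on d d∈) (cong (if_then 1ℤ else -1ℤ) (dec-false (o (edge d) Bool.≟ proj₂ d) neq))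

  unit-IsUnit : ∀ d → edge d ∈ A → IsUnit (unit A o d)
  unit-IsUnit d d∈ = Sum.map (unit-forward d d∈) (unit-backward d d∈) (toSum (o (edge d) Bool.≟ proj₂ d))

  unit-rev : ∀ d → unit A o (rev d) ≡ ℤ.- unit A o d
  unit-rev d@(e , b) with e ∈? A
  ... | no e∉ = refl
  ... | yes e∈ = lemma (o e) b
    where
    lemma : ∀ a b → (if does (a Bool.≟ not b) then 1ℤ else -1ℤ) ≡ ℤ.- (if does (a Bool.≟ b) then 1ℤ else -1ℤ)
    lemma false false = refl
    lemma false true  = refl
    lemma true  false = refl
    lemma true  true  = refl

module _ (G : Graph n m) (A : Subset m) (A⊆E : A ⊆ E G) (regular : TwoRegular G A)
         (o : Orientation m) (smooth-o : SmoothOn G A o) where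

  private
    Directed? : ∀ d → Dec (Directed o d)
    Directed? d = o (edge d) Bool.≟ proj₂ d

    -- A smooth orientation speaks only of circuits, so the sum is first restricted to the component
    -- of the vertex, which is one; there a single dart leaves and a single one enters.
    ∑-at-vertex : ∀ d → edge d ∈ A → ℤ∑.∑ (At? G A (tail G d)) (unit A o) ≡ 0ℤ
    ∑-at-vertex d d∈ = begin
      ℤ∑.∑ (At? G A v) (unit A o)
        ≡⟨ ℤ∑.∑-cong (At? G A v) (At? G D v)
             (λ { d′ (d′∈ , t) → ∈-component-edges G A d′ d′∈ (subst (_∈ component G A v) (sym t) start) , t })
             (λ d′ (d′∈ , t) → component-edges⊆ G A d′∈ , t) (λ _ _ → refl) ⟩
      ℤ∑.∑ (At? G D v) (unit A o)
        ≡⟨ ℤ∑.∑-split (At? G D v) Directed? (unit A o) ⟩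
      ℤ∑.∑ out? (unit A o) ℤ.+ ℤ∑.∑ in? (unit A o)
        ≡⟨ cong₂ ℤ._+_
             (trans (ℤ∑.∑-cong′ out? (λ d′ ((d′∈ , _) , eq) →
                unit-forward A o d′ (component-edges⊆ G A d′∈) eq)) (sym (∑-homo
                ℕ.+-0-isCommutativeMonoid ℤ.+-0-isCommutativeMonoid ℤ.+_ refl (λ _ _ → refl) out? (λ _ → 1))))
             (trans (ℤ∑.∑-cong′ in? (λ d′ ((d′∈ , _) , neq) →
                unit-backward A o d′ (component-edges⊆ G A d′∈) neq)) (sym (∑-homo
                ℕ.+-0-isCommutativeMonoid ℤ.+-0-isCommutativeMonoid (λ k → ℤ.- (ℤ.+ k)) refl
                (λ x y → ℤ.neg-distrib-+ (ℤ.+ x) (ℤ.+ y)) in? (λ _ → 1)))) ⟩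
      ℤ.+ ∑1 out? ℤ.+ ℤ.- (ℤ.+ ∑1 in?)
        ≡⟨ cong₂ (λ a b → ℤ.+ a ℤ.+ ℤ.- (ℤ.+ b)) out≡1 in≡1 ⟩
      0ℤ ∎
      where
      open ≡-Reasoning
      v = tail G d
      D = component-edges G A v
      start = Closure.start (reach G A v)
      out? : ∀ d′ → Dec (At G D v d′ × Directed o d′)
      out? d′ = At? G D v d′ ×-dec Directed? d′
      in? : ∀ d′ → Dec (At G D v d′ × ¬ Directed o d′)
      in? d′ = At? G D v d′ ×-dec ¬? (Directed? d′)
      degrees : inDegree G o D v ≡ 1 × outDegree G o D v ≡ 1
      degrees = smooth-o D (component-circuit G A A⊆E regular d d∈) (component-edges⊆ G A) v
        (edge d , ∈-component-edges G A d d∈ start , proj₂ d , refl)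
      out≡1 : ∑1 out? ≡ 1
      out≡1 = trans (sym (ℕ∑.∑-reindex out? (λ e → (e ∈? D) ×-dec (tail G (e , o e) ≟ v)) _≟ᵈ_
        (λ e → e , o e) (λ _ → 1) (λ e (e∈ , t) → (e∈ , t) , refl) (λ _ _ _ _ → cong edge)
        (λ { (e , _) ((e∈ , t) , refl) → e , (e∈ , t) , refl })))
        (trans (sym (outDegree-∑ G o D v)) (proj₂ degrees))
      in≡1 : ∑1 in? ≡ 1
      in≡1 = trans (sym (ℕ∑.∑-reindex in? (λ e → (e ∈? D) ×-dec (head G (e , o e) ≟ v)) _≟ᵈ_
        (λ e → e , not (o e)) (λ _ → 1) (λ e (e∈ , t) → (e∈ , t) , Bool.not-¬ refl) (λ _ _ _ _ → cong edge)
        (λ { (e , b) ((e∈ , t) , neq) → let eq = sym (Bool.¬-not (neq ∘ sym)) in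
             e , (e∈ , trans (cong (λ b → tail G (e , b)) eq) t) , cong (e ,_) eq })))
        (trans (sym (inDegree-∑ G o D v)) (proj₁ degrees))

  unit-conserved : ∀ v → ℤ∑.∑ (At? G A v) (unit A o) ≡ 0ℤ
  unit-conserved v with Fin.any? (λ e → At? G A v (e , false) ⊎-dec At? G A v (e , true))
  ... | yes (e , inj₁ (e∈ , refl)) = ∑-at-vertex (e , false) e∈
  ... | yes (e , inj₂ (e∈ , refl)) = ∑-at-vertex (e , true) e∈
  ... | no none = ℤ∑.∑-𝟘 (At? G A v) _ λ
    { (e , false) at → contradiction (e , inj₁ at) none
    ; (e , true)  at → contradiction (e , inj₂ at) none }

  unit-flow : IsFlow G (unit A o)
  unit-flow = record
    { antisymmetric = λ d _ → unit-rev A o d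
    ; conserved     = λ v _ → begin
        ℤ∑.∑ (At? G (E G) v) (unit A o)
          ≡⟨ ℤ∑.∑-split (At? G (E G) v) (λ d → edge d ∈? A) (unit A o) ⟩
        ℤ∑.∑ (λ d → At? G (E G) v d ×-dec (edge d ∈? A)) (unit A o) ℤ.+
        ℤ∑.∑ (λ d → At? G (E G) v d ×-dec ¬? (edge d ∈? A)) (unit A o)
          ≡⟨ cong₂ ℤ._+_
               (ℤ∑.∑-cong (λ d → At? G (E G) v d ×-dec (edge d ∈? A)) (At? G A v)
                 (λ _ ((_ , t) , d∈) → d∈ , t) (λ _ (d∈ , t) → (A⊆E d∈ , t) , d∈) (λ _ _ → refl))
               (ℤ∑.∑-𝟘 (λ d → At? G (E G) v d ×-dec ¬? (edge d ∈? A)) (unit A o)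
                 (λ d (_ , d∉) → unit-zero A o d d∉)) ⟩
        ℤ∑.∑ (At? G A v) (unit A o) ℤ.+ 0ℤ
          ≡⟨ trans (ℤ.+-identityʳ _) (unit-conserved v) ⟩
        0ℤ ∎
    }
    where open ≡-Reasoning

combine : ℤ → ℤ → (Dart m → ℤ) → (Dart m → ℤ) → Dart m → ℤ
combine a b f g d = a ℤ.* f d ℤ.+ b ℤ.* g d

neg-combine : ∀ a b x y → a ℤ.* (ℤ.- x) ℤ.+ b ℤ.* (ℤ.- y) ≡ ℤ.- (a ℤ.* x ℤ.+ b ℤ.* y)
neg-combine = ℤ-Solver.solve-∀

combine-flow : {G : Graph n m} {f g : Dart m → ℤ} (a b : ℤ) → IsFlow G f → IsFlow G g →
               IsFlow G (combine a b f g)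
combine-flow {G = G} {f} {g} a b F F′ = record
  { antisymmetric = λ d e∈ → trans
      (cong₂ (λ x y → a ℤ.* x ℤ.+ b ℤ.* y) (IsFlow.antisymmetric F d e∈) (IsFlow.antisymmetric F′ d e∈))
      (neg-combine a b (f d) (g d))
  ; conserved = λ v v∈ → trans (ℤ∑.∑-∙ (At? G (E G) v) _ _)
      (cong₂ ℤ._+_ (scaled a (IsFlow.conserved F v v∈)) (scaled b (IsFlow.conserved F′ v v∈)))
  }
  where
  scaled : ∀ a {h v} → ℤ∑.∑ (At? G (E G) v) h ≡ 0ℤ → ℤ∑.∑ (At? G (E G) v) (λ d → a ℤ.* h d) ≡ 0ℤ
  scaled a {h} {v} eq = trans (sym (∑-homo ℤ.+-0-isCommutativeMonoid ℤ.+-0-isCommutativeMonoid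
    (a ℤ.*_) (ℤ.*-zeroʳ a) (ℤ.*-distribˡ-+ a) (At? G (E G) v) h)) (trans (cong (a ℤ.*_) eq) (ℤ.*-zeroʳ a))

-- Ears through the path x₁ y₁ y₂ x₂

module EdgeFacts {G : Graph n m} (c : Configuration G) where
  open Configuration c
  open Facts c

  apart : ∀ {D D′} → (∀ {v} → VertexOf G D v → ¬ VertexOf G D′ v) → ∀ {e f} → e ∈ D → f ∈ D′ → e ≢ f
  apart D#D′ {e} e∈ f∈ refl = D#D′ (vertex (e , false) e∈ refl) (vertex (e , false) f∈ refl)

  edges≢ : ∀ {a b} → a ≢ b → tail G b ≢ head G a → edge a ≢ edge b
  edges≢ {a} {b} a≢b t≢h eq with same-edge a b eq
  ... | inj₁ b≡ = a≢b (sym b≡)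
  ... | inj₂ b≡ = t≢h (cong (tail G) b≡)

  p₁≢q₁-edge : edge p₁ ≢ edge q₁
  p₁≢q₁-edge = edges≢ {p₁} {q₁} (p₁≢q₁ ∘ cong (head G)) (λ eq → proj₁ p₁-off (trans (sym eq) tail-q₁))

  r₁≢s-edge : edge r₁ ≢ edge s
  r₁≢s-edge = edges≢ {r₁} {s} (r₁≢s ∘ cong (head G)) (λ eq → proj₁ (proj₂ r₁-off) (trans (sym eq) tail-s))

  r₁≢r₂-edge : edge r₁ ≢ edge r₂
  r₁≢r₂-edge = edges≢ {r₁} {r₂} (λ eq → y₁≢y₂ (trans (sym tail-r₁) (trans (cong (tail G) eq) tail-r₂)))
    (λ eq → r₁≢y₂ (trans (sym eq) tail-r₂))

-- The flow has a constant nonzero value along each of the three paths replaced by a new edge. For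
-- `φ₁` and `φ₂` this holds because x₁y₁ and x₂y₂ carry no flow.
record PathFlow {G : Graph n m} (c : Configuration G) (φ : Dart m → ℤ) : Set where
  open Configuration c
  field
    anti     : ∀ d → φ (rev d) ≡ ℤ.- φ d
    along-x₁ : φ (rev p₁) ≡ φ q₁
    along-x₂ : φ (rev p₂) ≡ φ q₂
    along-y₁ : φ (rev r₁) ≡ φ s
    along-y₂ : φ s ≡ φ r₂
    p₁≢0     : φ p₁ ≢ 0ℤ
    p₂≢0     : φ p₂ ≢ 0ℤ
    s≢0      : φ s ≢ 0ℤ

  anti′ : ∀ {d d′} → φ (rev d) ≡ φ d′ → φ (rev d′) ≡ φ d
  anti′ {d} {d′} eq = trans (anti d′) (trans (cong ℤ.-_ (trans (sym eq) (anti d))) (ℤ.neg-involutive (φ d)))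

reflect-flow : {G : Graph n m} {c : Configuration G} {φ : Dart m → ℤ} → PathFlow c φ → PathFlow (reflect c) φ
reflect-flow {c = c} {φ} pf = record
  { anti = anti ; along-x₁ = along-x₂ ; along-x₂ = along-x₁
  ; along-y₁ = trans (anti r₂) (trans (cong ℤ.-_ (sym along-y₂)) (sym (anti s)))
  ; along-y₂ = anti′ along-y₁
  ; p₁≢0 = p₂≢0 ; p₂≢0 = p₁≢0
  ; s≢0 = λ eq → s≢0 (ℤ.neg-injective (trans (sym (anti s)) eq))
  }
  where
  open PathFlow pf
  open Configuration c

pos-or-neg : ∀ {x y} → y ≡ ℤ.- x → x ≢ 0ℤ → 0ℤ ℤ.< x ⊎ 0ℤ ℤ.< y
pos-or-neg {ℤ.+ zero}  _ h = contradiction refl h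
pos-or-neg {ℤ.+ suc n} _ _ = inj₁ (ℤ.+<+ (s≤s z≤n))
pos-or-neg {ℤ.-[1+ n ]} refl _ = inj₂ (ℤ.+<+ (s≤s z≤n))

-- If the hubs reach each other without `e`, strong connectivity only requires each vertex to reach
-- some hub and to be reached from some hub. The hubs will be the vertices off the path, connected
-- through `H`.
module Deletion (G : Graph n m) (o : Orientation m) (e : Fin m)
  (Hub : Fin n → Set) (hubs : ∀ {u v} → Hub u → Hub v → Star (Arc (G ∖ ⁅ e ⁆) o) u v) where

  Exit Entry Linked : Fin n → Set
  Exit v   = ∃[ w ] Hub w × Star (Arc (G ∖ ⁅ e ⁆) o) v w
  Entry v  = ∃[ w ] Hub w × Star (Arc (G ∖ ⁅ e ⁆) o) w v
  Linked v = Exit v × Entry v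

  deletable : (∀ {v} → v ∈ V G → Linked v) → Deletable G o e
  deletable linked u v u∈ v∈ _ =
    let (w , hub-w , path) = proj₁ (linked u∈)
        (w′ , hub-w′ , path′) = proj₂ (linked v∈)
    in path ◅◅ hubs hub-w hub-w′ ◅◅ path′

  run : ∀ d → edge d ∈ E G → edge d ≢ e → Directed o d → Star (Arc (G ∖ ⁅ e ⁆) o) (tail G d) (head G d)
  run (f , b) f∈ f≢e refl = (f , x∈p∧x≢y⇒x∈p-y f∈ f≢e , tail-∖ G ⁅ e ⁆ (f , b) , tail-∖ G ⁅ e ⁆ (f , not b)) ◅ ε

  hub-linked : ∀ {v} → Hub v → Linked v
  hub-linked h = (_ , h , ε) , (_ , h , ε)

  exit-via : ∀ d {v} → edge d ∈ E G → edge d ≢ e → Directed o d → tail G d ≡ v → Exit (head G d) → Exit v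
  exit-via d d∈ d≢ dir refl (w , h , path) = w , h , run d d∈ d≢ dir ◅◅ path

  entry-via : ∀ d {v} → edge d ∈ E G → edge d ≢ e → Directed o d → head G d ≡ v → Entry (tail G d) → Entry v
  entry-via d d∈ d≢ dir refl (w , h , path) = w , h , path ◅◅ run d d∈ d≢ dir

  module Ears (c : Configuration G) (φ : Dart m → ℤ) (pf : PathFlow c φ)
    (directed : ∀ d → edge d ∈ E G → 0ℤ ℤ.< φ d → Directed o d)
    (off-hub : ∀ {v} → v ∈ V G → Configuration.OffPath c v → Hub v) where

    open Configuration c
    open Facts c
    open EdgeFacts c
    open PathFlow pf

    hub : ∀ d → edge d ∈ C → OffPath (head G d) → Linked (head G d)
    hub d d∈ off = hub-linked (off-hub (tail∈V G (rev d) (C⊆E d∈)) off)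

    exit-at : ∀ a {v} → edge a ∈ C → tail G a ≡ v → OffPath (head G a) → 0ℤ ℤ.< φ a → edge a ≢ e → Exit v
    exit-at a a∈ t off pos a≢ = exit-via a (C⊆E a∈) a≢ (directed a (C⊆E a∈) pos) t (proj₁ (hub a a∈ off))

    entry-at : ∀ a {v} → edge a ∈ C → tail G a ≡ v → OffPath (head G a) → 0ℤ ℤ.< φ (rev a) → edge a ≢ e → Entry v
    entry-at a a∈ t off pos a≢ = entry-via (rev a) (C⊆E a∈) a≢ (directed (rev a) (C⊆E a∈) pos)
      (trans (head-rev G a) t) (proj₂ (hub a a∈ off))

    x₁-linked : edge p₁ ≢ e → edge q₁ ≢ e → Linked x₁
    x₁-linked p≢ q≢ with pos-or-neg (anti p₁) p₁≢0
    ... | inj₁ pos = exit-at p₁ (N₁⊆C p₁∈) tail-p₁ p₁-off pos p≢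
                   , entry-at q₁ (N₁⊆C q₁∈) tail-q₁ q₁-off (subst (0ℤ ℤ.<_) (sym (anti′ along-x₁)) pos) q≢
    ... | inj₂ pos = exit-at q₁ (N₁⊆C q₁∈) tail-q₁ q₁-off (subst (0ℤ ℤ.<_) along-x₁ pos) q≢
                   , entry-at p₁ (N₁⊆C p₁∈) tail-p₁ p₁-off pos p≢

    -- The flow passes from w₁ through y₁ and y₂ to w₂; the opposite sign is covered by reflection.
    module _ (pos : 0ℤ ℤ.< φ s) where
      entry-y₁ : edge r₁ ≢ e → Entry y₁
      entry-y₁ r₁≢ = entry-at r₁ (W⊆C r₁∈) tail-r₁ r₁-off (subst (0ℤ ℤ.<_) (sym along-y₁) pos) r₁≢

      exit-y₂ : edge r₂ ≢ e → Exit y₂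
      exit-y₂ r₂≢ = exit-at r₂ (W⊆C r₂∈) tail-r₂
        (let (p , q , r , t) = Facts.r₁-off (reflect c) in r , t , p , q) (subst (0ℤ ℤ.<_) along-y₂ pos) r₂≢

      exit-y₁ : edge s ≢ e → Exit y₂ → Exit y₁
      exit-y₁ s≢ ex = exit-via s s∈ s≢ (directed s s∈ pos) tail-s (subst Exit (sym head-s) ex)

      entry-y₂ : edge s ≢ e → Entry y₁ → Entry y₂
      entry-y₂ s≢ en = entry-via s s∈ s≢ (directed s s∈ pos) head-s (subst Entry (sym tail-s) en)

      y-linked : edge r₁ ≢ e → edge r₂ ≢ e → edge s ≢ e → Linked y₁ × Linked y₂
      y-linked r₁≢ r₂≢ s≢ =
        (exit-y₁ s≢ (exit-y₂ r₂≢) , entry-y₁ r₁≢) , (exit-y₂ r₂≢ , entry-y₂ s≢ (entry-y₁ r₁≢))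

      -- Without `r₁` the vertex y₁ lacks its entry, which x₁ → y₁ replaces; without `r₂` the vertex
      -- y₂ lacks its exit, which y₂ → x₂ replaces.
      y-linked-without-r : e ≡ edge r₁ ⊎ e ≡ edge r₂ → Directed o t₁ → Directed o (rev t₂) →
                           Linked x₁ → Linked x₂ → Linked y₁ × Linked y₂
      y-linked-without-r (inj₁ refl) dir₁ dir₂ lx₁ lx₂ = (exit-y₁ s≢ out , en) , (out , entry-y₂ s≢ en)
        where
        s≢ = r₁≢s-edge ∘ sym
        out = exit-y₂ (r₁≢r₂-edge ∘ sym)
        en = entry-via t₁ t₁∈ (λ eq → t₁∉C (subst (_∈ C) (sym eq) (W⊆C r₁∈))) dir₁ refl (proj₂ lx₁)
      y-linked-without-r (inj₂ refl) dir₁ dir₂ lx₁ lx₂ = (exit-y₁ s≢ out , en) , (out , entry-y₂ s≢ en)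
        where
        s≢ = EdgeFacts.r₁≢s-edge (reflect c) ∘ sym
        en = entry-y₁ r₁≢r₂-edge
        out = exit-via (rev t₂) t₂∈ (λ eq → Facts.t₁∉C (reflect c) (subst (_∈ C) (sym eq) (W⊆C r₂∈))) dir₂ refl
                (subst Exit (sym (head-rev G t₂)) (proj₁ lx₂))

      -- Without `s` it is y₁ that lacks an exit and y₂ that lacks an entry, so x₁y₁ and x₂y₂ are
      -- required in the directions opposite to those for `r₁` and `r₂`.
      y-linked-without-s : e ≡ edge s → Directed o (rev t₁) → Directed o t₂ →
                           Linked x₁ → Linked x₂ → Linked y₁ × Linked y₂
      y-linked-without-s refl dir₁ dir₂ lx₁ lx₂ =
        ( exit-via (rev t₁) t₁∈ (λ eq → t₁∉C (subst (_∈ C) (sym eq) s∈C)) dir₁ refl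
            (subst Exit (sym (head-rev G t₁)) (proj₁ lx₁))
        , entry-y₁ r₁≢s-edge)
        , (exit-y₂ (EdgeFacts.r₁≢s-edge (reflect c))
        , entry-via t₂ t₂∈ (λ eq → Facts.t₁∉C (reflect c) (subst (_∈ C) (sym eq) s∈C)) dir₂ refl (proj₂ lx₂))

    -- If `a` carries flow out of `x₁`, it was the exit, and x₁ → y₁ takes over; if it carries flow
    -- in, it was the entry, and y₁ → x₁ takes over. The other edge `b` keeps its role.
    x₁-linked-without : ∀ a b → (a ≡ p₁ × b ≡ q₁) ⊎ (a ≡ q₁ × b ≡ p₁) → e ≡ edge a →
                        (0ℤ ℤ.< φ a × Directed o t₁) ⊎ (0ℤ ℤ.< φ (rev a) × Directed o (rev t₁)) →
                        Linked y₁ → Linked x₁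
    x₁-linked-without a b ab refl dir ly₁ = go dir
      where
      facts : (a ≡ p₁ × b ≡ q₁) ⊎ (a ≡ q₁ × b ≡ p₁) →
              edge a ∈ C × edge b ∈ C × tail G b ≡ x₁ × OffPath (head G b) × edge b ≢ edge a × φ (rev a) ≡ φ b
      facts (inj₁ (refl , refl)) = N₁⊆C p₁∈ , N₁⊆C q₁∈ , tail-q₁ , q₁-off , p₁≢q₁-edge ∘ sym , along-x₁
      facts (inj₂ (refl , refl)) = N₁⊆C q₁∈ , N₁⊆C p₁∈ , tail-p₁ , p₁-off , p₁≢q₁-edge , anti′ along-x₁
      a∈ = proj₁ (facts ab)
      b∈ = proj₁ (proj₂ (facts ab))
      tail-b = proj₁ (proj₂ (proj₂ (facts ab)))
      off-b = proj₁ (proj₂ (proj₂ (proj₂ (facts ab))))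
      b≢a = proj₁ (proj₂ (proj₂ (proj₂ (proj₂ (facts ab)))))
      along = proj₂ (proj₂ (proj₂ (proj₂ (proj₂ (facts ab)))))
      t₁≢a : edge t₁ ≢ edge a
      t₁≢a eq = t₁∉C (subst (_∈ C) (sym eq) a∈)
      go : _ → Linked x₁
      go (inj₁ (pos , dir)) =
        exit-via t₁ t₁∈ t₁≢a dir refl (proj₁ ly₁) ,
        entry-at b b∈ tail-b off-b (subst (0ℤ ℤ.<_) (sym (anti′ along)) pos) b≢a
      go (inj₂ (pos , dir)) =
        exit-at b b∈ tail-b off-b (subst (0ℤ ℤ.<_) along pos) b≢a ,
        entry-via (rev t₁) t₁∈ t₁≢a dir (head-rev G t₁) (proj₂ ly₁)

-- Values of the two combined flows

data Values (x y : ℤ) : Set where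
  C-only : IsUnit x → y ≡ 0ℤ → Values x y
  A-only : x ≡ 0ℤ → IsUnit y → Values x y
  both   : IsUnit x → IsUnit y → Values x y

-2ℤ 2ℤ : ℤ
-2ℤ = ℤ.-[1+ 1 ]
2ℤ  = ℤ.+ 2

flow₁ flow₂ : (Dart m → ℤ) → (Dart m → ℤ) → Dart m → ℤ
flow₁ = combine 1ℤ -2ℤ
flow₂ = combine 2ℤ 1ℤ

value₁ value₂ : ℤ → ℤ → ℤ
value₁ x y = 1ℤ ℤ.* x ℤ.+ -2ℤ ℤ.* y
value₂ x y = 2ℤ ℤ.* x ℤ.+ 1ℤ ℤ.* y

value₁≢0 : ∀ {x y} → Values x y → value₁ x y ≢ 0ℤ
value₁≢0 (C-only (inj₁ refl) refl) ()
value₁≢0 (C-only (inj₂ refl) refl) ()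
value₁≢0 (A-only refl (inj₁ refl)) ()
value₁≢0 (A-only refl (inj₂ refl)) ()
value₁≢0 (both (inj₁ refl) (inj₁ refl)) ()
value₁≢0 (both (inj₁ refl) (inj₂ refl)) ()
value₁≢0 (both (inj₂ refl) (inj₁ refl)) ()
value₁≢0 (both (inj₂ refl) (inj₂ refl)) ()

value₂≢0 : ∀ {x y} → Values x y → value₂ x y ≢ 0ℤ
value₂≢0 (C-only (inj₁ refl) refl) ()
value₂≢0 (C-only (inj₂ refl) refl) ()
value₂≢0 (A-only refl (inj₁ refl)) ()
value₂≢0 (A-only refl (inj₂ refl)) ()
value₂≢0 (both (inj₁ refl) (inj₁ refl)) ()
value₂≢0 (both (inj₁ refl) (inj₂ refl)) ()
value₂≢0 (both (inj₂ refl) (inj₁ refl)) ()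
value₂≢0 (both (inj₂ refl) (inj₂ refl)) ()

-- In the mixed case y = x gives the values -x and 3x, and y = -x gives 3x and x.
some-value-unit : ∀ {x y} → Values x y → ℤ.∣ value₁ x y ∣ ≡ 1 ⊎ ℤ.∣ value₂ x y ∣ ≡ 1
some-value-unit (C-only (inj₁ refl) refl) = inj₁ refl
some-value-unit (C-only (inj₂ refl) refl) = inj₁ refl
some-value-unit (A-only refl (inj₁ refl)) = inj₂ refl
some-value-unit (A-only refl (inj₂ refl)) = inj₂ refl
some-value-unit (both (inj₁ refl) (inj₁ refl)) = inj₁ refl
some-value-unit (both (inj₁ refl) (inj₂ refl)) = inj₂ refl
some-value-unit (both (inj₂ refl) (inj₁ refl)) = inj₂ refl
some-value-unit (both (inj₂ refl) (inj₂ refl)) = inj₁ refl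

-- Without `y` the value is the even number 2x.
value₂-unit⇒A : ∀ {x y} → Values x y → ℤ.∣ value₂ x y ∣ ≡ 1 → y ≢ 0ℤ
value₂-unit⇒A (C-only (inj₁ refl) refl) ()
value₂-unit⇒A (C-only (inj₂ refl) refl) ()
value₂-unit⇒A (A-only refl (inj₁ refl)) _ ()
value₂-unit⇒A (A-only refl (inj₂ refl)) _ ()
value₂-unit⇒A (both _ (inj₁ refl)) _ ()
value₂-unit⇒A (both _ (inj₂ refl)) _ ()

value₁-C : ∀ {x y} → IsUnit x → y ≡ 0ℤ → ℤ.∣ value₁ x y ∣ ≡ 1
value₁-C (inj₁ refl) refl = refl
value₁-C (inj₂ refl) refl = refl

value₂-C : ∀ {x y} → IsUnit x → y ≡ 0ℤ → ℤ.∣ value₂ x y ∣ ≡ 2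
value₂-C (inj₁ refl) refl = refl
value₂-C (inj₂ refl) refl = refl

value₂-equal : ∀ {x y} → IsUnit x → x ≡ y → ℤ.∣ value₂ x y ∣ ≡ 3
value₂-equal (inj₁ refl) refl = refl
value₂-equal (inj₂ refl) refl = refl

-- The unit flows on the 2-factor and on the matching with the rest of F

module Flows {G : Graph n m} (c : Configuration G) {M : Subset m}
  (maximum : MaximumMatching G (deleteVertices G (Configuration.C c) (PerfectMatching.path-vertices c)) M)
  (o₁ o₂ : Orientation m) where

  open Configuration c
  open Facts c
  open PerfectMatching c using (M⊆C; M-off; M-degree; OffPath?; C-TwoRegular)
  private module Reflected = Facts (reflect c)

  F = E G ─ C

  A : Subset m
  A = (F ─ (⁅ edge t₁ ⁆ ∪ ⁅ edge t₂ ⁆)) ∪ M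

  M⊆A : M ⊆ A
  M⊆A e∈ = x∈p∪q⁺ (inj₂ e∈)

  F-in-A : ∀ {e} → e ∈ E G → e ∉ C → e ≢ edge t₁ → e ≢ edge t₂ → e ∈ A
  F-in-A {e} e∈ e∉ ≢t₁ ≢t₂ = x∈p∪q⁺ (inj₁ (x∈p∧x∉q⇒x∈p─q (x∈p∧x∉q⇒x∈p─q e∈ e∉) λ e∈t →
    [ (λ p → ≢t₁ (x∈⁅y⁆⇒x≡y (edge t₁) p)) , (λ p → ≢t₂ (x∈⁅y⁆⇒x≡y (edge t₂) p)) ]′ (x∈p∪q⁻ _ _ e∈t)))

  A-cases : ∀ {e} → e ∈ A → (e ∈ E G × e ∉ C × e ≢ edge t₁ × e ≢ edge t₂) ⊎ e ∈ M
  A-cases {e} e∈ with x∈p∪q⁻ (F ─ (⁅ edge t₁ ⁆ ∪ ⁅ edge t₂ ⁆)) M e∈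
  ... | inj₂ e∈M = inj₂ e∈M
  ... | inj₁ e∈F = inj₁
    ( p─q⊆p (E G) C (p─q⊆p F _ e∈F) , ─-∉ (E G) C (p─q⊆p F _ e∈F)
    , (λ { refl → ─-∉ F _ e∈F (x∈p∪q⁺ (inj₁ (x∈⁅x⁆ _))) })
    , (λ { refl → ─-∉ F _ e∈F (x∈p∪q⁺ {p = ⁅ edge t₁ ⁆} (inj₂ (x∈⁅x⁆ _))) }))

  A⊆E : A ⊆ E G
  A⊆E e∈ = [ proj₁ , (λ e∈M → C⊆E (M⊆C maximum e∈M)) ]′ (A-cases e∈)

  A-off : ∀ d → edge d ∈ A → OffPath (tail G d)
  A-off d d∈ with A-cases d∈
  ... | inj₂ d∈M = M-off maximum d d∈M
  ... | inj₁ (d∈E , d∉C , ≢t₁ , ≢t₂) =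
      (λ eq → ≢t₁ (cong edge (F-one {d = d} {t₁} (d∈E , eq) d∉C (t₁∈ , refl) t₁∉C)))
    , (λ eq → ≢t₁ (cong edge (F-one {d = d} {rev t₁} (d∈E , eq) d∉C (t₁∈ , refl) t₁∉C)))
    , (λ eq → ≢t₂ (cong edge (F-one {d = d} {t₂} (d∈E , eq) d∉C (t₂∈ , refl) Reflected.t₁∉C)))
    , (λ eq → ≢t₂ (cong edge (F-one {d = d} {rev t₂} (d∈E , eq) d∉C (t₂∈ , refl) Reflected.t₁∉C)))

  off-≢t : ∀ d → OffPath (tail G d) → edge d ≢ edge t₁ × edge d ≢ edge t₂
  off-≢t d (≢x₁ , ≢y₁ , ≢x₂ , ≢y₂) =
      (λ eq → [ (λ d≡ → ≢x₁ (cong (tail G) d≡)) , (λ d≡ → ≢y₁ (cong (tail G) d≡)) ]′ (same-edge t₁ d (sym eq)))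
    , (λ eq → [ (λ d≡ → ≢x₂ (cong (tail G) d≡)) , (λ d≡ → ≢y₂ (cong (tail G) d≡)) ]′ (same-edge t₂ d (sym eq)))

  A-degree : ∀ {v} → v ∈ V G → OffPath v → degree G A v ≡ 2
  A-degree {v} v∈ off = trans (degree-∑ G A v) (trans
    (ℕ∑.∑-split (At? G A v) (λ d → edge d ∈? C) (λ _ → 1)) (cong₂ _+_
      (trans (ℕ∑.∑-cong (λ d → At? G A v d ×-dec (edge d ∈? C)) (At? G M v)
        (λ { d ((d∈ , t) , d∈C) → [ (λ (_ , d∉ , _) → contradiction d∈C d∉) , (λ d∈M → d∈M , t) ]′ (A-cases d∈) })
        (λ { d (d∈ , t) → (M⊆A d∈ , t) , M⊆C maximum d∈ }) (λ _ _ → refl))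
        (trans (sym (degree-∑ G M v)) (M-degree maximum v∈ off)))
      (trans (ℕ∑.∑-cong (λ d → At? G A v d ×-dec ¬? (edge d ∈? C)) (At? G F v)
        (λ { d ((d∈ , t) , d∉C) → x∈p∧x∉q⇒x∈p─q (A⊆E d∈) d∉C , t })
        (λ { d (d∈ , refl) → let (≢t₁ , ≢t₂) = off-≢t d off ; d∉ = ─-∉ (E G) C d∈ in
             (F-in-A (p─q⊆p (E G) C d∈) d∉ ≢t₁ ≢t₂ , refl) , d∉ })
        (λ _ _ → refl))
        (trans (sym (degree-∑ G F v)) (F-degree v∈)))))

  A-TwoRegular : TwoRegular G A
  A-TwoRegular v with OffPath? v
  ... | yes (v∈ , off) = inj₂ (A-degree v∈ off)
  ... | no h = inj₁ (trans (degree-∑ G A v) (ℕ∑.∑-𝟘 (At? G A v) _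
    (λ { d (d∈ , refl) → contradiction (tail∈V G d (A⊆E d∈) , A-off d d∈) h })))

  f g : Dart m → ℤ
  f = unit C o₂
  g = unit A o₁

  values : ∀ d → edge d ∈ E G → edge d ≢ edge t₁ → edge d ≢ edge t₂ → Values (f d) (g d)
  values d d∈ ≢t₁ ≢t₂ = by-cases (edge d ∈? C) (edge d ∈? A)
    where
    by-cases : Dec (edge d ∈ C) → Dec (edge d ∈ A) → Values (f d) (g d)
    by-cases (yes d∈C) (yes d∈A) = both (unit-IsUnit C o₂ d d∈C) (unit-IsUnit A o₁ d d∈A)
    by-cases (yes d∈C) (no d∉A)  = C-only (unit-IsUnit C o₂ d d∈C) (unit-zero A o₁ d d∉A)
    by-cases (no d∉C)  (yes d∈A) = A-only (unit-zero C o₂ d d∉C) (unit-IsUnit A o₁ d d∈A)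
    by-cases (no d∉C)  (no d∉A)  = contradiction (F-in-A d∈ d∉C ≢t₁ ≢t₂) d∉A

  f-path : ∀ d → edge d ∈ C → IsUnit (f d)
  f-path d d∈ = unit-IsUnit C o₂ d d∈

  g-path : ∀ d → ¬ OffPath (tail G d) → g d ≡ 0ℤ
  g-path d on = unit-zero A o₁ d λ d∈ → on (A-off d d∈)

  g-path′ : ∀ d → ¬ OffPath (tail G d) → g (rev d) ≡ 0ℤ
  g-path′ d on = trans (unit-rev A o₁ d) (cong ℤ.-_ (g-path d on))

  x₁-on : ∀ {v} → v ≡ x₁ → ¬ OffPath v
  x₁-on refl (h , _) = h refl
  y₁-on : ∀ {v} → v ≡ y₁ → ¬ OffPath v
  y₁-on refl (_ , h , _) = h refl
  x₂-on : ∀ {v} → v ≡ x₂ → ¬ OffPath v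
  x₂-on refl (_ , _ , h , _) = h refl
  y₂-on : ∀ {v} → v ≡ y₂ → ¬ OffPath v
  y₂-on refl (_ , _ , _ , h) = h refl

  module _ (smooth-C : SmoothOn G C o₂) where

    f-flow : IsFlow G f
    f-flow = unit-flow G C C⊆E C-TwoRegular o₂ smooth-C

    f-through : ∀ {v a b} → a ≢ b → At G C v a → At G C v b → f (rev a) ≡ f b
    f-through {v} {a} {b} a≢b a-at b-at = trans (unit-rev C o₂ a)
      (trans (sym (ℤ.+-identityʳ _)) (trans (cong (λ z → ℤ.- f a ℤ.+ z) (sym total)) (cancel (f a) (f b))))
      where
      cancel : ∀ x y → ℤ.- x ℤ.+ (x ℤ.+ y) ≡ y
      cancel = ℤ-Solver.solve-∀
      total : f a ℤ.+ f b ≡ 0ℤ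
      total = trans (sym (cong₂ ℤ._+_
          (ℤ∑.∑-single (λ d → At? G C v d ×-dec (d ≟ᵈ a)) f (a-at , refl) (λ _ → proj₂))
          (ℤ∑.∑-single (λ d → At? G C v d ×-dec ¬? (d ≟ᵈ a)) f (b-at , a≢b ∘ sym)
            (λ d (d-at , d≢a) → [ (λ d≡a → contradiction d≡a d≢a) , id ]′ (C-two {a = a} {b} {d} a≢b a-at b-at d-at)))))
        (trans (sym (ℤ∑.∑-split (At? G C v) (_≟ᵈ a) f))
          (unit-conserved G C C⊆E C-TwoRegular o₂ smooth-C v))

    path-flow : (α β : ℤ) → (∀ {x y} → Values x y → α ℤ.* x ℤ.+ β ℤ.* y ≢ 0ℤ) → PathFlow c (combine α β f g)
    path-flow α β nonzero = record
      { anti = λ d → trans (cong₂ (λ x y → α ℤ.* x ℤ.+ β ℤ.* y) (unit-rev C o₂ d) (unit-rev A o₁ d))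
                           (neg-combine α β (f d) (g d))
      ; along-x₁ = equal (rev p₁) q₁ (f-through {a = p₁} {q₁} (p₁≢q₁ ∘ cong (head G)) p₁-at q₁-at)
                     (g-path′ p₁ (x₁-on tail-p₁)) (g-path q₁ (x₁-on tail-q₁))
      ; along-x₂ = equal (rev p₂) q₂ (f-through {a = p₂} {q₂} (p₂≢q₂ ∘ cong (head G)) Reflected.p₁-at Reflected.q₁-at)
                     (g-path′ p₂ (x₂-on tail-p₂)) (g-path q₂ (x₂-on tail-q₂))
      ; along-y₁ = equal (rev r₁) s (f-through {a = r₁} {s} (r₁≢s ∘ cong (head G)) r₁-at s-at)
                     (g-path′ r₁ (y₁-on tail-r₁)) (g-path s (y₁-on tail-s))
      ; along-y₂ = equal s r₂ (trans (cong f (sym (rev-rev s)))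
                       (f-through {a = rev s} {r₂} (λ eq → Reflected.r₁≢s (cong (head G) (sym eq))) Reflected.s-at Reflected.r₁-at))
                     (g-path s (y₁-on tail-s)) (g-path r₂ (y₂-on tail-r₂))
      ; p₁≢0 = nonzero (C-only (f-path p₁ (N₁⊆C p₁∈)) (g-path p₁ (x₁-on tail-p₁)))
      ; p₂≢0 = nonzero (C-only (f-path p₂ (N₂⊆C p₂∈)) (g-path p₂ (x₂-on tail-p₂)))
      ; s≢0  = nonzero (C-only (f-path s s∈C) (g-path s (y₁-on tail-s)))
      }
      where
      equal : ∀ d d′ → f d ≡ f d′ → g d ≡ 0ℤ → g d′ ≡ 0ℤ → combine α β f g d ≡ combine α β f g d′
      equal _ _ p q r = cong₂ (λ x y → α ℤ.* x ℤ.+ β ℤ.* y) p (trans q (sym r))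

  g-flow : SmoothOn G A o₁ → IsFlow G g
  g-flow smooth-A = unit-flow G A A⊆E A-TwoRegular o₁ smooth-A

-- Deletable edges of the smoothed graph

∣-∣ : (P : Subset n) {x : Fin n} → x ∈ P → ∣ P ∣ ≡ suc ∣ P - x ∣
∣-∣ P {x} x∈ = trans (∣∣-∑1 P) (trans (ℕ∑.∑-split (_∈? P) (_≟ x) (λ _ → 1)) (cong₂ _+_
  (ℕ∑.∑-single (λ i → (i ∈? P) ×-dec (i ≟ x)) (λ _ → 1) (x∈ , refl) (λ _ → proj₂))
  (trans (ℕ∑.∑-cong (λ i → (i ∈? P) ×-dec ¬? (i ≟ x)) (_∈? (P - x))
    (λ _ (i∈ , i≢) → x∈p∧x≢y⇒x∈p-y i∈ i≢) (λ _ i∈ → ∈- P i∈) (λ _ _ → refl))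
    (sym (∣∣-∑1 (P - x))))))

0<∣∣⇒Nonempty : (P : Subset n) → 0 < ∣ P ∣ → Nonempty P
0<∣∣⇒Nonempty P h = ∑1-nonempty (_∈? P) (subst (1 ≤_) (∣∣-∑1 P) h)

size-one : (P : Subset n) → ∣ P ∣ ≡ 1 → ∀ {x y} → x ∈ P → y ∈ P → x ≡ y
size-one P one {x} {y} x∈ y∈ = decidable-stable (x ≟ y) λ x≢y →
  ℕ.<-irrefl (sym (ℕ.suc-injective (trans (sym (∣-∣ P x∈)) one)))
    (Nonempty⇒0<∣∣ (y , x∈p∧x≢y⇒x∈p-y y∈ (x≢y ∘ sym)))

size-three : (P : Subset n) → ∣ P ∣ ≡ 3 → ∀ {x} → x ∈ P →
             ∃₂ λ a b → a ∈ P × b ∈ P × a ≢ x × b ≢ x × P ≡ ⁅ x ⁆ ∪ ⁅ a ⁆ ∪ ⁅ b ⁆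
size-three P three {x} x∈ = a , b , a∈P , b∈P , a≢x , b≢x , ⊆-antisym sub sup
  where
  two : ∣ P - x ∣ ≡ 2
  two = ℕ.suc-injective (trans (sym (∣-∣ P x∈)) three)
  first = 0<∣∣⇒Nonempty (P - x) (subst (0 <_) (sym two) (s≤s z≤n))
  a = proj₁ first
  one : ∣ P - x - a ∣ ≡ 1
  one = ℕ.suc-injective (trans (sym (∣-∣ (P - x) (proj₂ first))) two)
  second = 0<∣∣⇒Nonempty (P - x - a) (subst (0 <_) (sym one) (s≤s z≤n))
  b = proj₁ second
  a∈P = proj₁ (∈- P (proj₂ first))
  a≢x = proj₂ (∈- P (proj₂ first))
  b∈P-x = proj₁ (∈- (P - x) (proj₂ second))
  b∈P = proj₁ (∈- P b∈P-x)
  b≢x = proj₂ (∈- P b∈P-x)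
  sub : P ⊆ ⁅ x ⁆ ∪ ⁅ a ⁆ ∪ ⁅ b ⁆
  sub {z} z∈ = by-cases (z ≟ x) (z ≟ a)
    where
    by-cases : Dec (z ≡ x) → Dec (z ≡ a) → z ∈ ⁅ x ⁆ ∪ ⁅ a ⁆ ∪ ⁅ b ⁆
    by-cases (yes z≡x) _ = x∈p∪q⁺ (inj₁ (subst (_∈ ⁅ x ⁆) (sym z≡x) (x∈⁅x⁆ x)))
    by-cases (no _) (yes z≡a) =
      x∈p∪q⁺ {p = ⁅ x ⁆} (inj₂ (x∈p∪q⁺ (inj₁ (subst (_∈ ⁅ a ⁆) (sym z≡a) (x∈⁅x⁆ a)))))
    by-cases (no z≢x) (no z≢a) = x∈p∪q⁺ {p = ⁅ x ⁆} (inj₂ (x∈p∪q⁺ {p = ⁅ a ⁆} (inj₂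
      (subst (_∈ ⁅ b ⁆) (size-one (P - x - a) one (proj₂ second)
        (x∈p∧x≢y⇒x∈p-y (x∈p∧x≢y⇒x∈p-y z∈ z≢x) z≢a)) (x∈⁅x⁆ b)))))
  sup : ⁅ x ⁆ ∪ ⁅ a ⁆ ∪ ⁅ b ⁆ ⊆ P
  sup z∈ = case x∈p∪q⁻ ⁅ x ⁆ _ z∈ of λ
    { (inj₁ p) → subst (_∈ P) (sym (x∈⁅y⁆⇒x≡y x p)) x∈
    ; (inj₂ z∈) → case x∈p∪q⁻ ⁅ a ⁆ _ z∈ of λ
      { (inj₁ p) → subst (_∈ P) (sym (x∈⁅y⁆⇒x≡y a p)) a∈P
      ; (inj₂ p) → subst (_∈ P) (sym (x∈⁅y⁆⇒x≡y b p)) b∈P } }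

not-both : ∀ {x} → 0ℤ ℤ.< x → ¬ 0ℤ ℤ.< ℤ.- x
not-both {ℤ.+ zero}  (ℤ.+<+ ()) _
not-both {ℤ.+ suc n} _ ()

if-true : ∀ {b x y : Bool} → b ≡ true → (if b then x else y) ≡ x
if-true refl = refl

if-false : ∀ {b x y : Bool} → b ≡ false → (if b then x else y) ≡ y
if-false refl = refl

∉-single : {e f : Fin m} → e ≢ f → e List.∉ (f ∷ [])
∉-single e≢f (here eq) = e≢f eq

-- With y = 0 the two values are x and 2x; hence both orientations direct the replaced paths alike.
positive-transfer : ∀ {x y} → IsUnit x → y ≡ 0ℤ → 0ℤ ℤ.< value₁ x y → 0ℤ ℤ.< value₂ x y
positive-transfer (inj₁ refl) refl _ = ℤ.+<+ (s≤s z≤n)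
positive-transfer (inj₂ refl) refl ()

module Core {G : Graph n m} (c : Configuration G) {M : Subset m}
  (maximum : MaximumMatching G (deleteVertices G (Configuration.C c) (PerfectMatching.path-vertices c)) M)
  (o₁ o₂ : Orientation m)
  (smooth-A : SmoothOn G (Flows.A c maximum o₁ o₂) o₁) (smooth-C : SmoothOn G (Configuration.C c) o₂)
  {G₁ : Graph n (2 + m)}
  (T₁ : Tilde G (edge (Configuration.t₁ c)) G₁ (Configuration.x₁ c) (Configuration.y₁ c)
          (Configuration.p₁ c) (Configuration.q₁ c) (Configuration.r₁ c) (Configuration.s c))
  {H : Graph n (4 + m)}
  (T₂ : Tilde G₁ (Smoothings.Reduced.e₂ c T₁) H (Configuration.x₂ c) (Configuration.y₂ c)
          (suc-dart (suc-dart (Configuration.p₂ c))) (suc-dart (suc-dart (Configuration.q₂ c)))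
          (suc-dart (suc-dart (Configuration.r₂ c))) (rev (Tilde.β T₁)))
  where

  open Configuration c
  open Facts c
  open Flows c maximum o₁ o₂
  open Smoothings.Reduced.Final c T₁ T₂
  private module Reflected = Facts (reflect c)
  open Reduction reduction using (R-tail; R-edge; R-inj; R-surj)

  -- The darts from u₁, v₁, u₂, v₂, w₁, w₂ into the path, which are the values of `R` on the darts
  -- of the new edges.
  data PathDart : Dart m → Set where
    via-p₁ : PathDart (rev p₁)
    via-q₁ : PathDart (rev q₁)
    via-p₂ : PathDart (rev p₂)
    via-q₂ : PathDart (rev q₂)
    via-r₁ : PathDart (rev r₁)
    via-r₂ : PathDart (rev r₂)

  data NewDart : Dart (4 + m) → Set where
    forth₁ : NewDart new₁
    back₁  : NewDart (rev new₁)
    forth₂ : NewDart new₂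
    back₂  : NewDart (rev new₂)
    forth₃ : NewDart new₃
    back₃  : NewDart (rev new₃)

  new-dart : ∀ d → NewEdge (edge d) → NewDart d
  new-dart d (inj₁ eq) with same-edge new₁ d (sym eq)
  ... | inj₁ refl = forth₁
  ... | inj₂ refl = back₁
  new-dart d (inj₂ (inj₁ eq)) with same-edge new₂ d (sym eq)
  ... | inj₁ refl = forth₂
  ... | inj₂ refl = back₂
  new-dart d (inj₂ (inj₂ eq)) with same-edge new₃ d (sym eq)
  ... | inj₁ refl = forth₃
  ... | inj₂ refl = back₃

  R-new : ∀ {d} → NewDart d → PathDart (R d)
  R-new forth₁ = subst PathDart (sym R-new₁) via-p₁
  R-new back₁  = subst PathDart (sym R-new₁′) via-q₁
  R-new forth₂ = subst PathDart (sym R-new₂) via-p₂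
  R-new back₂  = subst PathDart (sym R-new₂′) via-q₂
  R-new forth₃ = subst PathDart (sym R-new₃) via-r₂
  R-new back₃  = subst PathDart (sym R-new₃′) via-r₁

  path-C : ∀ {d} → PathDart d → edge d ∈ C
  path-C via-p₁ = N₁⊆C p₁∈
  path-C via-q₁ = N₁⊆C q₁∈
  path-C via-p₂ = N₂⊆C p₂∈
  path-C via-q₂ = N₂⊆C q₂∈
  path-C via-r₁ = W⊆C r₁∈
  path-C via-r₂ = W⊆C r₂∈

  path-on : ∀ {d} → PathDart d → ¬ OffPath (head G d)
  path-on via-p₁ = x₁-on (trans (head-rev G p₁) tail-p₁)
  path-on via-q₁ = x₁-on (trans (head-rev G q₁) tail-q₁)
  path-on via-p₂ = x₂-on (trans (head-rev G p₂) tail-p₂)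
  path-on via-q₂ = x₂-on (trans (head-rev G q₂) tail-q₂)
  path-on via-r₁ = y₁-on (trans (head-rev G r₁) tail-r₁)
  path-on via-r₂ = y₂-on (trans (head-rev G r₂) tail-r₂)

  path-f : ∀ {d} → PathDart d → IsUnit (f d)
  path-f {d} p = f-path d (path-C p)

  path-g : ∀ {d} → PathDart d → g d ≡ 0ℤ
  path-g {d} p = unit-zero A o₁ d λ d∈ → path-on p (A-off (rev d) d∈)

  C-≢t : ∀ {e} → e ∈ C → e ≢ edge t₁ × e ≢ edge t₂
  C-≢t e∈ = (λ { refl → t₁∉C e∈ }) , (λ { refl → Reflected.t₁∉C e∈ })

  R-≢t : ∀ d → edge d ∈ E H → edge (R d) ≢ edge t₁ × edge (R d) ≢ edge t₂
  R-≢t d d∈ with view d d∈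
  ... | new e = C-≢t (path-C (R-new (new-dart d e)))
  ... | old d₀ _ off = subst (λ a → edge a ≢ edge t₁ × edge a ≢ edge t₂) (sym (R-old d₀)) (off-≢t d₀ (off (proj₂ d₀)))

  values-H : ∀ d → edge d ∈ E H → Values (f (R d)) (g (R d))
  values-H d d∈ = let (≢t₁ , ≢t₂) = R-≢t d d∈ in values (R d) (R-edge d d∈) ≢t₁ ≢t₂

  -- On a new edge `R` does not commute with reversal: `R (rev d)` enters the replaced path from its
  -- other end. The values are opposite because the flow is constant along that path.
  antisymmetric-H : ∀ {φ} → PathFlow c φ → ∀ d → edge d ∈ E H → φ (R (rev d)) ≡ ℤ.- φ (R d)
  antisymmetric-H {φ} pf d d∈ with view d d∈
  ... | old d₀ _ _ = trans (cong φ (R-old (rev d₀))) (trans (anti d₀) (cong (λ a → ℤ.- φ a) (sym (R-old d₀))))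
    where open PathFlow pf
  ... | new e = by-cases (new-dart d e)
    where
    open PathFlow pf
    forth : ∀ d {a b} → R d ≡ rev a → R (rev d) ≡ rev b → φ (rev a) ≡ φ b → φ (R (rev d)) ≡ ℤ.- φ (R d)
    forth d {a} {b} p q eq = trans (cong φ q) (trans (anti b) (cong ℤ.-_ (sym (trans (cong φ p) eq))))
    back : ∀ d {a b} → R d ≡ rev a → R (rev d) ≡ rev b → φ (rev a) ≡ φ b → φ (R (rev (rev d))) ≡ ℤ.- φ (R (rev d))
    back d p q eq = trans (cong (φ ∘ R) (rev-rev d)) (trans (sym (ℤ.neg-involutive (φ (R d))))
      (cong ℤ.-_ (sym (forth d p q eq))))
    r₂-r₁ : φ (rev r₂) ≡ φ r₁
    r₂-r₁ = trans (PathFlow.along-y₁ (reflect-flow pf)) (anti′ along-y₁)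
    by-cases : ∀ {d} → NewDart d → φ (R (rev d)) ≡ ℤ.- φ (R d)
    by-cases forth₁ = forth new₁ R-new₁ R-new₁′ along-x₁
    by-cases back₁  = back new₁ R-new₁ R-new₁′ along-x₁
    by-cases forth₂ = forth new₂ R-new₂ R-new₂′ along-x₂
    by-cases back₂  = back new₂ R-new₂ R-new₂′ along-x₂
    by-cases forth₃ = forth new₃ R-new₃ R-new₃′ r₂-r₁
    by-cases back₃  = back new₃ R-new₃ R-new₃′ r₂-r₁

  into-At : ∀ {v} d → At H (E H) v d → At G (E G) v (R d)
  into-At d (d∈ , t) = R-edge d d∈ , trans (R-tail d d∈) t

  onto-At : ∀ {v} → OffPath v → ∀ d → At G (E G) v d → ∃[ d′ ] At H (E H) v d′ × R d′ ≡ d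
  onto-At off d (d∈ , refl) = let (d′ , d′∈ , eq) = R-surj d d∈ off in
    d′ , (d′∈ , trans (sym (R-tail d′ d′∈)) (cong (tail G) eq)) , eq

  -- At a vertex off the path `R` is a bijection between the darts of `H` and those of `G`, so
  -- conservation carries over term by term.
  flow-H : ∀ {φ} → IsFlow G φ → PathFlow c φ → IsFlow H (φ ∘ R)
  flow-H {φ} flow pf = record
    { antisymmetric = antisymmetric-H pf
    ; conserved     = λ v v∈ → let (v∈G , off) = V-H v∈ in trans
        (ℤ∑.∑-reindex (At? G (E G) v) (At? H (E H) v) _≟ᵈ_ R φ into-At
          (λ d d′ (d∈ , _) (d′∈ , _) → R-inj d d′ d∈ d′∈) (onto-At off))
        (IsFlow.conserved flow v v∈G)
    }

  cubic-H : Cubic H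
  cubic-H v v∈ = let (v∈G , off) = V-H v∈ in trans (degree-∑ H (E H) v) (trans
    (ℕ∑.∑-reindex (At? G (E G) v) (At? H (E H) v) _≟ᵈ_ R (λ _ → 1) into-At
      (λ d d′ (d∈ , _) (d′∈ , _) → R-inj d d′ d∈ d′∈) (onto-At off))
    (trans (sym (degree-∑ G (E G) v)) (cubic v v∈G)))

  tail-new : ∀ d {a} → edge d ∈ E H → R d ≡ rev a → tail H d ≡ head G a
  tail-new d d∈ eq = trans (sym (R-tail d d∈)) (cong (tail G) eq)

  new-joins : ∀ {e} → NewEdge e → Joins H e (head G p₁) (head G q₁) ⊎ Joins H e (head G p₂) (head G q₂) ⊎
              Joins H e (head G r₁) (head G r₂)
  new-joins (inj₁ refl) =
    inj₁ (proj₂ new₁ , tail-new new₁ new₁∈ R-new₁ , tail-new (rev new₁) new₁∈ R-new₁′)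
  new-joins (inj₂ (inj₁ refl)) =
    inj₂ (inj₁ (proj₂ new₂ , tail-new new₂ new₂∈ R-new₂ , tail-new (rev new₂) new₂∈ R-new₂′))
  new-joins (inj₂ (inj₂ refl)) =
    inj₂ (inj₂ (not (proj₂ new₃) , tail-new (rev new₃) new₃∈ R-new₃′ ,
      trans (head-rev H new₃) (tail-new new₃ new₃∈ R-new₃)))

  φ₁ φ₂ : Dart m → ℤ
  φ₁ = flow₁ f g
  φ₂ = flow₂ f g

  pf₁ : PathFlow c φ₁
  pf₁ = path-flow smooth-C 1ℤ -2ℤ value₁≢0
  pf₂ : PathFlow c φ₂
  pf₂ = path-flow smooth-C 2ℤ 1ℤ value₂≢0

  flow₁-H : IsFlow H (φ₁ ∘ R)
  flow₁-H = flow-H (combine-flow 1ℤ -2ℤ (f-flow smooth-C) (g-flow smooth-A)) pf₁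
  flow₂-H : IsFlow H (φ₂ ∘ R)
  flow₂-H = flow-H (combine-flow 2ℤ 1ℤ (f-flow smooth-C) (g-flow smooth-A)) pf₂

  both-darts : ∀ {φ} → PathFlow c φ → ∀ d {k} → edge d ∈ E H → ℤ.∣ φ (R d) ∣ ≡ k → ∀ b → ℤ.∣ φ (R (edge d , b)) ∣ ≡ k
  both-darts {φ} pf d d∈ eq b with same-edge d (edge d , b) refl
  ... | inj₁ refl = eq
  ... | inj₂ refl = trans (cong ℤ.∣_∣ (antisymmetric-H pf d d∈)) (trans (ℤ.∣-i∣≡∣i∣ (φ (R d))) eq)

  NearPath : Fin n → Set
  NearPath v = ∃[ d ] PathDart d × tail G d ≡ v

  module _ (agree : ∀ d → edge d ∈ M → NearPath (tail G d) → f d ≡ g d)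
    (conn : CyclicallyEdgeConnected 3 H)
    (no-cut : ∀ (i : Fin 4) (f₂ f₃ : Fin m) → NewEdge (i ↑ˡ m) → f₂ ∈ A → f₃ ∈ A →
              ∣ ⁅ i ↑ˡ m ⁆ ∪ ⁅ 4 ↑ʳ f₂ ⁆ ∪ ⁅ 4 ↑ʳ f₃ ⁆ ∣ ≡ 3 →
              ¬ CycleSeparatingCut H (⁅ i ↑ˡ m ⁆ ∪ ⁅ 4 ↑ʳ f₂ ⁆ ∪ ⁅ 4 ↑ʳ f₃ ⁆))
    where

    Reachable : (Dart m → ℤ) → Fin (4 + m) → Set
    Reachable φ ℓ = ∀ u v → u ∈ V H → v ∈ V H → Star (Run H (λ d → 0ℤ ℤ.< φ (R d) × edge d ≢ ℓ)) u v

    open SmallCut H cubic-H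

    nonzero₁ : ∀ d → edge d ∈ E H → φ₁ (R d) ≢ 0ℤ
    nonzero₁ d d∈ = value₁≢0 (values-H d d∈)
    nonzero₂ : ∀ d → edge d ∈ E H → φ₂ (R d) ≢ 0ℤ
    nonzero₂ d d∈ = value₂≢0 (values-H d d∈)

    reachable₁ : ∀ d → edge d ∈ E H → ℤ.∣ φ₁ (R d) ∣ ≡ 1 → Reachable φ₁ (edge d)
    reachable₁ d d∈ one = Flow.strong-without flow₁-H nonzero₁ (cut≥3 conn) (edge d)
      (λ b → ℕ.≤-trans (ℕ.≤-reflexive (both-darts pf₁ d d∈ one b)) (s≤s z≤n))
      (λ b (_ , _ , _ , _ , _ , two , _) → case trans (sym (both-darts pf₁ d d∈ one b)) two of λ ())

    reachable₂ : ∀ d → edge d ∈ E H → ℤ.∣ φ₂ (R d) ∣ ≡ 1 → Reachable φ₂ (edge d)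
    reachable₂ d d∈ one = Flow.strong-without flow₂-H nonzero₂ (cut≥3 conn) (edge d)
      (λ b → ℕ.≤-trans (ℕ.≤-reflexive (both-darts pf₂ d d∈ one b)) (s≤s z≤n))
      (λ b (_ , _ , _ , _ , _ , two , _) → case trans (sym (both-darts pf₂ d d∈ one b)) two of λ ())

    -- The matching edge at an end of a new edge has |φ₂| = 3 because f and g agree on it.
    heavy-dart : ∀ d → edge d ∈ E H → NewDart d →
                 ∃[ z ] edge z ∈ E H × tail H z ≡ tail H d × head H z ≢ tail H d × ℤ.∣ φ₂ (R z) ∣ ≡ 3
    heavy-dart d d∈ nd = old⁴ z , z∈H , tail-z , head-z , subst (λ a → ℤ.∣ φ₂ a ∣ ≡ 3) (sym (R-old z))
        (value₂-equal (f-path z (M⊆C maximum z∈M)) (agree z z∈M near))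
      where
      open PerfectMatching c using (M⊆C; M-off; M-degree)
      end∈ : tail H d ∈ V H
      end∈ = tail∈V H d d∈
      one : degree G M (tail H d) ≡ 1
      one = M-degree maximum (proj₁ (V-H end∈)) (proj₂ (V-H end∈))
      matched = ∑1-nonempty (At? G M (tail H d)) (ℕ.≤-reflexive (trans (sym one) (degree-∑ G M (tail H d))))
      z = proj₁ matched
      z∈M = proj₁ (proj₂ matched)
      z-at = proj₂ (proj₂ matched)
      z∈H : edge (old⁴ z) ∈ E H
      z∈H = old⁴∈ (C⊆E (M⊆C maximum z∈M)) (λ b → M-off maximum (edge z , b) z∈M)
      tail-old⁴ : ∀ a → edge (old⁴ a) ∈ E H → tail H (old⁴ a) ≡ tail G a
      tail-old⁴ a a∈ = trans (sym (R-tail (old⁴ a) a∈)) (cong (tail G) (R-old a))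
      tail-z : tail H (old⁴ z) ≡ tail H d
      tail-z = trans (tail-old⁴ z z∈H) z-at
      head-z : head H (old⁴ z) ≢ tail H d
      head-z eq = rev≢ z (length≤1 (dartsAt G M (tail H d)) (ℕ.≤-reflexive one)
        (∈-dartsAt G M (tail H d) {rev z} (z∈M , trans (sym (tail-old⁴ (rev z) z∈H)) eq))
        (∈-dartsAt G M (tail H d) {z} (z∈M , z-at)))
      near : NearPath (tail G z)
      near = R d , R-new nd , trans (R-tail d d∈) (sym z-at)

    rev-new : ∀ {d} → NewDart d → NewDart (rev d)
    rev-new forth₁ = back₁
    rev-new back₁  = subst NewDart (sym (rev-rev new₁)) forth₁
    rev-new forth₂ = back₂
    rev-new back₂  = subst NewDart (sym (rev-rev new₂)) forth₂
    rev-new forth₃ = back₃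
    rev-new back₃  = subst NewDart (sym (rev-rev new₃)) forth₃

    -- If a shore is a single vertex, it is an end of `d`, and the matching edge there crosses the
    -- cut with too large a value. Otherwise the cut separates circuits, and its two other edges lie
    -- in `A`, which `no-cut` excludes.
    unblocked : ∀ d → edge d ∈ E H → NewEdge (edge d) → ¬ Flow.Blocked flow₂-H nonzero₂ d
    unblocked d d∈ ne (S , S-ne , S-ne′ , leaves@(_ , t∈ , h∉) , three , two , units) =
      go (3-cut S S-ne S-ne′ three)
      where
      nd = new-dart d ne
      -- The absolute values on the cut are 2 on `d` and 1 on the two other edges.
      too-heavy : ∀ {z} → Leaves H S z → ℤ.∣ φ₂ (R z) ∣ ≡ 3 → ⊥
      too-heavy {z} l heavy with z ≟ᵈ d
      ... | yes refl = case trans (sym two) heavy of λ ()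
      ... | no z≢d   = case trans (sym (units z l z≢d)) heavy of λ ()
      -- An edge of value ±1 in `φ₂` has `g` nonzero; new edges have value ±2, so this one is an old
      -- edge in `A`.
      light : ∀ {e} → e ∈ boundary H S → e ≢ edge d → ∃[ f₀ ] f₀ ∈ A × e ≡ 4 ↑ʳ f₀
      light {e} e∈ e≢ with boundary-Leaves H S e∈
      ... | b , l with view (e , b) (proj₁ l)
      ...   | old d₀ _ _ = edge d₀ , decidable-stable (edge d₀ ∈? A) (λ ∉A →
                value₂-unit⇒A (values-H (e , b) (proj₁ l)) (units (e , b) l (e≢ ∘ cong edge))
                  (trans (cong g (R-old d₀)) (unit-zero A o₁ d₀ ∉A))) , refl
      ...   | new e-new = contradiction
                (trans (sym (value₂-C (path-f path) (path-g path))) (units (e , b) l (e≢ ∘ cong edge))) λ ()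
        where path = R-new (new-dart (e , b) e-new)
      go : ∣ S ∩ V H ∣ ≡ 1 ⊎ ∣ ∁ S ∩ V H ∣ ≡ 1 ⊎ CycleSeparatingCut H (boundary H S) → ⊥
      go (inj₁ single) =
        let (z , z∈ , tail-z , head-z , heavy) = heavy-dart d d∈ nd in
        too-heavy (z∈ , subst (_∈ S) (sym tail-z) t∈ ,
          λ h∈ → head-z (size-one (S ∩ V H) single (x∈p∩q⁺ (h∈ , tail∈V H (rev z) z∈))
                          (x∈p∩q⁺ (t∈ , tail∈V H d d∈)))) heavy
      go (inj₂ (inj₁ single)) =
        let (z , z∈ , tail-z , head-z , heavy) = heavy-dart (rev d) d∈ (rev-new nd) in
        too-heavy {rev z} (z∈ ,
          decidable-stable (head H z ∈? S) (λ h∉S → head-z (size-one (∁ S ∩ V H) single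
            (x∈p∩q⁺ (x∉p⇒x∈∁p h∉S , tail∈V H (rev z) z∈))
            (x∈p∩q⁺ (x∉p⇒x∈∁p h∉ , tail∈V H (rev d) d∈)))) ,
          λ h∈ → h∉ (subst (_∈ S) (trans (head-rev H z) tail-z) h∈))
          (both-darts pf₂ z z∈ heavy (not (proj₂ z)))
      go (inj₂ (inj₂ separating)) =
        let (a , b , a∈ , b∈ , a≢ , b≢ , K≡) = size-three (boundary H S) size (Leaves-boundary H S d leaves)
            (f₂ , f₂∈ , a≡) = light a∈ a≢
            (f₃ , f₃∈ , b≡) = light b∈ b≢
            (i , i≡) = new-label ne
            K≡′ : boundary H S ≡ ⁅ i ↑ˡ m ⁆ ∪ ⁅ 4 ↑ʳ f₂ ⁆ ∪ ⁅ 4 ↑ʳ f₃ ⁆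
            K≡′ = trans K≡ (cong₂ (λ p q → ⁅ p ⁆ ∪ q) i≡ (cong₂ (λ p q → ⁅ p ⁆ ∪ ⁅ q ⁆) a≡ b≡))
        in no-cut i f₂ f₃ (subst NewEdge i≡ ne) f₂∈ f₃∈ (trans (cong ∣_∣ (sym K≡′)) size)
             (subst (CycleSeparatingCut H) K≡′ separating)
        where
        size : ∣ boundary H S ∣ ≡ 3
        size = trans (∣boundary∣ H S) three

    reachable₁-new : ∀ d → edge d ∈ E H → NewEdge (edge d) → Reachable φ₁ (edge d)
    reachable₁-new d d∈ ne = reachable₁ d d∈ (value₁-C (path-f path) (path-g path))
      where path = R-new (new-dart d ne)

    reachable₂-new : ∀ d → edge d ∈ E H → NewEdge (edge d) → Reachable φ₂ (edge d)
    reachable₂-new d d∈ ne = Flow.strong-without flow₂-H nonzero₂ (cut≥3 conn) (edge d)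
      (λ b → ℕ.≤-reflexive (both-darts pf₂ d d∈ (value₂-C (path-f path) (path-g path)) b))
      (λ b → unblocked (edge d , b) d∈ ne)
      where path = R-new (new-dart d ne)

    Hub : Fin n → Set
    Hub v = v ∈ V G × OffPath v

    -- `xs` lists forbidden edges. To delete one edge of a replaced path, all edges of that path are
    -- forbidden together; otherwise the predicate would not be `Coherent` and walks in `H` could
    -- not be lifted.
    Allowed : (Dart m → ℤ) → List (Fin m) → Dart m → Set
    Allowed φ xs d = 0ℤ ℤ.< φ d × edge d List.∉ xs

    SameStatus : List (Fin m) → Dart m → Dart m → Set
    SameStatus xs a b = (edge a List.∉ xs → edge b List.∉ xs) × (edge b List.∉ xs → edge a List.∉ xs)

    allowed-coherent : ∀ {φ} → PathFlow c φ → ∀ xs → SameStatus xs p₁ q₁ → SameStatus xs p₂ q₂ →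
                       SameStatus xs r₁ s → SameStatus xs s r₂ → Coherent (Allowed φ xs)
    allowed-coherent pf xs p₁q₁ p₂q₂ r₁s sr₂ = record
      { p→q₁ = λ (pos , a) → subst (0ℤ ℤ.<_) along-x₁ pos , proj₁ p₁q₁ a
      ; q→p₁ = λ (pos , a) → subst (0ℤ ℤ.<_) (anti′ along-x₁) pos , proj₂ p₁q₁ a
      ; p→q₂ = λ (pos , a) → subst (0ℤ ℤ.<_) along-x₂ pos , proj₁ p₂q₂ a
      ; q→p₂ = λ (pos , a) → subst (0ℤ ℤ.<_) (anti′ along-x₂) pos , proj₂ p₂q₂ a
      ; r→s  = λ (pos , a) → subst (0ℤ ℤ.<_) along-y₁ pos , proj₁ r₁s a
      ; s→r  = λ (pos , a) → subst (0ℤ ℤ.<_) (anti′ along-y₁) pos , proj₂ r₁s a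
      ; s→r₂ = λ (pos , a) → subst (0ℤ ℤ.<_) along-y₂ pos , proj₁ sr₂ a
      ; r→s₂ = λ (pos , a) → subst (0ℤ ℤ.<_) (PathFlow.along-y₁ (reflect-flow pf)) pos , proj₂ sr₂ a
      }
      where open PathFlow pf

    neither : ∀ {xs} a b → edge a List.∈ xs → edge b List.∈ xs → SameStatus xs a b
    neither _ _ a∈ b∈ = (λ a∉ → contradiction a∈ a∉) , (λ b∉ → contradiction b∈ b∉)

    either : ∀ {xs} a b → edge a List.∉ xs → edge b List.∉ xs → SameStatus xs a b
    either _ _ a∉ b∉ = (λ _ → b∉) , (λ _ → a∉)

    open EdgeFacts c using (apart)

    -- Treats one flow together with an orientation that follows it, to be applied to `φ₁` and to
    -- `φ₂`.
    module Side (φ : Dart m → ℤ) (pf : PathFlow c φ) (o : Orientation m)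
      (directed : ∀ d → edge d ∈ E G → 0ℤ ℤ.< φ d → Directed o d)
      (reach-new : ∀ d → edge d ∈ E H → NewEdge (edge d) → Reachable φ (edge d)) where

      open PathFlow pf

      Hubs : Fin m → Set
      Hubs e = ∀ {u v} → Hub u → Hub v → Star (Arc (G ∖ ⁅ e ⁆) o) u v

      -- Walks in `H` without the edge `ℓ` lift to walks in `G` without any edge of `xs`, provided
      -- no other edge of `H` stands for an edge of `xs`.
      lift-hubs : ∀ e xs {ℓ} → e List.∈ xs → Reachable φ ℓ → Coherent (Allowed φ xs) →
                  (∀ d → edge d ∈ E H → edge d ≢ ℓ → edge (R d) List.∉ xs) → Hubs e
      lift-hubs e xs e∈ reach coherent avoid (u∈ , u-off) (v∈ , v-off) =
        Star.map arc (lifts (Allowed φ xs) coherent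
          (Star.map (λ (d , d∈ , (pos , ≢ℓ) , t , h) → d , d∈ , (pos , avoid d d∈ ≢ℓ) , t , h)
            (reach _ _ (V-H⁺ u∈ u-off) (V-H⁺ v∈ v-off))))
        where
        arc : ∀ {u v} → Run G (Allowed φ xs) u v → Arc (G ∖ ⁅ e ⁆) o u v
        arc ((f , b) , f∈ , (pos , f∉) , t , h) with directed (f , b) f∈ pos
        ... | refl = f , x∈p∧x≢y⇒x∈p-y f∈ (λ { refl → f∉ e∈ })
                   , trans (tail-∖ G ⁅ e ⁆ (f , b)) t , trans (tail-∖ G ⁅ e ⁆ (f , not b)) h

      module Without (e : Fin m) (hubs : Hubs e) where
        open Deletion G o e Hub hubs
        module E₁ = Ears c φ pf directed (λ v∈ off → v∈ , off)
        module E₂ = Ears (reflect c) φ (reflect-flow pf) directed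
          (λ v∈ (≢x₂ , ≢y₂ , ≢x₁ , ≢y₁) → v∈ , ≢x₁ , ≢y₁ , ≢x₂ , ≢y₂)

        all-linked : Linked x₁ → Linked y₁ → Linked x₂ → Linked y₂ → Deletable G o e
        all-linked lx₁ ly₁ lx₂ ly₂ = deletable linked
          where
          linked : ∀ {v} → v ∈ V G → Linked v
          linked {v} v∈ with v ≟ x₁ | v ≟ y₁ | v ≟ x₂ | v ≟ y₂
          ... | yes refl | _ | _ | _ = lx₁
          ... | no _ | yes refl | _ | _ = ly₁
          ... | no _ | no _ | yes refl | _ = lx₂
          ... | no _ | no _ | no _ | yes refl = ly₂
          ... | no ≢x₁ | no ≢y₁ | no ≢x₂ | no ≢y₂ = hub-linked (v∈ , ≢x₁ , ≢y₁ , ≢x₂ , ≢y₂)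

        y-linked : edge r₁ ≢ e → edge r₂ ≢ e → edge s ≢ e → Linked y₁ × Linked y₂
        y-linked r₁≢ r₂≢ s≢ with pos-or-neg (anti s) s≢0
        ... | inj₁ pos = E₁.y-linked pos r₁≢ r₂≢ s≢
        ... | inj₂ pos = let (l₂ , l₁) = E₂.y-linked pos r₂≢ r₁≢ s≢ in l₁ , l₂

      module _ (e : Fin m) (p₁≢ : edge p₁ ≢ e) (q₁≢ : edge q₁ ≢ e) (p₂≢ : edge p₂ ≢ e) (q₂≢ : edge q₂ ≢ e)
        (r₁≢ : edge r₁ ≢ e) (r₂≢ : edge r₂ ≢ e) (s≢ : edge s ≢ e) where

        off-path-deletable : ∀ {ℓ} → Reachable φ ℓ →
                             (∀ d → edge d ∈ E H → edge d ≢ ℓ → edge (R d) ≢ e) → Deletable G o e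
        off-path-deletable reach avoid =
          let open Without e (lift-hubs e (e ∷ []) (here refl) reach
                (allowed-coherent pf (e ∷ []) (either p₁ q₁ (∉-single p₁≢) (∉-single q₁≢))
                  (either p₂ q₂ (∉-single p₂≢) (∉-single q₂≢)) (either r₁ s (∉-single r₁≢) (∉-single s≢))
                  (either s r₂ (∉-single s≢) (∉-single r₂≢)))
                (λ d d∈ ≢ℓ → ∉-single (avoid d d∈ ≢ℓ)))
              (ly₁ , ly₂) = y-linked r₁≢ r₂≢ s≢
          in all-linked (E₁.x₁-linked p₁≢ q₁≢) ly₁ (E₂.x₁-linked p₂≢ q₂≢) ly₂

      -- The edges of `xs` lie on one circuit `D` and touch the path. An old edge of `H` does not
      -- touch the path, and a new edge other than `ℓ` comes from a different circuit.
      avoid-path : ∀ {D} xs → (∀ {e} → e List.∈ xs → e ∈ D) → (∀ {e} → e List.∈ xs → ∃[ b ] ¬ OffPath (tail G (e , b))) →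
                   ∀ {ℓ} → (∀ d → NewDart d → edge d ≢ ℓ → edge (R d) ∉ D) →
                   ∀ d → edge d ∈ E H → edge d ≢ ℓ → edge (R d) List.∉ xs
      avoid-path xs xs⊆D xs-on sep d d∈ ≢ℓ R∈ with view d d∈
      ... | new e = sep d (new-dart d e) ≢ℓ (xs⊆D R∈)
      ... | old d₀ _ off with subst (λ a → edge a List.∈ xs) (R-old d₀) R∈
      ...   | d₀∈ = let (b , on) = xs-on d₀∈ in on (off b)

      N₁-separate : ∀ d → NewDart d → edge d ≢ edge new₁ → edge (R d) ∉ N₁
      N₁-separate _ forth₁ h = contradiction refl h
      N₁-separate _ back₁  h = contradiction refl h
      N₁-separate _ forth₂ _ = subst (λ a → edge a ∉ N₁) (sym R-new₂) (λ e∈ → apart N₁#N₂ e∈ p₂∈ refl)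
      N₁-separate _ back₂  _ = subst (λ a → edge a ∉ N₁) (sym R-new₂′) (λ e∈ → apart N₁#N₂ e∈ q₂∈ refl)
      N₁-separate _ forth₃ _ = subst (λ a → edge a ∉ N₁) (sym R-new₃) (λ e∈ → apart N₁#W e∈ r₂∈ refl)
      N₁-separate _ back₃  _ = subst (λ a → edge a ∉ N₁) (sym R-new₃′) (λ e∈ → apart N₁#W e∈ r₁∈ refl)

      N₂-separate : ∀ d → NewDart d → edge d ≢ edge new₂ → edge (R d) ∉ N₂
      N₂-separate _ forth₁ _ = subst (λ a → edge a ∉ N₂) (sym R-new₁) (λ e∈ → apart N₁#N₂ p₁∈ e∈ refl)
      N₂-separate _ back₁  _ = subst (λ a → edge a ∉ N₂) (sym R-new₁′) (λ e∈ → apart N₁#N₂ q₁∈ e∈ refl)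
      N₂-separate _ forth₂ h = contradiction refl h
      N₂-separate _ back₂  h = contradiction refl h
      N₂-separate _ forth₃ _ = subst (λ a → edge a ∉ N₂) (sym R-new₃) (λ e∈ → apart N₂#W e∈ r₂∈ refl)
      N₂-separate _ back₃  _ = subst (λ a → edge a ∉ N₂) (sym R-new₃′) (λ e∈ → apart N₂#W e∈ r₁∈ refl)

      W-separate : ∀ d → NewDart d → edge d ≢ edge new₃ → edge (R d) ∉ W
      W-separate _ forth₁ _ = subst (λ a → edge a ∉ W) (sym R-new₁) (λ e∈ → apart N₁#W p₁∈ e∈ refl)
      W-separate _ back₁  _ = subst (λ a → edge a ∉ W) (sym R-new₁′) (λ e∈ → apart N₁#W q₁∈ e∈ refl)
      W-separate _ forth₂ _ = subst (λ a → edge a ∉ W) (sym R-new₂) (λ e∈ → apart N₂#W p₂∈ e∈ refl)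
      W-separate _ back₂  _ = subst (λ a → edge a ∉ W) (sym R-new₂′) (λ e∈ → apart N₂#W q₂∈ e∈ refl)
      W-separate _ forth₃ h = contradiction refl h
      W-separate _ back₃  h = contradiction refl h

      ∉-outside : ∀ {D : Subset m} {xs e} → (∀ {f} → f List.∈ xs → f ∈ D) → e ∉ D → e List.∉ xs
      ∉-outside xs⊆D e∉ e∈ = e∉ (xs⊆D e∈)

      N₁-edges N₂-edges W-edges : List (Fin m)
      N₁-edges = edge p₁ ∷ edge q₁ ∷ []
      N₂-edges = edge p₂ ∷ edge q₂ ∷ []
      W-edges  = edge r₁ ∷ edge s ∷ edge r₂ ∷ []

      N₁-edges⊆ : ∀ {e} → e List.∈ N₁-edges → e ∈ N₁
      N₁-edges⊆ = All.lookup (p₁∈ ∷ q₁∈ ∷ [])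

      N₂-edges⊆ : ∀ {e} → e List.∈ N₂-edges → e ∈ N₂
      N₂-edges⊆ = All.lookup (p₂∈ ∷ q₂∈ ∷ [])

      W-edges⊆ : ∀ {e} → e List.∈ W-edges → e ∈ W
      W-edges⊆ = All.lookup (r₁∈ ∷ s∈W ∷ r₂∈ ∷ [])

      hubs-N₁ : ∀ {e} → e List.∈ N₁-edges → Hubs e
      hubs-N₁ {e} e∈ = lift-hubs e N₁-edges e∈ (reach-new new₁ new₁∈ (inj₁ refl))
        (allowed-coherent pf N₁-edges (neither p₁ q₁ (here refl) (there (here refl)))
          (either p₂ q₂ (out (λ e∈ → apart N₁#N₂ e∈ p₂∈ refl)) (out (λ e∈ → apart N₁#N₂ e∈ q₂∈ refl)))
          (either r₁ s (out (λ e∈ → apart N₁#W e∈ r₁∈ refl)) (out (λ e∈ → apart N₁#W e∈ s∈W refl)))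
          (either s r₂ (out (λ e∈ → apart N₁#W e∈ s∈W refl)) (out (λ e∈ → apart N₁#W e∈ r₂∈ refl))))
        (avoid-path N₁-edges N₁-edges⊆
          (All.lookup ((proj₂ p₁ , x₁-on tail-p₁) ∷ (proj₂ q₁ , x₁-on tail-q₁) ∷ []))
          N₁-separate)
        where
        out : ∀ {e} → e ∉ N₁ → e List.∉ N₁-edges
        out = ∉-outside N₁-edges⊆

      hubs-N₂ : ∀ {e} → e List.∈ N₂-edges → Hubs e
      hubs-N₂ {e} e∈ = lift-hubs e N₂-edges e∈ (reach-new new₂ new₂∈ (inj₂ (inj₁ refl)))
        (allowed-coherent pf N₂-edges
          (either p₁ q₁ (out (λ e∈ → apart N₁#N₂ p₁∈ e∈ refl)) (out (λ e∈ → apart N₁#N₂ q₁∈ e∈ refl)))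
          (neither p₂ q₂ (here refl) (there (here refl)))
          (either r₁ s (out (λ e∈ → apart N₂#W e∈ r₁∈ refl)) (out (λ e∈ → apart N₂#W e∈ s∈W refl)))
          (either s r₂ (out (λ e∈ → apart N₂#W e∈ s∈W refl)) (out (λ e∈ → apart N₂#W e∈ r₂∈ refl))))
        (avoid-path N₂-edges N₂-edges⊆
          (All.lookup ((proj₂ p₂ , x₂-on tail-p₂) ∷ (proj₂ q₂ , x₂-on tail-q₂) ∷ []))
          N₂-separate)
        where
        out : ∀ {e} → e ∉ N₂ → e List.∉ N₂-edges
        out = ∉-outside N₂-edges⊆

      hubs-W : ∀ {e} → e List.∈ W-edges → Hubs e
      hubs-W {e} e∈ = lift-hubs e W-edges e∈ (reach-new new₃ new₃∈ (inj₂ (inj₂ refl)))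
        (allowed-coherent pf W-edges
          (either p₁ q₁ (out (λ e∈ → apart N₁#W p₁∈ e∈ refl)) (out (λ e∈ → apart N₁#W q₁∈ e∈ refl)))
          (either p₂ q₂ (out (λ e∈ → apart N₂#W p₂∈ e∈ refl)) (out (λ e∈ → apart N₂#W q₂∈ e∈ refl)))
          (neither r₁ s (here refl) (there (here refl)))
          (neither s r₂ (there (here refl)) (there (there (here refl)))))
        (avoid-path W-edges W-edges⊆
          (All.lookup ((proj₂ r₁ , y₁-on tail-r₁) ∷ (proj₂ s , y₁-on tail-s) ∷ (proj₂ r₂ , y₂-on tail-r₂) ∷ []))
          W-separate)
        where
        out : ∀ {e} → e ∉ W → e List.∉ W-edges
        out = ∉-outside W-edges⊆

      N₁-deletable : ∀ a b → (a ≡ p₁ × b ≡ q₁) ⊎ (a ≡ q₁ × b ≡ p₁) →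
                     (0ℤ ℤ.< φ a × Directed o t₁) ⊎ (0ℤ ℤ.< φ (rev a) × Directed o (rev t₁)) →
                     Deletable G o (edge a)
      N₁-deletable a b ab dir =
        let open Without (edge a) (hubs-N₁ (proj₁ (member ab)))
            a∈ = proj₂ (member ab)
            (ly₁ , ly₂) = y-linked (apart N₁#W a∈ r₁∈ ∘ sym) (apart N₁#W a∈ r₂∈ ∘ sym) (apart N₁#W a∈ s∈W ∘ sym)
        in all-linked (E₁.x₁-linked-without a b ab refl dir ly₁) ly₁
             (E₂.x₁-linked (apart N₁#N₂ a∈ p₂∈ ∘ sym) (apart N₁#N₂ a∈ q₂∈ ∘ sym)) ly₂
        where
        member : (a ≡ p₁ × b ≡ q₁) ⊎ (a ≡ q₁ × b ≡ p₁) → edge a List.∈ N₁-edges × edge a ∈ N₁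
        member (inj₁ (refl , _)) = here refl , p₁∈
        member (inj₂ (refl , _)) = there (here refl) , q₁∈

      N₂-deletable : ∀ a b → (a ≡ p₂ × b ≡ q₂) ⊎ (a ≡ q₂ × b ≡ p₂) →
                     (0ℤ ℤ.< φ a × Directed o t₂) ⊎ (0ℤ ℤ.< φ (rev a) × Directed o (rev t₂)) →
                     Deletable G o (edge a)
      N₂-deletable a b ab dir =
        let open Without (edge a) (hubs-N₂ (proj₁ (member ab)))
            a∈ = proj₂ (member ab)
            (ly₁ , ly₂) = y-linked (apart N₂#W a∈ r₁∈ ∘ sym) (apart N₂#W a∈ r₂∈ ∘ sym) (apart N₂#W a∈ s∈W ∘ sym)
        in all-linked (E₁.x₁-linked (apart N₁#N₂ p₁∈ a∈) (apart N₁#N₂ q₁∈ a∈)) ly₁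
             (E₂.x₁-linked-without a b ab refl dir ly₂) ly₂
        where
        member : (a ≡ p₂ × b ≡ q₂) ⊎ (a ≡ q₂ × b ≡ p₂) → edge a List.∈ N₂-edges × edge a ∈ N₂
        member (inj₁ (refl , _)) = here refl , p₂∈
        member (inj₂ (refl , _)) = there (here refl) , q₂∈

      module _ {e : Fin m} (e∈ : e List.∈ W-edges) where
        open Without e (hubs-W e∈)
        private
          e∈W = W-edges⊆ e∈
          lx₁ = E₁.x₁-linked (apart N₁#W p₁∈ e∈W) (apart N₁#W q₁∈ e∈W)
          lx₂ = E₂.x₁-linked (apart N₂#W p₂∈ e∈W) (apart N₂#W q₂∈ e∈W)

        r-deletable : e ≡ edge r₁ ⊎ e ≡ edge r₂ →
                      (0ℤ ℤ.< φ s × Directed o t₁ × Directed o (rev t₂)) ⊎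
                      (0ℤ ℤ.< φ (rev s) × Directed o (rev t₁) × Directed o t₂) → Deletable G o e
        r-deletable e≡ (inj₁ (pos , dir₁ , dir₂)) =
          let (ly₁ , ly₂) = E₁.y-linked-without-r pos e≡ dir₁ dir₂ lx₁ lx₂ in all-linked lx₁ ly₁ lx₂ ly₂
        r-deletable e≡ (inj₂ (pos , dir₁ , dir₂)) =
          let (ly₂ , ly₁) = E₂.y-linked-without-r pos (Sum.swap e≡) dir₂ dir₁ lx₂ lx₁ in all-linked lx₁ ly₁ lx₂ ly₂

        s-deletable : e ≡ edge s →
                      (0ℤ ℤ.< φ s × Directed o (rev t₁) × Directed o t₂) ⊎
                      (0ℤ ℤ.< φ (rev s) × Directed o t₁ × Directed o (rev t₂)) → Deletable G o e
        s-deletable e≡ (inj₁ (pos , dir₁ , dir₂)) =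
          let (ly₁ , ly₂) = E₁.y-linked-without-s pos e≡ dir₁ dir₂ lx₁ lx₂ in all-linked lx₁ ly₁ lx₂ ly₂
        s-deletable e≡ (inj₂ (pos , dir₁ , dir₂)) =
          let (ly₂ , ly₁) = E₂.y-linked-without-s pos e≡ dir₂ dir₁ lx₂ lx₁ in all-linked lx₁ ly₁ lx₂ ly₂

    -- `τ₁` and `τ₂` prescribe the directions of x₁y₁ and x₂y₂, where the flow vanishes. Elsewhere
    -- the sign decides; `false` selects the dart `(e , false)`, whence the `not`.
    orient : (Dart m → ℤ) → Dart m → Dart m → Orientation m
    orient φ τ₁ τ₂ e =
      if does (e ≟ edge t₁) then proj₂ τ₁ else
      if does (e ≟ edge t₂) then proj₂ τ₂ else not (does (0ℤ ℤ.<? φ (e , false)))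

    t₁≢t₂ : edge t₂ ≢ edge t₁
    t₁≢t₂ eq = [ (λ t₂≡ → x₁≢x₂ (sym (cong (tail G) t₂≡))) , (λ t₂≡ → x₂≢y₁ (cong (tail G) t₂≡)) ]′
      (same-edge t₁ t₂ (sym eq))

    orient-t₁ : ∀ φ τ₁ τ₂ → edge τ₁ ≡ edge t₁ → Directed (orient φ τ₁ τ₂) τ₁
    orient-t₁ φ τ₁ τ₂ eq = if-true (dec-true (edge τ₁ ≟ edge t₁) eq)

    orient-t₂ : ∀ φ τ₁ τ₂ → edge τ₂ ≡ edge t₂ → Directed (orient φ τ₁ τ₂) τ₂
    orient-t₂ φ τ₁ τ₂ eq = trans
      (if-false (dec-false (edge τ₂ ≟ edge t₁) (λ eq′ → t₁≢t₂ (trans (sym eq) eq′))))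
      (if-true (dec-true (edge τ₂ ≟ edge t₂) eq))

    orient-directed : ∀ {φ} → PathFlow c φ → ∀ τ₁ τ₂ d → edge d ≢ edge t₁ → edge d ≢ edge t₂ →
                      0ℤ ℤ.< φ d → Directed (orient φ τ₁ τ₂) d
    orient-directed {φ} pf τ₁ τ₂ d ≢t₁ ≢t₂ pos = trans
      (if-false (dec-false (edge d ≟ edge t₁) ≢t₁)) (trans
      (if-false (dec-false (edge d ≟ edge t₂) ≢t₂)) (by-direction d pos))
      where
      by-direction : ∀ d → 0ℤ ℤ.< φ d → not (does (0ℤ ℤ.<? φ (edge d , false))) ≡ proj₂ d
      by-direction (e , false) pos = cong not (dec-true (0ℤ ℤ.<? φ (e , false)) pos)
      by-direction (e , true)  pos = cong not (dec-false (0ℤ ℤ.<? φ (e , false))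
        (λ pos′ → not-both pos (subst (0ℤ ℤ.<_) (PathFlow.anti pf (e , true)) pos′)))

    zero-on : ∀ d → edge d ≡ edge t₁ ⊎ edge d ≡ edge t₂ → f d ≡ 0ℤ × g d ≡ 0ℤ
    zero-on d (inj₁ refl) = unit-zero C o₂ d t₁∉C , unit-zero A o₁ d (λ d∈ → x₁-on refl (A-off t₁ d∈))
    zero-on d (inj₂ refl) = unit-zero C o₂ d Reflected.t₁∉C , unit-zero A o₁ d (λ d∈ → x₂-on refl (A-off t₂ d∈))

    positive-≢t : ∀ α β d → 0ℤ ℤ.< combine α β f g d → edge d ≢ edge t₁ × edge d ≢ edge t₂
    positive-≢t α β d pos = (λ eq → impossible (zero-on d (inj₁ eq))) , (λ eq → impossible (zero-on d (inj₂ eq)))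
      where
      impossible : f d ≡ 0ℤ × g d ≡ 0ℤ → ⊥
      impossible (f≡0 , g≡0) = ℤ.<-irrefl refl (subst (0ℤ ℤ.<_) (trans
        (cong₂ (λ x y → α ℤ.* x ℤ.+ β ℤ.* y) f≡0 g≡0)
        (cong₂ ℤ._+_ (ℤ.*-zeroʳ α) (ℤ.*-zeroʳ β))) pos)

    O₁ O₂ : Orientation m
    O₁ = orient φ₁ t₁ (rev t₂)
    O₂ = orient φ₂ (rev t₁) t₂

    directed₁ : ∀ d → edge d ∈ E G → 0ℤ ℤ.< φ₁ d → Directed O₁ d
    directed₁ d _ pos = let (≢t₁ , ≢t₂) = positive-≢t 1ℤ -2ℤ d pos in
      orient-directed pf₁ t₁ (rev t₂) d ≢t₁ ≢t₂ pos

    directed₂ : ∀ d → edge d ∈ E G → 0ℤ ℤ.< φ₂ d → Directed O₂ d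
    directed₂ d _ pos = let (≢t₁ , ≢t₂) = positive-≢t 2ℤ 1ℤ d pos in
      orient-directed pf₂ (rev t₁) t₂ d ≢t₁ ≢t₂ pos

    module Side₁ = Side φ₁ pf₁ O₁ directed₁ reachable₁-new
    module Side₂ = Side φ₂ pf₂ O₂ directed₂ reachable₂-new

    t₁-out₁ : Directed O₁ t₁
    t₁-out₁ = orient-t₁ φ₁ t₁ (rev t₂) refl
    t₂-in₁ : Directed O₁ (rev t₂)
    t₂-in₁ = orient-t₂ φ₁ t₁ (rev t₂) refl
    t₁-in₂ : Directed O₂ (rev t₁)
    t₁-in₂ = orient-t₁ φ₂ (rev t₁) t₂ refl
    t₂-out₂ : Directed O₂ t₂
    t₂-out₂ = orient-t₂ φ₂ (rev t₁) t₂ refl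

    on-path : ∀ d → edge d ∈ C → ¬ OffPath (tail G d) → 0ℤ ℤ.< φ₁ d → 0ℤ ℤ.< φ₂ d
    on-path d d∈ on = positive-transfer (f-path d d∈) (g-path d on)

    on-path′ : ∀ d → edge d ∈ C → ¬ OffPath (tail G d) → 0ℤ ℤ.< φ₁ (rev d) → 0ℤ ℤ.< φ₂ (rev d)
    on-path′ d d∈ on = positive-transfer (f-path (rev d) d∈) (g-path′ d on)

    Covered : Fin m → Set
    Covered e = Deletable G O₁ e ⊎ Deletable G O₂ e

    -- An edge directed away from x₁ needs x₁ → y₁ as a substitute exit, which `O₁` offers; one
    -- directed towards x₁ needs y₁ → x₁ as a substitute entry, which `O₂` offers. Its own direction
    -- is the same in both.
    N₁-covered : ∀ a b → (a ≡ p₁ × b ≡ q₁) ⊎ (a ≡ q₁ × b ≡ p₁) → edge a ∈ C → ¬ OffPath (tail G a) →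
                 φ₁ a ≢ 0ℤ → Covered (edge a)
    N₁-covered a b ab a∈ on a≢0 =
      [ (λ pos → inj₁ (Side₁.N₁-deletable a b ab (inj₁ (pos , t₁-out₁))))
      , (λ pos → inj₂ (Side₂.N₁-deletable a b ab (inj₂ (on-path′ a a∈ on pos , t₁-in₂)))) ]′
      (pos-or-neg (PathFlow.anti pf₁ a) a≢0)

    -- The roles of the orientations are exchanged compared with `N₁`, as `O₁` directs x₂y₂ towards
    -- x₂ and x₁y₁ away from x₁.
    N₂-covered : ∀ a b → (a ≡ p₂ × b ≡ q₂) ⊎ (a ≡ q₂ × b ≡ p₂) → edge a ∈ C → ¬ OffPath (tail G a) →
                 φ₁ a ≢ 0ℤ → Covered (edge a)
    N₂-covered a b ab a∈ on a≢0 =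
      [ (λ pos → inj₂ (Side₂.N₂-deletable a b ab (inj₁ (on-path a a∈ on pos , t₂-out₂))))
      , (λ pos → inj₁ (Side₁.N₂-deletable a b ab (inj₂ (pos , t₂-in₁)))) ]′
      (pos-or-neg (PathFlow.anti pf₁ a) a≢0)

    s-sign : 0ℤ ℤ.< φ₁ s ⊎ 0ℤ ℤ.< φ₁ (rev s)
    s-sign = pos-or-neg (PathFlow.anti pf₁ s) (PathFlow.s≢0 pf₁)

    r-covered : ∀ {e} → e List.∈ Side₁.W-edges → e ≡ edge r₁ ⊎ e ≡ edge r₂ → Covered e
    r-covered e∈ e≡ =
      [ (λ pos → inj₁ (Side₁.r-deletable e∈ e≡ (inj₁ (pos , t₁-out₁ , t₂-in₁))))
      , (λ pos → inj₂ (Side₂.r-deletable e∈ e≡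
          (inj₂ (on-path′ s s∈C (y₁-on tail-s) pos , t₁-in₂ , t₂-out₂)))) ]′ s-sign

    -- For each sign of the flow, `s` is covered by the orientation that does not serve for `r₁` and
    -- `r₂`.
    s-covered : Covered (edge s)
    s-covered =
      [ (λ pos → inj₂ (Side₂.s-deletable (there (here refl)) refl
          (inj₁ (on-path s s∈C (y₁-on tail-s) pos , t₁-in₂ , t₂-out₂))))
      , (λ pos → inj₁ (Side₁.s-deletable (there (here refl)) refl (inj₂ (pos , t₁-out₁ , t₂-in₁)))) ]′ s-sign

    t-covered : ∀ e → e ≡ edge t₁ ⊎ e ≡ edge t₂ → Covered e
    t-covered e e≡ = inj₁ (Side₁.off-path-deletable e
        (C≢ (N₁⊆C p₁∈)) (C≢ (N₁⊆C q₁∈)) (C≢ (N₂⊆C p₂∈)) (C≢ (N₂⊆C q₂∈)) (C≢ (W⊆C r₁∈)) (C≢ (W⊆C r₂∈)) (C≢ s∈C)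
        -- Neither of the two edges occurs in a path represented by `H`, so it does not matter which
        -- edge of `H` is given up; `new₁` is one known to be deletable.
        (reachable₁-new new₁ new₁∈ (inj₁ refl))
        (λ d d∈ _ eq → let (≢t₁ , ≢t₂) = R-≢t d d∈ in [ (λ e≡ → ≢t₁ (trans eq e≡)) , (λ e≡ → ≢t₂ (trans eq e≡)) ]′ e≡))
      where
      C≢ : ∀ {f} → f ∈ C → f ≢ e
      C≢ f∈ refl = [ proj₁ (C-≢t f∈) , proj₂ (C-≢t f∈) ]′ e≡

    off-covered : ∀ e → e ∈ E G → (∀ b → OffPath (tail G (e , b))) → Covered e
    off-covered e e∈ off = Sum.map
        (λ one → Side₁.off-path-deletable e p₁≢ q₁≢ p₂≢ q₂≢ r₁≢ r₂≢ s≢ (reachable₁ d d∈ (transport φ₁ one)) avoid)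
        (λ one → Side₂.off-path-deletable e p₁≢ q₁≢ p₂≢ q₂≢ r₁≢ r₂≢ s≢ (reachable₂ d d∈ (transport φ₂ one)) avoid)
        (some-value-unit (values (e , false) e∈ (proj₁ (off-≢t (e , false) (off false))) (proj₂ (off-≢t (e , false) (off false)))))
      where
      d = old⁴ (e , false)
      d∈ : edge d ∈ E H
      d∈ = old⁴∈ e∈ off
      transport : ∀ φ → ℤ.∣ φ (e , false) ∣ ≡ 1 → ℤ.∣ φ (R d) ∣ ≡ 1
      transport φ = subst (λ a → ℤ.∣ φ a ∣ ≡ 1) (sym (R-old (e , false)))
      on≢ : ∀ a → ¬ OffPath (tail G a) → edge a ≢ e
      on≢ (_ , b) on refl = on (off b)
      p₁≢ = on≢ p₁ (x₁-on tail-p₁)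
      q₁≢ = on≢ q₁ (x₁-on tail-q₁)
      p₂≢ = on≢ p₂ (x₂-on tail-p₂)
      q₂≢ = on≢ q₂ (x₂-on tail-q₂)
      r₁≢ = on≢ r₁ (y₁-on tail-r₁)
      r₂≢ = on≢ r₂ (y₂-on tail-r₂)
      s≢  = on≢ s (y₁-on tail-s)
      avoid : ∀ d′ → edge d′ ∈ E H → edge d′ ≢ edge d → edge (R d′) ≢ e
      avoid d′ d′∈ ≢d eq with view d′ d′∈
      ... | new n = on≢ (rev (R d′)) (path-on (R-new (new-dart d′ n))) eq
      ... | old d₀ _ _ = ≢d (cong (λ f → suc (suc (suc (suc f)))) (trans (sym (cong edge (R-old d₀))) eq))

    covered-at : ∀ d → edge d ∈ E G → OffPath (tail G d) ⊎ Covered (edge d)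
    covered-at d d∈ with tail G d ≟ x₁ | tail G d ≟ y₁ | tail G d ≟ x₂ | tail G d ≟ y₂
    ... | no ≢x₁ | no ≢y₁ | no ≢x₂ | no ≢y₂ = inj₁ (≢x₁ , ≢y₁ , ≢x₂ , ≢y₂)
    ... | yes eq | _ | _ | _ = inj₂ (case only-x₁ d (d∈ , eq) of λ
      { (inj₁ refl) → t-covered _ (inj₁ refl)
      ; (inj₂ (inj₁ refl)) → N₁-covered p₁ q₁ (inj₁ (refl , refl)) (N₁⊆C p₁∈) (x₁-on tail-p₁) (PathFlow.p₁≢0 pf₁)
      ; (inj₂ (inj₂ refl)) → N₁-covered q₁ p₁ (inj₂ (refl , refl)) (N₁⊆C q₁∈) (x₁-on tail-q₁)
          (value₁≢0 (C-only (f-path q₁ (N₁⊆C q₁∈)) (g-path q₁ (x₁-on tail-q₁)))) })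
    ... | no _ | yes eq | _ | _ = inj₂ (case only-y₁ d (d∈ , eq) of λ
      { (inj₁ refl) → t-covered _ (inj₁ refl)
      ; (inj₂ (inj₁ refl)) → r-covered (here refl) (inj₁ refl)
      ; (inj₂ (inj₂ refl)) → s-covered })
    ... | no _ | no _ | yes eq | _ = inj₂ (case Reflected.only-x₁ d (d∈ , eq) of λ
      { (inj₁ refl) → t-covered _ (inj₂ refl)
      ; (inj₂ (inj₁ refl)) → N₂-covered p₂ q₂ (inj₁ (refl , refl)) (N₂⊆C p₂∈) (x₂-on tail-p₂) (PathFlow.p₂≢0 pf₁)
      ; (inj₂ (inj₂ refl)) → N₂-covered q₂ p₂ (inj₂ (refl , refl)) (N₂⊆C q₂∈) (x₂-on tail-q₂)
          (value₁≢0 (C-only (f-path q₂ (N₂⊆C q₂∈)) (g-path q₂ (x₂-on tail-q₂)))) })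
    ... | no _ | no _ | no _ | yes eq = inj₂ (case Reflected.only-y₁ d (d∈ , eq) of λ
      { (inj₁ refl) → t-covered _ (inj₂ refl)
      ; (inj₂ (inj₁ refl)) → r-covered (there (there (here refl))) (inj₂ refl)
      ; (inj₂ (inj₂ refl)) → s-covered })

    covered : ∀ e → e ∈ E G → Covered e
    covered e e∈ with covered-at (e , false) e∈ | covered-at (e , true) e∈
    ... | inj₂ cov | _        = cov
    ... | inj₁ _   | inj₂ cov = cov
    ... | inj₁ off | inj₁ off′ = off-covered e e∈ λ { false → off ; true → off′ }

    covered-by-two : CoveredByOrientations G 2
    covered-by-two = (λ { zero → O₁ ; (suc zero) → O₂ }) , λ e e∈ →
      [ (λ d → zero , d) , (λ d → suc zero , d) ]′ (covered e e∈)

-- One orientation does not suffice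

module LowerBound {G : Graph n m} (c : Configuration G) where
  open Configuration c
  open Facts c

  first-arc : ∀ {o : Orientation m} {e u v} → Star (Arc (G ∖ ⁅ e ⁆) o) u v → u ≢ v →
              ∃[ d ] At G (E G) u d × edge d ≢ e × Directed o d
  first-arc ε u≢u = contradiction refl u≢u
  first-arc {o} {e} ((f , f∈ , t , _) ◅ _) _ =
    let (f∈E , f≢e) = ∈- (E G) f∈ in
    (f , o f) , (f∈E , trans (sym (tail-∖ G ⁅ e ⁆ (f , o f))) t) , f≢e , refl

  last-arc : ∀ {o : Orientation m} {e u v} → Star (Arc (G ∖ ⁅ e ⁆) o) u v → u ≢ v →
             ∃[ d ] At G (E G) v d × edge d ≢ e × ¬ Directed o d
  last-arc ε u≢u = contradiction refl u≢u
  last-arc {o} {e} {v = v} ((f , f∈ , _ , h) ◅ rest) _ = go rest f∈ h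
    where
    go : ∀ {w f} → Star (Arc (G ∖ ⁅ e ⁆) o) w v → f ∈ E G ─ ⁅ e ⁆ → head (G ∖ ⁅ e ⁆) (f , o f) ≡ w →
         ∃[ d ] At G (E G) v d × edge d ≢ e × ¬ Directed o d
    go {f = f} ε f∈ h =
      let (f∈E , f≢e) = ∈- (E G) f∈ in
      (f , not (o f)) , (f∈E , trans (sym (tail-∖ G ⁅ e ⁆ (f , not (o f)))) h) , f≢e , Bool.not-¬ refl
    go ((f , f∈ , _ , h) ◅ rest) _ _ = go rest f∈ h

  -- Two outgoing and two incoming edges do not fit at the vertex x₁ of degree 3.
  not-all-deletable : (o : Orientation m) → ¬ (∀ e → e ∈ E G → Deletable G o e)
  not-all-deletable o all =
    -- Deleting `t₁` yields an outgoing dart `a`, and deleting `a` in turn yields a second outgoing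
    -- one; likewise for the incoming darts.
    let (a , a-at , _ , a-dir)   = out t₁ (t₁∈ , refl)
        (b , b-at , b≢a , b-dir) = out a a-at
        (d , d-at , _ , d-in)    = into t₁ (t₁∈ , refl)
        (f , f-at , f≢d , f-in)  = into d d-at
    in case length≤3 (dartsAt G (E G) x₁) (ℕ.≤-reflexive (cubic x₁ x₁∈V))
              (λ eq → b≢a (sym (cong edge eq))) (λ eq → d-in (subst (Directed o) eq a-dir))
              (λ eq → d-in (subst (Directed o) eq b-dir))
              (∈-dartsAt G (E G) x₁ {a} a-at) (∈-dartsAt G (E G) x₁ {b} b-at)
              (∈-dartsAt G (E G) x₁ {d} d-at) (∈-dartsAt G (E G) x₁ {f} f-at) of λ
       { (inj₁ f≡a) → f-in (subst (Directed o) (sym f≡a) a-dir)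
       ; (inj₂ (inj₁ f≡b)) → f-in (subst (Directed o) (sym f≡b) b-dir)
       ; (inj₂ (inj₂ f≡d)) → f≢d (cong edge f≡d) }
    where
    x₁∈V = tail∈V G t₁ t₁∈
    y₁∈V = tail∈V G (rev t₁) t₁∈
    out : ∀ a → At G (E G) x₁ a → ∃[ d ] At G (E G) x₁ d × edge d ≢ edge a × Directed o d
    out a (a∈ , _) = first-arc (all (edge a) a∈ x₁ y₁ x₁∈V y₁∈V x₁≢y₁) x₁≢y₁
    into : ∀ a → At G (E G) x₁ a → ∃[ d ] At G (E G) x₁ d × edge d ≢ edge a × ¬ Directed o d
    into a (a∈ , _) = last-arc (all (edge a) a∈ y₁ x₁ y₁∈V x₁∈V (x₁≢y₁ ∘ sym)) (x₁≢y₁ ∘ sym)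

  two≤ : ∀ j → CoveredByOrientations G j → 2 ≤ j
  two≤ zero (_ , cover) with cover (edge t₁) t₁∈
  ... | () , _
  two≤ (suc zero) (os , cover) = contradiction
    (λ e e∈ → case cover e e∈ of λ { (zero , del) → del }) (not-all-deletable (os zero))
  two≤ (suc (suc j)) _ = s≤s (s≤s z≤n)

-- From the hypotheses of the theorem to the configuration

module Conclusion {G : Graph n m} (c : Configuration G) {M : Subset m}
  (maximum : MaximumMatching G (deleteVertices G (Configuration.C c) (PerfectMatching.path-vertices c)) M)
  (o₁ o₂ : Orientation m)
  (smooth-A : SmoothOn G (Flows.A c maximum o₁ o₂) o₁) (smooth-C : SmoothOn G (Configuration.C c) o₂)
  {G₁ : Graph n (2 + m)}
  (T₁ : Tilde G (edge (Configuration.t₁ c)) G₁ (Configuration.x₁ c) (Configuration.y₁ c)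
          (Configuration.p₁ c) (Configuration.q₁ c) (Configuration.r₁ c) (Configuration.s c))
  {H : Graph n (4 + m)}
  (T₂ : Tilde G₁ (Smoothings.Reduced.e₂ c T₁) H (Configuration.x₂ c) (Configuration.y₂ c)
          (suc-dart (suc-dart (Configuration.p₂ c))) (suc-dart (suc-dart (Configuration.q₂ c)))
          (suc-dart (suc-dart (Configuration.r₂ c))) (rev (Tilde.β T₁)))
  (agree : ∀ e →
      (e ∈ Configuration.N₁ c × ¬ Incident G e (Configuration.x₁ c) ×
        (Incident G e (head G (Configuration.p₁ c)) ⊎ Incident G e (head G (Configuration.q₁ c))))
    ⊎ (e ∈ Configuration.N₂ c × ¬ Incident G e (Configuration.x₂ c) ×
        (Incident G e (head G (Configuration.p₂ c)) ⊎ Incident G e (head G (Configuration.q₂ c))))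
    ⊎ (e ∈ Configuration.W c × ¬ Incident G e (Configuration.y₁ c) × ¬ Incident G e (Configuration.y₂ c) ×
        (Incident G e (head G (Configuration.r₁ c)) ⊎ Incident G e (head G (Configuration.r₂ c)))) →
    o₁ e ≡ o₂ e)
  (connected : CyclicallyEdgeConnected 3 H)
  (no-cut : ∀ (i : Fin 4) (f₂ f₃ : Fin m) →
    Joins H (i ↑ˡ m) (head G (Configuration.p₁ c)) (head G (Configuration.q₁ c)) ⊎
    Joins H (i ↑ˡ m) (head G (Configuration.p₂ c)) (head G (Configuration.q₂ c)) ⊎
    Joins H (i ↑ˡ m) (head G (Configuration.r₁ c)) (head G (Configuration.r₂ c)) →
    f₂ ∈ Flows.A c maximum o₁ o₂ → f₃ ∈ Flows.A c maximum o₁ o₂ →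
    ∣ ⁅ i ↑ˡ m ⁆ ∪ ⁅ 4 ↑ʳ f₂ ⁆ ∪ ⁅ 4 ↑ʳ f₃ ⁆ ∣ ≡ 3 →
    ¬ CycleSeparatingCut H (⁅ i ↑ˡ m ⁆ ∪ ⁅ 4 ↑ʳ f₂ ⁆ ∪ ⁅ 4 ↑ʳ f₃ ⁆))
  where

  open Configuration c
  open Facts c using (vertex; circuit-closed)
  open PerfectMatching c using (M⊆C; M-off)
  open Flows c maximum o₁ o₂ using (A; M⊆A; f; g)
  open Core c maximum o₁ o₂ smooth-A smooth-C T₁ T₂

  agree-unit : ∀ d → edge d ∈ M → o₁ (edge d) ≡ o₂ (edge d) → f d ≡ g d
  agree-unit d d∈ eq = trans (unit-on C o₂ d (M⊆C maximum d∈)) (trans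
    (cong (λ b → if does (b Bool.≟ proj₂ d) then 1ℤ else -1ℤ) (sym eq))
    (sym (unit-on A o₁ d (M⊆A d∈))))

  in-circuit : ∀ {D} → Circuit G D → D ⊆ C → ∀ a d → edge a ∈ D → edge d ∈ M → head G a ≡ tail G d → edge d ∈ D
  in-circuit circuit D⊆C a d a∈ d∈ eq =
    circuit-closed circuit D⊆C (vertex (rev a) a∈ refl) d (M⊆C maximum d∈ , sym eq)

  -- A matching edge at u₁, v₁, u₂, v₂, w₁ or w₂ lies on the same circuit as that vertex and avoids
  -- the path, so it belongs to Z, where the orientations agree.
  agree-Z : ∀ d → edge d ∈ M → NearPath (tail G d) → f d ≡ g d
  agree-Z d@(e , b) d∈ (_ , near , eq) = agree-unit d d∈ (agree e (in-Z near eq))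
    where
    off : ∀ b′ → OffPath (tail G (e , b′))
    off b′ = M-off maximum (e , b′) d∈
    in-Z : ∀ {a} → PathDart a → tail G a ≡ tail G d → _
    in-Z via-p₁ eq = inj₁ (in-circuit circuit₁ N₁⊆C p₁ d p₁∈ d∈ eq ,
      (λ (b′ , t) → proj₁ (off b′) t) , inj₁ (b , sym eq))
    in-Z via-q₁ eq = inj₁ (in-circuit circuit₁ N₁⊆C q₁ d q₁∈ d∈ eq ,
      (λ (b′ , t) → proj₁ (off b′) t) , inj₂ (b , sym eq))
    in-Z via-p₂ eq = inj₂ (inj₁ (in-circuit circuit₂ N₂⊆C p₂ d p₂∈ d∈ eq ,
      (λ (b′ , t) → proj₁ (proj₂ (proj₂ (off b′))) t) , inj₁ (b , sym eq)))
    in-Z via-q₂ eq = inj₂ (inj₁ (in-circuit circuit₂ N₂⊆C q₂ d q₂∈ d∈ eq ,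
      (λ (b′ , t) → proj₁ (proj₂ (proj₂ (off b′))) t) , inj₂ (b , sym eq)))
    in-Z via-r₁ eq = inj₂ (inj₂ (in-circuit circuit-W W⊆C r₁ d r₁∈ d∈ eq ,
      (λ (b′ , t) → proj₁ (proj₂ (off b′)) t) , (λ (b′ , t) → proj₂ (proj₂ (proj₂ (off b′))) t) , inj₁ (b , sym eq)))
    in-Z via-r₂ eq = inj₂ (inj₂ (in-circuit circuit-W W⊆C r₂ d r₂∈ d∈ eq ,
      (λ (b′ , t) → proj₁ (proj₂ (off b′)) t) , (λ (b′ , t) → proj₂ (proj₂ (proj₂ (off b′))) t) , inj₂ (b , sym eq)))

  frank-number : FrankNumber G 2
  frank-number =
    covered-by-two agree-Z connected
      (λ i f₂ f₃ new f₂∈ f₃∈ → no-cut i f₂ f₃ (new-joins new) f₂∈ f₃∈) ,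
    LowerBound.two≤ c

theorem4 :
  ∀ {n m : ℕ} (G : Graph n m) →
  Cubic G →
  CyclicallyEdgeConnected 4 G →
  (C N₁ N₂ W : Subset m) →
  TwoFactor G C →
  Circuit G N₁ → N₁ ⊆ C → OddSize N₁ →
  Circuit G N₂ → N₂ ⊆ C → OddSize N₂ →
  N₁ ≢ N₂ →
  (∀ D → Circuit G D → D ⊆ C → OddSize D → D ≡ N₁ ⊎ D ≡ N₂) →
  Circuit G W → W ⊆ C → EvenSize W →
  (x₁ x₂ y₁ y₂ : Fin n) (x₁y₁ y₁y₂ x₂y₂ : Fin m) →
  x₁y₁ ∈ E G → Joins G x₁y₁ x₁ y₁ →
  y₁y₂ ∈ E G → Joins G y₁y₂ y₁ y₂ →
  x₂y₂ ∈ E G → Joins G x₂y₂ x₂ y₂ →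
  VertexOf G N₁ x₁ → VertexOf G N₂ x₂ →
  VertexOf G W y₁ → VertexOf G W y₂ →
  (u₁ v₁ u₂ v₂ w₁ w₂ : Fin n) →
  Adjacent G N₁ x₁ u₁ → Adjacent G N₁ x₁ v₁ → u₁ ≢ v₁ →
  Adjacent G N₂ x₂ u₂ → Adjacent G N₂ x₂ v₂ → u₂ ≢ v₂ →
  Adjacent G W y₁ w₁ → w₁ ≢ y₂ →
  Adjacent G W y₂ w₂ → w₂ ≢ y₁ →
  (M : Subset m) →
  MaximumMatching G (deleteVertices G C (⁅ x₁ ⁆ ∪ ⁅ y₁ ⁆ ∪ ⁅ y₂ ⁆ ∪ ⁅ x₂ ⁆)) M →
  let F = E G ─ C
      A = (F ─ (⁅ x₁y₁ ⁆ ∪ ⁅ x₂y₂ ⁆)) ∪ M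
      inZ = λ (e : Fin m) →
          (e ∈ N₁ × ¬ Incident G e x₁ × (Incident G e u₁ ⊎ Incident G e v₁))
        ⊎ (e ∈ N₂ × ¬ Incident G e x₂ × (Incident G e u₂ ⊎ Incident G e v₂))
        ⊎ (e ∈ W × ¬ Incident G e y₁ × ¬ Incident G e y₂ ×
           (Incident G e w₁ ⊎ Incident G e w₂))
      H = G ∼ x₁y₁ ∼ (2 ↑ʳ x₂y₂)
  in
  -- (i)
  (∃₂ λ (o₁ o₂ : Orientation m) →
     SmoothOn G A o₁ × SmoothOn G C o₂ × (∀ e → inZ e → o₁ e ≡ o₂ e)) →
  -- (ii)
  CyclicallyEdgeConnected 3 H →
  -- (iii): labels i ↑ˡ m are those of the new edges of H, and 4 ↑ʳ f is the
  -- label in H of the edge f of G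
  (∀ (i : Fin 4) (f₂ f₃ : Fin m) →
     Joins H (i ↑ˡ m) u₁ v₁ ⊎ Joins H (i ↑ˡ m) u₂ v₂ ⊎ Joins H (i ↑ˡ m) w₁ w₂ →
     f₂ ∈ A → f₃ ∈ A →
     let K = ⁅ i ↑ˡ m ⁆ ∪ ⁅ 4 ↑ʳ f₂ ⁆ ∪ ⁅ 4 ↑ʳ f₃ ⁆ in
     ∣ K ∣ ≡ 3 → ¬ CycleSeparatingCut H K) →
  FrankNumber G 2
theorem4 {n} {m} G cubic _ C N₁ N₂ W factor circuit₁ N₁⊆C odd₁ circuit₂ N₂⊆C odd₂ N₁≢N₂ odd-circuits
  circuit-W W⊆C even-W _ _ _ _ x₁y₁ y₁y₂ x₂y₂ t₁∈ (bt₁ , refl , refl) s∈ (bs , tail-s , head-s)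
  t₂∈ (bt₂ , refl , refl) _ _ _ _ _ _ _ _ _ _
  (ep₁ , p₁∈ , bp₁ , tail-p₁ , refl) (eq₁ , q₁∈ , bq₁ , tail-q₁ , refl) p₁≢q₁
  (ep₂ , p₂∈ , bp₂ , tail-p₂ , refl) (eq₂ , q₂∈ , bq₂ , tail-q₂ , refl) p₂≢q₂
  (er₁ , r₁∈ , br₁ , tail-r₁ , refl) r₁≢y₂ (er₂ , r₂∈ , br₂ , tail-r₂ , refl) r₂≢y₁
  M maximum (o₁ , o₂ , smooth-A , smooth-C , agree) connected no-cut =
  Conclusion.frank-number c maximum o₁ o₂ smooth-A smooth-C
    {G₁ = G ∼ x₁y₁} T₁ {H = G ∼ x₁y₁ ∼ (2 ↑ʳ x₂y₂)} T₂ agree connected no-cut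
  where
  c : Configuration G
  c = record
    { cubic = cubic ; C = C ; N₁ = N₁ ; N₂ = N₂ ; W = W ; factor = factor
    ; circuit₁ = circuit₁ ; circuit₂ = circuit₂ ; circuit-W = circuit-W
    ; N₁⊆C = N₁⊆C ; N₂⊆C = N₂⊆C ; W⊆C = W⊆C ; odd₁ = odd₁ ; odd₂ = odd₂ ; even-W = even-W
    ; N₁≢N₂ = N₁≢N₂ ; odd-circuits = odd-circuits
    ; p₁ = ep₁ , bp₁ ; q₁ = eq₁ , bq₁ ; t₁ = x₁y₁ , bt₁ ; r₁ = er₁ , br₁
    ; p₂ = ep₂ , bp₂ ; q₂ = eq₂ , bq₂ ; t₂ = x₂y₂ , bt₂ ; r₂ = er₂ , br₂ ; s = y₁y₂ , bs
    ; p₁∈ = p₁∈ ; q₁∈ = q₁∈ ; p₂∈ = p₂∈ ; q₂∈ = q₂∈ ; r₁∈ = r₁∈ ; r₂∈ = r₂∈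
    ; t₁∈ = t₁∈ ; t₂∈ = t₂∈ ; s∈ = s∈
    ; tail-p₁ = tail-p₁ ; tail-q₁ = tail-q₁ ; tail-p₂ = tail-p₂ ; tail-q₂ = tail-q₂
    ; tail-r₁ = tail-r₁ ; tail-r₂ = tail-r₂ ; tail-s = tail-s ; head-s = head-s
    ; p₁≢q₁ = p₁≢q₁ ; p₂≢q₂ = p₂≢q₂ ; r₁≢y₂ = r₁≢y₂ ; r₂≢y₁ = r₂≢y₁
    }
  T₁ = Smoothings.first-tilde c x₁y₁ refl
  T₂ = Smoothings.Reduced.second-tilde c {G₁ = G ∼ x₁y₁} T₁ (2 ↑ʳ x₂y₂) refl
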